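{- Let $\mathcal{GA}_n$ be the set of nonsingular $2^n\times 2^n$ signature matrices of affine functions of arity $2n$, and let $\mathcal{C}_n$ be the Clifford group on $n$ qubits. Then the set of nonsingular affine signatures is exactly the set of Clifford gates, namely $$\mathcal{GA}_n/U(1)=\mathcal{C}_n.$$
   Context: Affine functions. A function $f:\{0,1\}^k\to\mathbb{C}$ is affine if there are $\lambda\in\mathbb{C}$, a matrix $A$ over $\mathbb{F}_2$ with $k+1$ columns, and finitely many vectors $\boldsymbol{\alpha}_1,\dots,\boldsymbol{\alpha}_m\in\mathbb{F}_2^{k+1}$ such that, with $\mathbf{x}=(x_1,\dots,x_k,1)^{\mathsf T}$, $$f(x_1,\dots,x_k)=\lambda\,\chi_{A\mathbf{x}=0}\cdot i^{\sum_{j=1}^m\langle\boldsymbol{\alpha}_j,\mathbf{x}\rangle},\qquad i=\sqrt{ -1}.$$ Here $\chi_{A\mathbf{x}=0}$ is $1$ if $A\mathbf{x}=0$ over $\mathbb{F}_2$ and $0$ otherwise; each $\langle\boldsymbol{\alpha}_j,\mathbf{x}\rangle$ is computed in $\mathbb{F}_2$ and then regarded as the integer $0$ or $1$, and the outer sum is a sum mod 4 of these 0-1 terms. The set of all affine functions (of all arities) is $\mathscr{A}$. Signature matrix. For $f:\{0,1\}^{2n}\to\mathbb{C}$, $M_f$ is the $2^n\times2^n$ matrix with rows and columns indexed by $\{0,1\}^n$ whose entry in row $(x_1,\dots,x_n)$ and column $(x_{2n},x_{2n-1},\dots,x_{n+1})$ is $f(x_1,\dots,x_{2n})$. Set $\mathcal{A}_n=\{M_f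 : f\in\mathscr{A},\ f \text{ of arity } 2n\}$ and $\mathcal{GA}_n=GL_{2^n}(\mathbb{C})\cap\mathcal{A}_n$, where $GL_k(\mathbb{C})$ is the group of nonsingular $k\times k$ complex matrices. Pauli group. Let $I=\begin{bmatrix}1&0\\0&1\end{bmatrix}$, $X=\begin{bmatrix}0&1\\1&0\end{bmatrix}$, $Y=\begin{bmatrix}0&-i\\i&0\end{bmatrix}$, $Z=\begin{bmatrix}1&0\\0&-1\end{bmatrix}$. The Pauli group $\mathcal{P}_n$ is the group generated by all $\sigma_1\otimes\cdots\otimes\sigma_n$ with $\sigma_k\in\{I,X,Y,Z\}$; equivalently it consists of these tensor products multiplied by $\pm1$ or $\pm i$. Clifford group. $U(k)$ is the group of $k\times k$ unitary matrices, and $U(1)=\{z\in\mathbb{C} : |z|=1\}$ is identified with the scalar matrices $zI_{2^n}$, $|z|=1$. With $U^*$ the conjugate transpose of $U$, $$\mathcal{C}_n=\{U\in U(2^n) : \sigma\in\mathcal{P}_n\Rightarrow U\sigma U^*\in\mathcal{P}_n\}/U(1).$$ The quotient $/U(1)$ means that matrices differing by a scalar factor of norm one are identified.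
   Formalization: Since λ is arbitrary, 2·I is a nonsingular affine signature but not unitary, so the equation fails as written. Proved instead: every nonsingular affine signature is unitary after multiplication by a nonzero scalar, and the unitary ones modulo U(1) are exactly the Clifford group. -}

module Defs where

open import Algebra.Bundles using (CommutativeMonoid)
import Algebra.Properties.CommutativeSemigroup as CommutativeSemigroupProperties
open import Data.Bool.Base using (Bool; true; false; _∧_; _xor_; not; if_then_else_)
open import Data.Bool.ListAction using (all)
open import Data.List.Base using (List; map)
open import Data.Nat.Base as ℕ using (ℕ; zero; suc; _⊔_)
open import Data.Nat.ListAction using (sum)
import Data.Nat.Properties as ℕ
open import Data.Product.Base using (∃; ∃-syntax; _×_; _,_)
open import Data.Rational.Base as ℚ using (ℚ; 0ℚ; 1ℚ; ½; ∣_∣)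
import Data.Rational.Properties as ℚ
open import Data.Vec.Base using (Vec; []; _∷_; _∷ʳ_; _++_; reverse; zipWith; foldr′)
open import Level using (0ℓ)
open import Relation.Binary.PropositionalEquality
  using (_≡_; refl; sym; trans; cong; cong₂; subst)
open import Relation.Unary using (Pred)

-- Real numbers: Cauchy sequences of rationals modulo null sequences.
-- Equality of reals is the equivalence relation _≈ℝ_.

IsCauchy : (ℕ → ℚ) → Set
IsCauchy s = ∀ ε → 0ℚ ℚ.< ε →
  ∃[ N ] (∀ m n → N ℕ.≤ m → N ℕ.≤ n → ∣ s m ℚ.- s n ∣ ℚ.< ε)

record ℝ : Set where
  constructor mkℝ
  field
    seq    : ℕ → ℚ
    cauchy : IsCauchy seq

open ℝ public

infix 4 _≈ℝ_

record _≈ℝ_ (x y : ℝ) : Set where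
  constructor mk≈ℝ
  field
    null : ∀ ε → 0ℚ ℚ.< ε →
      ∃[ N ] (∀ n → N ℕ.≤ n → ∣ seq x n ℚ.- seq y n ∣ ℚ.< ε)

private
  open CommutativeSemigroupProperties
    (CommutativeMonoid.commutativeSemigroup ℚ.+-0-commutativeMonoid) using (interchange)

  half-pos : ∀ {ε} → 0ℚ ℚ.< ε → 0ℚ ℚ.< ½ ℚ.* ε
  half-pos {ε} 0<ε = subst (ℚ._< ½ ℚ.* ε) (ℚ.*-zeroʳ ½) (ℚ.*-monoʳ-<-pos ½ 0<ε)

  half+half : ∀ ε → ½ ℚ.* ε ℚ.+ ½ ℚ.* ε ≡ ε
  half+half ε = trans (sym (ℚ.*-distribʳ-+ ε ½ ½)) (ℚ.*-identityˡ ε)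

  const-cauchy : ∀ q → IsCauchy (λ _ → q)
  const-cauchy q ε 0<ε =
    0 , λ _ _ _ _ → subst (ℚ._< ε) (cong ∣_∣ (sym (ℚ.+-inverseʳ q))) 0<ε

  +-cauchy : ∀ s t → IsCauchy s → IsCauchy t → IsCauchy (λ n → s n ℚ.+ t n)
  +-cauchy s t cs ct ε 0<ε with cs (½ ℚ.* ε) (half-pos 0<ε) | ct (½ ℚ.* ε) (half-pos 0<ε)
  ... | N₁ , h₁ | N₂ , h₂ = N₁ ⊔ N₂ , λ m n m≥ n≥ → begin-strict
    ∣ (s m ℚ.+ t m) ℚ.- (s n ℚ.+ t n) ∣          ≡⟨ cong ∣_∣ (rearrange (s m) (t m) (s n) (t n)) ⟩
    ∣ (s m ℚ.- s n) ℚ.+ (t m ℚ.- t n) ∣          ≤⟨ ℚ.∣p+q∣≤∣p∣+∣q∣ (s m ℚ.- s n) (t m ℚ.- t n) ⟩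
    ∣ s m ℚ.- s n ∣ ℚ.+ ∣ t m ℚ.- t n ∣          <⟨ ℚ.+-mono-<
                                                     (h₁ m n (ℕ.m⊔n≤o⇒m≤o N₁ N₂ m≥) (ℕ.m⊔n≤o⇒m≤o N₁ N₂ n≥))
                                                     (h₂ m n (ℕ.m⊔n≤o⇒n≤o N₁ N₂ m≥) (ℕ.m⊔n≤o⇒n≤o N₁ N₂ n≥)) ⟩
    ½ ℚ.* ε ℚ.+ ½ ℚ.* ε                          ≡⟨ half+half ε ⟩
    ε                                            ∎
    where
    open ℚ.≤-Reasoning
    rearrange : ∀ a b c d → (a ℚ.+ b) ℚ.- (c ℚ.+ d) ≡ (a ℚ.- c) ℚ.+ (b ℚ.- d)
    rearrange a b c d = trans (cong ((a ℚ.+ b) ℚ.+_) (ℚ.neg-distrib-+ c d))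
                              (interchange a b (ℚ.- c) (ℚ.- d))

  neg-cauchy : ∀ s → IsCauchy s → IsCauchy (λ n → ℚ.- s n)
  neg-cauchy s cs ε 0<ε with cs ε 0<ε
  ... | N , h = N , λ m n m≥ n≥ → subst (ℚ._< ε) (eq m n) (h m n m≥ n≥)
    where
    eq : ∀ m n → ∣ s m ℚ.- s n ∣ ≡ ∣ ℚ.- s m ℚ.- ℚ.- s n ∣
    eq m n = trans (sym (ℚ.∣-p∣≡∣p∣ (s m ℚ.- s n)))
                   (cong ∣_∣ (ℚ.neg-distrib-+ (s m) (ℚ.- s n)))

  bounded : ∀ s → IsCauchy s →
    ∃[ B ] ∃[ N ] (0ℚ ℚ.< B × (∀ n → N ℕ.≤ n → ∣ s n ∣ ℚ.≤ B))
  bounded s cs with cs 1ℚ (ℚ.positive⁻¹ 1ℚ)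
  ... | N , h = B , N , 0<B , λ n n≥ → begin
    ∣ s n ∣                          ≡⟨ cong ∣_∣ (split (s n) (s N)) ⟩
    ∣ (s n ℚ.- s N) ℚ.+ s N ∣        ≤⟨ ℚ.∣p+q∣≤∣p∣+∣q∣ (s n ℚ.- s N) (s N) ⟩
    ∣ s n ℚ.- s N ∣ ℚ.+ ∣ s N ∣      ≤⟨ ℚ.+-monoˡ-≤ ∣ s N ∣ (ℚ.<⇒≤ (h n N n≥ ℕ.≤-refl)) ⟩
    B                                ∎
    where
    open ℚ.≤-Reasoning
    B = 1ℚ ℚ.+ ∣ s N ∣
    0<B : 0ℚ ℚ.< B
    0<B = ℚ.+-mono-<-≤ (ℚ.positive⁻¹ 1ℚ) (ℚ.0≤∣p∣ (s N))
    split : ∀ a b → a ≡ (a ℚ.- b) ℚ.+ b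
    split a b = sym (trans (ℚ.+-assoc a (ℚ.- b) b)
                    (trans (cong (a ℚ.+_) (ℚ.+-inverseˡ b)) (ℚ.+-identityʳ a)))

  -- For B, ε > 0, a δ > 0 such that B · δ = ε / 2.
  shrink : ∀ {B ε} → 0ℚ ℚ.< B → 0ℚ ℚ.< ε → ∃[ δ ] (0ℚ ℚ.< δ × B ℚ.* δ ≡ ½ ℚ.* ε)
  shrink {B} {ε} 0<B 0<ε = δ , 0<δ , eq
    where
    instance
      B⁺ : ℚ.Positive B
      B⁺ = ℚ.positive 0<B
      B≠0 : ℚ.NonZero B
      B≠0 = ℚ.pos⇒nonZero B
      B⁻¹⁺ : ℚ.Positive (ℚ.1/ B)
      B⁻¹⁺ = ℚ.1/pos⇒pos B
    δ = ℚ.1/ B ℚ.* (½ ℚ.* ε)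
    0<δ : 0ℚ ℚ.< δ
    0<δ = subst (ℚ._< δ) (ℚ.*-zeroʳ (ℚ.1/ B)) (ℚ.*-monoʳ-<-pos (ℚ.1/ B) (half-pos 0<ε))
    eq : B ℚ.* δ ≡ ½ ℚ.* ε
    eq = trans (sym (ℚ.*-assoc B (ℚ.1/ B) (½ ℚ.* ε)))
         (trans (cong (ℚ._* (½ ℚ.* ε)) (ℚ.*-inverseʳ B)) (ℚ.*-identityˡ (½ ℚ.* ε)))

  *-bound : ∀ p q {B δ} → 0ℚ ℚ.< B → ∣ p ∣ ℚ.≤ B → ∣ q ∣ ℚ.< δ → ∣ p ℚ.* q ∣ ℚ.< B ℚ.* δ
  *-bound p q {B} {δ} 0<B p≤ q< = begin-strict
    ∣ p ℚ.* q ∣        ≡⟨ ℚ.∣p*q∣≡∣p∣*∣q∣ p q ⟩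
    ∣ p ∣ ℚ.* ∣ q ∣    ≤⟨ ℚ.*-monoʳ-≤-nonNeg ∣ q ∣ {{ℚ.nonNegative (ℚ.0≤∣p∣ q)}} p≤ ⟩
    B ℚ.* ∣ q ∣        <⟨ ℚ.*-monoʳ-<-pos B {{ℚ.positive 0<B}} q< ⟩
    B ℚ.* δ            ∎
    where open ℚ.≤-Reasoning

  *-cauchy : ∀ s t → IsCauchy s → IsCauchy t → IsCauchy (λ n → s n ℚ.* t n)
  *-cauchy s t cs ct ε 0<ε
    with bounded s cs | bounded t ct
  ... | B , Nb , 0<B , hB | C , Nc , 0<C , hC
    with shrink 0<B 0<ε | shrink 0<C 0<ε
  ... | δ , 0<δ , Bδ | η , 0<η , Cη
    with ct δ 0<δ | cs η 0<η
  ... | N₁ , h₁ | N₂ , h₂ = (Nb ⊔ Nc) ⊔ (N₁ ⊔ N₂) , λ m n m≥ n≥ → begin-strict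
    ∣ s m ℚ.* t m ℚ.- s n ℚ.* t n ∣
      ≡⟨ cong ∣_∣ (rearrange (s m) (t m) (s n) (t n)) ⟩
    ∣ s m ℚ.* (t m ℚ.- t n) ℚ.+ t n ℚ.* (s m ℚ.- s n) ∣
      ≤⟨ ℚ.∣p+q∣≤∣p∣+∣q∣ (s m ℚ.* (t m ℚ.- t n)) (t n ℚ.* (s m ℚ.- s n)) ⟩
    ∣ s m ℚ.* (t m ℚ.- t n) ∣ ℚ.+ ∣ t n ℚ.* (s m ℚ.- s n) ∣
      <⟨ ℚ.+-mono-< (*-bound (s m) (t m ℚ.- t n) 0<B (hB m (toB m≥)) (h₁ m n (to₁ m≥) (to₁ n≥)))
                    (*-bound (t n) (s m ℚ.- s n) 0<C (hC n (toC n≥)) (h₂ m n (to₂ m≥) (to₂ n≥))) ⟩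
    B ℚ.* δ ℚ.+ C ℚ.* η
      ≡⟨ cong₂ ℚ._+_ Bδ Cη ⟩
    ½ ℚ.* ε ℚ.+ ½ ℚ.* ε
      ≡⟨ half+half ε ⟩
    ε ∎
    where
    open ℚ.≤-Reasoning
    toB : ∀ {k} → (Nb ⊔ Nc) ⊔ (N₁ ⊔ N₂) ℕ.≤ k → Nb ℕ.≤ k
    toB k≥ = ℕ.m⊔n≤o⇒m≤o Nb Nc (ℕ.m⊔n≤o⇒m≤o (Nb ⊔ Nc) (N₁ ⊔ N₂) k≥)
    toC : ∀ {k} → (Nb ⊔ Nc) ⊔ (N₁ ⊔ N₂) ℕ.≤ k → Nc ℕ.≤ k
    toC k≥ = ℕ.m⊔n≤o⇒n≤o Nb Nc (ℕ.m⊔n≤o⇒m≤o (Nb ⊔ Nc) (N₁ ⊔ N₂) k≥)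
    to₁ : ∀ {k} → (Nb ⊔ Nc) ⊔ (N₁ ⊔ N₂) ℕ.≤ k → N₁ ℕ.≤ k
    to₁ k≥ = ℕ.m⊔n≤o⇒m≤o N₁ N₂ (ℕ.m⊔n≤o⇒n≤o (Nb ⊔ Nc) (N₁ ⊔ N₂) k≥)
    to₂ : ∀ {k} → (Nb ⊔ Nc) ⊔ (N₁ ⊔ N₂) ℕ.≤ k → N₂ ℕ.≤ k
    to₂ k≥ = ℕ.m⊔n≤o⇒n≤o N₁ N₂ (ℕ.m⊔n≤o⇒n≤o (Nb ⊔ Nc) (N₁ ⊔ N₂) k≥)
    telescope : ∀ p q r → p ℚ.- r ≡ (p ℚ.- q) ℚ.+ (q ℚ.- r)
    telescope p q r = sym
      (trans (ℚ.+-assoc p (ℚ.- q) (q ℚ.- r)) (cong (p ℚ.+_)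
      (trans (sym (ℚ.+-assoc (ℚ.- q) q (ℚ.- r)))
      (trans (cong (ℚ._- r) (ℚ.+-inverseˡ q)) (ℚ.+-identityˡ (ℚ.- r))))))
    factor : ∀ p q r → p ℚ.* q ℚ.- p ℚ.* r ≡ p ℚ.* (q ℚ.- r)
    factor p q r = trans (cong (p ℚ.* q ℚ.+_) (ℚ.neg-distribʳ-* p r))
                         (sym (ℚ.*-distribˡ-+ p q (ℚ.- r)))
    rearrange : ∀ a b c d → a ℚ.* b ℚ.- c ℚ.* d ≡ a ℚ.* (b ℚ.- d) ℚ.+ d ℚ.* (a ℚ.- c)
    rearrange a b c d = trans (telescope (a ℚ.* b) (a ℚ.* d) (c ℚ.* d))
      (cong₂ ℚ._+_ (factor a b d)
        (trans (cong₂ ℚ._-_ (ℚ.*-comm a d) (ℚ.*-comm c d)) (factor d a c)))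

infixl 6 _+ℝ_
infixl 7 _*ℝ_
infix  8 -ℝ_

fromℚ : ℚ → ℝ
fromℚ q = mkℝ (λ _ → q) (const-cauchy q)

0ℝ 1ℝ : ℝ
0ℝ = fromℚ 0ℚ
1ℝ = fromℚ 1ℚ

_+ℝ_ _*ℝ_ : ℝ → ℝ → ℝ
mkℝ s cs +ℝ mkℝ t ct = mkℝ (λ n → s n ℚ.+ t n) (+-cauchy s t cs ct)
mkℝ s cs *ℝ mkℝ t ct = mkℝ (λ n → s n ℚ.* t n) (*-cauchy s t cs ct)

-ℝ_ : ℝ → ℝ
-ℝ mkℝ s cs = mkℝ (λ n → ℚ.- s n) (neg-cauchy s cs)

record ℂ : Set where
  constructor _+i_
  field
    re im : ℝ

open ℂ public

infix  4 _≈_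
infixl 6 _+_
infixl 7 _*_
infix  8 -_

record _≈_ (z w : ℂ) : Set where
  constructor mk≈
  field
    re≈ : re z ≈ℝ re w
    im≈ : im z ≈ℝ im w

0ℂ 1ℂ i : ℂ
0ℂ = 0ℝ +i 0ℝ
1ℂ = 1ℝ +i 0ℝ
i  = 0ℝ +i 1ℝ

_+_ _*_ : ℂ → ℂ → ℂ
(a +i b) + (c +i d) = (a +ℝ c) +i (b +ℝ d)
(a +i b) * (c +i d) = ((a *ℝ c) +ℝ (-ℝ (b *ℝ d))) +i ((a *ℝ d) +ℝ (b *ℝ c))

-_ conj : ℂ → ℂ
- (a +i b)    = (-ℝ a) +i (-ℝ b)
conj (a +i b) = a +i (-ℝ b)

i^_ : ℕ → ℂ
i^ zero  = 1ℂ
i^ suc k = i * (i^ k)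

-- Apartness from zero, the positive form of z ≠ 0.
Nonzero : Pred ℂ 0ℓ
Nonzero z = ∃[ w ] z * w ≈ 1ℂ

-- U(1) as the group of 1 × 1 unitary matrices: z z̄ = 1, i.e. |z| = 1.
U₁ : Pred ℂ 0ℓ
U₁ z = z * conj z ≈ 1ℂ

-- Bit strings; 𝔽₂ is Bool with _xor_ as addition and _∧_ as product.

Bits : ℕ → Set
Bits = Vec Bool

⟨_,_⟩ : ∀ {k} → Bits k → Bits k → Bool
⟨ a , x ⟩ = foldr′ _xor_ false (zipWith _∧_ a x)

bit : Bool → ℕ
bit b = if b then 1 else 0

Σ[_] : ∀ n → (Bits n → ℂ) → ℂ
Σ[ zero ]  f = f []
Σ[ suc n ] f = Σ[ n ] (λ x → f (false ∷ x)) + Σ[ n ] (λ x → f (true ∷ x))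

-- A matrix over 𝔽₂ with k columns is given by the list of its rows.
χ[_·_≡0] : ∀ {k} → List (Bits k) → Bits k → ℂ
χ[ A · x ≡0] = if all (λ row → not ⟨ row , x ⟩) A then 1ℂ else 0ℂ

-- The exponent is the natural number Σⱼ ⟨αⱼ , x⟩; as i⁴ = 1 it matters
-- only modulo 4.
affine : ∀ {k} → ℂ → List (Bits (suc k)) → List (Bits (suc k)) → Bits k → ℂ
affine c A αs x =
  c * χ[ A · x ∷ʳ true ≡0] * (i^ sum (map (λ α → bit ⟨ α , x ∷ʳ true ⟩) αs))

IsAffine : ∀ {k} → Pred (Bits k → ℂ) 0ℓ
IsAffine f = ∃[ c ] ∃[ A ] ∃[ αs ] (∀ x → f x ≈ affine c A αs x)

-- 2ⁿ × 2ⁿ complex matrices, with rows and columns indexed by {0,1}ⁿ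

Mat : ℕ → Set
Mat n = Bits n → Bits n → ℂ

infix  4 _≋_
infixl 7 _⊡_
infixr 7 _•_
infix  9 _†

_≋_ : ∀ {n} → Mat n → Mat n → Set
M ≋ N = ∀ x y → M x y ≈ N x y

δ₂ : Bool → Bool → ℂ
δ₂ false false = 1ℂ
δ₂ false true  = 0ℂ
δ₂ true  false = 0ℂ
δ₂ true  true  = 1ℂ

𝟙 : ∀ {n} → Mat n
𝟙 []      []      = 1ℂ
𝟙 (a ∷ x) (b ∷ y) = δ₂ a b * 𝟙 x y

_⊡_ : ∀ {n} → Mat n → Mat n → Mat n
_⊡_ {n} M N x y = Σ[ n ] (λ z → M x z * N z y)

_•_ : ∀ {n} → ℂ → Mat n → Mat n
(c • M) x y = c * M x y

_† : ∀ {n} → Mat n → Mat n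
(M †) x y = conj (M y x)

Nonsingular : ∀ {n} → Pred (Mat n) 0ℓ
Nonsingular M = ∃[ N ] (M ⊡ N ≋ 𝟙 × N ⊡ M ≋ 𝟙)

Unitary : ∀ n → Pred (Mat n) 0ℓ
Unitary n U = U ⊡ U † ≋ 𝟙 × U † ⊡ U ≋ 𝟙

-- The column (x₂ₙ , … , xₙ₊₁) is y, so the last n arguments are reverse y.
signatureMatrix : ∀ {n} → (Bits (n ℕ.+ n) → ℂ) → Mat n
signatureMatrix f x y = f (x ++ reverse y)

𝒜 : ∀ n → Pred (Mat n) 0ℓ
𝒜 n M = ∃[ f ] (IsAffine {n ℕ.+ n} f × M ≋ signatureMatrix f)

-- Closed under all nonzero scalars, not only those of norm one, so its
-- members need a scalar factor to become unitary.
𝒢𝒜 : ∀ n → Pred (Mat n) 0ℓ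
𝒢𝒜 n M = Nonsingular M × 𝒜 n M

data Pauli : Set where
  I X Y Z : Pauli

entries : ℂ → ℂ → ℂ → ℂ → Bool → Bool → ℂ
entries a b c d false false = a
entries a b c d false true  = b
entries a b c d true  false = c
entries a b c d true  true  = d

⟦_⟧ : Pauli → Bool → Bool → ℂ
⟦ I ⟧ = entries 1ℂ 0ℂ
                0ℂ 1ℂ
⟦ X ⟧ = entries 0ℂ 1ℂ
                1ℂ 0ℂ
⟦ Y ⟧ = entries 0ℂ (- i)
                i  0ℂ
⟦ Z ⟧ = entries 1ℂ 0ℂ
                0ℂ (- 1ℂ)

⨂ : ∀ {n} → Vec Pauli n → Mat n
⨂ []       []      []      = 1ℂ
⨂ (σ ∷ σs) (a ∷ x) (b ∷ y) = ⟦ σ ⟧ a b * ⨂ σs x y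

-- The phases i^ k are exactly ±1 and ±i.
𝒫 : ∀ n → Pred (Mat n) 0ℓ
𝒫 n M = ∃[ k ] ∃[ σs ] M ≋ (i^ k) • ⨂ {n} σs

PauliNormalizer : ∀ n → Pred (Mat n) 0ℓ
PauliNormalizer n U = Unitary n U × (∀ σ → 𝒫 n σ → 𝒫 n (U ⊡ σ ⊡ U †))

-- A subset of the quotient by U(1) is represented by its preimage: the
-- matrices whose class is the class of some member of S.
_/U⟨1⟩ : ∀ {n} → Pred (Mat n) 0ℓ → Pred (Mat n) 0ℓ
(S /U⟨1⟩) M = ∃[ V ] (S V × ∃[ z ] (U₁ z × M ≋ z • V))

𝒞 : ∀ n → Pred (Mat n) 0ℓ
𝒞 n = PauliNormalizer n /U⟨1⟩

module Submission where

-- Consider the relations X^u Z^w M = M X^v Z^b, up to a phase. An affine M has one for every direction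
-- (u , v) of its support, because a translation changes the exponent by a linear form, and one with
-- u = v = 0 for every equation of the support. If M is nonsingular, the Fredholm alternative over 𝔽₂ shows
-- that every X^v Z^b occurs on the right: M normalises the Pauli group. Hence M†M commutes with the Pauli
-- matrices, so it is the scalar |λ|² 2ʳ, the squared modulus of λ (1 + i)ʳ, and M is unitary up to a factor.
--
-- Conversely let U be a unitary that normalises the Pauli group. Since 2ⁿ e_y e_y† = Σ_b ± Z^b, the product
-- of two entries in one column of U is 2⁻ⁿ times a sum of entries of the Pauli matrices U Z^b U†. So it is
-- decidable whether an entry is zero, and any two nonzero entries of U are linked by one of the relations.
-- A function on bit strings with this property is affine, by induction on the number of bits.

open import Algebra.Bundles using (CommutativeRing)
open import Data.Bool.Base using (Bool; true; false; _∧_; _xor_; not; if_then_else_)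
open import Data.Bool.ListAction using (all)
open import Data.Bool.Properties
  using (xor-comm; xor-assoc; xor-same; xor-identityʳ; ∧-distribˡ-xor; ∧-comm; ∧-zeroʳ; ∧-identityʳ;
         xor-∧-commutativeRing)
  renaming (_≟_ to _≟ᵇ_)
open import Data.Empty using (⊥-elim)
open import Data.List.Base as List using (List; []; _∷_)
open import Data.List.Membership.Propositional using (_∈_)
open import Data.List.Membership.Propositional.Properties using (∈-map⁺; ∈-++⁺ˡ; ∈-++⁺ʳ)
open import Data.List.Properties using (map-++)
open import Data.List.Relation.Unary.All as All using (All; []; _∷_)
import Data.List.Relation.Unary.All.Properties as All
open import Data.List.Relation.Unary.Any using (here)
open import Data.Nat.Base as ℕ using (ℕ; zero; suc; _⊔_)
open import Data.Nat.ListAction using (sum)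
open import Data.Nat.ListAction.Properties using (sum-++)
import Data.Nat.Properties as ℕ
open import Data.Product.Base using (∃; ∃-syntax; _×_; _,_; proj₁; proj₂)
open import Data.Rational.Base as ℚ using (ℚ; 0ℚ; 1ℚ; ½; ∣_∣)
import Data.Rational.Properties as ℚ
open import Data.Rational.Solver using (module +-*-Solver)
open import Data.Sum.Base using (_⊎_; inj₁; inj₂)
open import Data.Vec.Base
  using (Vec; []; _∷_; _∷ʳ_; _++_; reverse; zipWith; replicate; map; splitAt; initLast)
open import Data.Vec.Properties
  using (zipWith-comm; zipWith-assoc; zipWith-identityˡ; zipWith-identityʳ; reverse-∷; reverse-involutive;
         reverse-injective; ++-injective; ≡-dec)
open import Defs hiding (_+_; _*_; -_; conj; Σ[_]; i^_; 𝟙; ⨂)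
import Defs as D
open import Level using (0ℓ)
open import Relation.Binary.Bundles using (Setoid)
open import Relation.Binary.Definitions using (tri<; tri≈; tri>)
open import Relation.Binary.PropositionalEquality
  using (_≡_; _≢_; refl; sym; trans; cong; cong₂; subst)
open import Relation.Nullary using (¬_; Dec; yes; no)
open import Relation.Unary using (Pred; _⊆_; _≐_; _∩_)

-- Real and complex arithmetic

-- Complex numbers are pairs of Cauchy reals: being zero is undecidable, and a square root would
-- have to be constructed. Both facts shape the proof. Nonzero means invertible throughout, and
-- cases are distinguished on bit strings or through Gaussian rationals. The support of an affine
-- matrix is decided by its equations, and `(1 + i) / 2` stands in for a square root of ½. A
-- Clifford unitary may carry an arbitrary global phase, so its entries need not be rational; the
-- product of one entry with the conjugate of another no longer contains this phase.
--
-- The relations are stated entrywise, with powers of i as the only scalars, and make sense for a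
-- matrix that is not unitary. Thus they are available for a nonsingular affine matrix before it is
-- scaled, and they determine M†M. They add up in all four bit vectors, so that finding a relation
-- with a prescribed right side is linear algebra over 𝔽₂.

pointwise : ∀ {x y} → (∀ n → seq x n ≡ seq y n) → x ≈ℝ y
pointwise {x} {y} x≡y = mk≈ℝ λ ε 0<ε → 0 , λ n _ →
  subst (ℚ._< ε) (cong ∣_∣ (sym (trans (cong (ℚ._- seq y n) (x≡y n)) (ℚ.+-inverseʳ (seq y n))))) 0<ε

open +-*-Solver using (_:=_; _:+_; _:*_; _:-_; :-_; con) renaming (solve to solveℚ)

private
  half-pos : ∀ {ε} → 0ℚ ℚ.< ε → 0ℚ ℚ.< ½ ℚ.* ε
  half-pos {ε} 0<ε = subst (ℚ._< ½ ℚ.* ε) (ℚ.*-zeroʳ ½) (ℚ.*-monoʳ-<-pos ½ 0<ε)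

  half+half : ∀ ε → ½ ℚ.* ε ℚ.+ ½ ℚ.* ε ≡ ε
  half+half ε = trans (sym (ℚ.*-distribʳ-+ ε ½ ½)) (ℚ.*-identityˡ ε)

  ∣-∣-comm : ∀ p q → ∣ p ℚ.- q ∣ ≡ ∣ q ℚ.- p ∣
  ∣-∣-comm p q = trans (sym (ℚ.∣-p∣≡∣p∣ (p ℚ.- q)))
    (cong ∣_∣ (solveℚ 2 (λ a b → :- (a :- b) := b :- a) refl p q))

  ∣sum∣< : ∀ p q {ε} → ∣ p ∣ ℚ.< ½ ℚ.* ε → ∣ q ∣ ℚ.< ½ ℚ.* ε → ∣ p ℚ.+ q ∣ ℚ.< ε
  ∣sum∣< p q {ε} p< q< = begin-strict
    ∣ p ℚ.+ q ∣               ≤⟨ ℚ.∣p+q∣≤∣p∣+∣q∣ p q ⟩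
    ∣ p ∣ ℚ.+ ∣ q ∣           <⟨ ℚ.+-mono-< p< q< ⟩
    ½ ℚ.* ε ℚ.+ ½ ℚ.* ε       ≡⟨ half+half ε ⟩
    ε                         ∎
    where open ℚ.≤-Reasoning

≈ℝ-sym : ∀ {x y} → x ≈ℝ y → y ≈ℝ x
≈ℝ-sym {x} {y} (mk≈ℝ h) = mk≈ℝ λ ε 0<ε → let N , hN = h ε 0<ε in
  N , λ n n≥ → subst (ℚ._< ε) (∣-∣-comm (seq x n) (seq y n)) (hN n n≥)

≈ℝ-trans : ∀ {x y z} → x ≈ℝ y → y ≈ℝ z → x ≈ℝ z
≈ℝ-trans {x} {y} {z} (mk≈ℝ h) (mk≈ℝ k) = mk≈ℝ λ ε 0<ε →
  let N , hN = h (½ ℚ.* ε) (half-pos 0<ε) ; K , hK = k (½ ℚ.* ε) (half-pos 0<ε)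
  in N ⊔ K , λ n n≥ → subst (ℚ._< ε)
    (cong ∣_∣ (solveℚ 3 (λ a b c → (a :- b) :+ (b :- c) := a :- c) refl (seq x n) (seq y n) (seq z n)))
    (∣sum∣< (seq x n ℚ.- seq y n) (seq y n ℚ.- seq z n)
      (hN n (ℕ.m⊔n≤o⇒m≤o N K n≥)) (hK n (ℕ.m⊔n≤o⇒n≤o N K n≥)))

+ℝ-cong : ∀ {x x′ y y′} → x ≈ℝ x′ → y ≈ℝ y′ → x +ℝ y ≈ℝ x′ +ℝ y′
+ℝ-cong {x} {x′} {y} {y′} (mk≈ℝ h) (mk≈ℝ k) = mk≈ℝ λ ε 0<ε →
  let N , hN = h (½ ℚ.* ε) (half-pos 0<ε) ; K , hK = k (½ ℚ.* ε) (half-pos 0<ε)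
  in N ⊔ K , λ n n≥ → subst (ℚ._< ε)
    (cong ∣_∣ (solveℚ 4 (λ a b c d → (a :- b) :+ (c :- d) := (a :+ c) :- (b :+ d)) refl
      (seq x n) (seq x′ n) (seq y n) (seq y′ n)))
    (∣sum∣< (seq x n ℚ.- seq x′ n) (seq y n ℚ.- seq y′ n)
      (hN n (ℕ.m⊔n≤o⇒m≤o N K n≥)) (hK n (ℕ.m⊔n≤o⇒n≤o N K n≥)))

-ℝ-cong : ∀ {x y} → x ≈ℝ y → -ℝ x ≈ℝ -ℝ y
-ℝ-cong {x} {y} (mk≈ℝ h) = mk≈ℝ λ ε 0<ε → let N , hN = h ε 0<ε in
  N , λ n n≥ → subst (ℚ._< ε)
    (trans (∣-∣-comm (seq x n) (seq y n))
      (cong ∣_∣ (solveℚ 2 (λ a b → b :- a := (:- a) :- (:- b)) refl (seq x n) (seq y n))))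
    (hN n n≥)

eventually-bounded : ∀ x → ∃[ B ] ∃[ N ] (0ℚ ℚ.< B × (∀ n → N ℕ.≤ n → ∣ seq x n ∣ ℚ.≤ B))
eventually-bounded (mkℝ s cs) with cs 1ℚ (ℚ.positive⁻¹ 1ℚ)
... | N , h = 1ℚ ℚ.+ ∣ s N ∣ , N , ℚ.+-mono-<-≤ (ℚ.positive⁻¹ 1ℚ) (ℚ.0≤∣p∣ (s N)) , λ n n≥ → begin
  ∣ s n ∣                      ≡⟨ cong ∣_∣ (solveℚ 2 (λ a b → a := (a :- b) :+ b) refl (s n) (s N)) ⟩
  ∣ (s n ℚ.- s N) ℚ.+ s N ∣    ≤⟨ ℚ.∣p+q∣≤∣p∣+∣q∣ (s n ℚ.- s N) (s N) ⟩
  ∣ s n ℚ.- s N ∣ ℚ.+ ∣ s N ∣  ≤⟨ ℚ.+-monoˡ-≤ ∣ s N ∣ (ℚ.<⇒≤ (h n N n≥ ℕ.≤-refl)) ⟩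
  1ℚ ℚ.+ ∣ s N ∣               ∎
  where open ℚ.≤-Reasoning

private
  shrink : ∀ {B ε} → 0ℚ ℚ.< B → 0ℚ ℚ.< ε → ∃[ δ ] (0ℚ ℚ.< δ × B ℚ.* δ ≡ ε)
  shrink {B} {ε} 0<B 0<ε = ℚ.1/ B ℚ.* ε , 0<δ , Bδ≡ε
    where
    instance
      B⁺ : ℚ.Positive B
      B⁺ = ℚ.positive 0<B
      B≠0 : ℚ.NonZero B
      B≠0 = ℚ.pos⇒nonZero B
      B⁻¹⁺ : ℚ.Positive (ℚ.1/ B)
      B⁻¹⁺ = ℚ.1/pos⇒pos B
    0<δ : 0ℚ ℚ.< ℚ.1/ B ℚ.* ε
    0<δ = subst (ℚ._< ℚ.1/ B ℚ.* ε) (ℚ.*-zeroʳ (ℚ.1/ B)) (ℚ.*-monoʳ-<-pos (ℚ.1/ B) 0<ε)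
    Bδ≡ε : B ℚ.* (ℚ.1/ B ℚ.* ε) ≡ ε
    Bδ≡ε = trans (sym (ℚ.*-assoc B (ℚ.1/ B) ε))
             (trans (cong (ℚ._* ε) (ℚ.*-inverseʳ B)) (ℚ.*-identityˡ ε))

  ∣product∣< : ∀ p q {B δ} → 0ℚ ℚ.< B → ∣ p ∣ ℚ.≤ B → ∣ q ∣ ℚ.< δ → ∣ p ℚ.* q ∣ ℚ.< B ℚ.* δ
  ∣product∣< p q {B} {δ} 0<B p≤ q< = begin-strict
    ∣ p ℚ.* q ∣        ≡⟨ ℚ.∣p*q∣≡∣p∣*∣q∣ p q ⟩
    ∣ p ∣ ℚ.* ∣ q ∣    ≤⟨ ℚ.*-monoʳ-≤-nonNeg ∣ q ∣ {{ℚ.nonNegative (ℚ.0≤∣p∣ q)}} p≤ ⟩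
    B ℚ.* ∣ q ∣        <⟨ ℚ.*-monoʳ-<-pos B {{ℚ.positive 0<B}} q< ⟩
    B ℚ.* δ            ∎
    where open ℚ.≤-Reasoning

  *ℝ-comm : ∀ x y → x *ℝ y ≈ℝ y *ℝ x
  *ℝ-comm x y = pointwise {x *ℝ y} {y *ℝ x} λ n → ℚ.*-comm (seq x n) (seq y n)

  -- With `B` an eventual bound of `x`, closeness of the second factors within ε / B gives closeness
  -- of the products within ε.
  *ℝ-congˡ : ∀ x {y y′} → y ≈ℝ y′ → x *ℝ y ≈ℝ x *ℝ y′
  *ℝ-congˡ x {y} {y′} (mk≈ℝ h) = mk≈ℝ λ ε 0<ε →
    let B , N , 0<B , x≤B = eventually-bounded x
        δ , 0<δ , Bδ≡ε = shrink 0<B 0<ε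
        K , hK = h δ 0<δ
    in N ⊔ K , λ n n≥ → bound (seq x n) (seq y n) (seq y′ n) 0<B Bδ≡ε
         (x≤B n (ℕ.m⊔n≤o⇒m≤o N K n≥)) (hK n (ℕ.m⊔n≤o⇒n≤o N K n≥))
    where
    bound : ∀ p q r {B δ ε} → 0ℚ ℚ.< B → B ℚ.* δ ≡ ε → ∣ p ∣ ℚ.≤ B → ∣ q ℚ.- r ∣ ℚ.< δ →
      ∣ p ℚ.* q ℚ.- p ℚ.* r ∣ ℚ.< ε
    bound p q r {B} {δ} 0<B refl p≤ q-r< = subst (λ t → ∣ t ∣ ℚ.< B ℚ.* δ)
      (solveℚ 3 (λ a b c → a :* (b :- c) := a :* b :- a :* c) refl p q r)
      (∣product∣< p (q ℚ.- r) 0<B p≤ q-r<)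

*ℝ-cong : ∀ {x x′ y y′} → x ≈ℝ x′ → y ≈ℝ y′ → x *ℝ y ≈ℝ x′ *ℝ y′
*ℝ-cong {x} {x′} {y} {y′} p q =
  ≈ℝ-trans {x *ℝ y} {x *ℝ y′} {x′ *ℝ y′} (*ℝ-congˡ x {y} {y′} q)
    (≈ℝ-trans {x *ℝ y′} {y′ *ℝ x} {x′ *ℝ y′} (*ℝ-comm x y′)
      (≈ℝ-trans {y′ *ℝ x} {y′ *ℝ x′} {x′ *ℝ y′} (*ℝ-congˡ y′ {x} {x′} p) (*ℝ-comm y′ x′)))

≈-refl : ∀ {z} → z ≈ z
≈-refl = mk≈ (pointwise λ _ → refl) (pointwise λ _ → refl)

≈-sym : ∀ {z w} → z ≈ w → w ≈ z
≈-sym (mk≈ p q) = mk≈ (≈ℝ-sym p) (≈ℝ-sym q)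

≈-trans : ∀ {z w v} → z ≈ w → w ≈ v → z ≈ v
≈-trans (mk≈ p q) (mk≈ p′ q′) = mk≈ (≈ℝ-trans p p′) (≈ℝ-trans q q′)

-- The operations of Defs unfold to sequences with their Cauchy proofs; the opaque copies keep the
-- conversion checker away from these.
opaque
  infixl 6 _+_
  infixl 7 _*_
  infix  8 -_

  _+_ _*_ : ℂ → ℂ → ℂ
  _+_ = D._+_
  _*_ = D._*_

  -_ conj : ℂ → ℂ
  -_ = D.-_
  conj = D.conj

  +-cong : ∀ {z z′ w w′} → z ≈ z′ → w ≈ w′ → z + w ≈ z′ + w′
  +-cong {a +i b} {a′ +i b′} {c +i d} {c′ +i d′} (mk≈ p q) (mk≈ r s) =
    mk≈ (+ℝ-cong {a} {a′} {c} {c′} p r) (+ℝ-cong {b} {b′} {d} {d′} q s)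

  *-cong : ∀ {z z′ w w′} → z ≈ z′ → w ≈ w′ → z * w ≈ z′ * w′
  *-cong {a +i b} {a′ +i b′} {c +i d} {c′ +i d′} (mk≈ p q) (mk≈ r s) = mk≈
    (+ℝ-cong {a *ℝ c} {a′ *ℝ c′} { -ℝ (b *ℝ d)} { -ℝ (b′ *ℝ d′)} (*ℝ-cong {a} {a′} {c} {c′} p r)
      (-ℝ-cong {b *ℝ d} {b′ *ℝ d′} (*ℝ-cong {b} {b′} {d} {d′} q s)))
    (+ℝ-cong {a *ℝ d} {a′ *ℝ d′} {b *ℝ c} {b′ *ℝ c′} (*ℝ-cong {a} {a′} {d} {d′} p s) (*ℝ-cong {b} {b′} {c} {c′} q r))

  -‿cong : ∀ {z w} → z ≈ w → - z ≈ - w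
  -‿cong {a +i b} {c +i d} (mk≈ p q) = mk≈ (-ℝ-cong {a} {c} p) (-ℝ-cong {b} {d} q)

  conj-cong : ∀ {z w} → z ≈ w → conj z ≈ conj w
  conj-cong {a +i b} {c +i d} (mk≈ p q) = mk≈ p (-ℝ-cong {b} {d} q)

  +-assoc : ∀ z w v → (z + w) + v ≈ z + (w + v)
  +-assoc (a +i b) (c +i d) (e +i f) = mk≈
    (pointwise λ n → ℚ.+-assoc (seq a n) (seq c n) (seq e n))
    (pointwise λ n → ℚ.+-assoc (seq b n) (seq d n) (seq f n))

  +-comm : ∀ z w → z + w ≈ w + z
  +-comm (a +i b) (c +i d) = mk≈
    (pointwise λ n → ℚ.+-comm (seq a n) (seq c n))
    (pointwise λ n → ℚ.+-comm (seq b n) (seq d n))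

  +-identityˡ : ∀ z → 0ℂ + z ≈ z
  +-identityˡ (a +i b) = mk≈
    (pointwise λ n → ℚ.+-identityˡ (seq a n))
    (pointwise λ n → ℚ.+-identityˡ (seq b n))

  -‿inverseˡ : ∀ z → - z + z ≈ 0ℂ
  -‿inverseˡ (a +i b) = mk≈
    (pointwise λ n → ℚ.+-inverseˡ (seq a n))
    (pointwise λ n → ℚ.+-inverseˡ (seq b n))

  *-assoc : ∀ z w v → (z * w) * v ≈ z * (w * v)
  *-assoc (a +i b) (c +i d) (e +i f) = mk≈
    (pointwise λ n → solveℚ 6 (λ a b c d e f →
        (a :* c :- b :* d) :* e :- (a :* d :+ b :* c) :* f := a :* (c :* e :- d :* f) :- b :* (c :* f :+ d :* e))
      refl (seq a n) (seq b n) (seq c n) (seq d n) (seq e n) (seq f n))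
    (pointwise λ n → solveℚ 6 (λ a b c d e f →
        (a :* c :- b :* d) :* f :+ (a :* d :+ b :* c) :* e := a :* (c :* f :+ d :* e) :+ b :* (c :* e :- d :* f))
      refl (seq a n) (seq b n) (seq c n) (seq d n) (seq e n) (seq f n))

  *-comm : ∀ z w → z * w ≈ w * z
  *-comm (a +i b) (c +i d) = mk≈
    (pointwise λ n → solveℚ 4 (λ a b c d →
        a :* c :- b :* d := c :* a :- d :* b)
      refl (seq a n) (seq b n) (seq c n) (seq d n))
    (pointwise λ n → solveℚ 4 (λ a b c d →
        a :* d :+ b :* c := c :* b :+ d :* a)
      refl (seq a n) (seq b n) (seq c n) (seq d n))

  *-identityˡ : ∀ z → 1ℂ * z ≈ z
  *-identityˡ (a +i b) = mk≈
    (pointwise λ n → solveℚ 2 (λ a b → con 1ℚ :* a :- con 0ℚ :* b := a) refl (seq a n) (seq b n))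
    (pointwise λ n → solveℚ 2 (λ a b → con 1ℚ :* b :+ con 0ℚ :* a := b) refl (seq a n) (seq b n))

  *-distribˡ-+ : ∀ z w v → z * (w + v) ≈ z * w + z * v
  *-distribˡ-+ (a +i b) (c +i d) (e +i f) = mk≈
    (pointwise λ n → solveℚ 6 (λ a b c d e f →
        a :* (c :+ e) :- b :* (d :+ f) := (a :* c :- b :* d) :+ (a :* e :- b :* f))
      refl (seq a n) (seq b n) (seq c n) (seq d n) (seq e n) (seq f n))
    (pointwise λ n → solveℚ 6 (λ a b c d e f →
        a :* (d :+ f) :+ b :* (c :+ e) := (a :* d :+ b :* c) :+ (a :* f :+ b :* e))
      refl (seq a n) (seq b n) (seq c n) (seq d n) (seq e n) (seq f n))

  conj-* : ∀ z w → conj (z * w) ≈ conj z * conj w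
  conj-* (a +i b) (c +i d) = mk≈
    (pointwise λ n → solveℚ 4 (λ a b c d →
        a :* c :- b :* d := a :* c :- (:- b) :* (:- d))
      refl (seq a n) (seq b n) (seq c n) (seq d n))
    (pointwise λ n → solveℚ 4 (λ a b c d →
        :- (a :* d :+ b :* c) := a :* (:- d) :+ (:- b) :* c)
      refl (seq a n) (seq b n) (seq c n) (seq d n))

  conj-involutive : ∀ z → conj (conj z) ≈ z
  conj-involutive (a +i b) = mk≈
    (pointwise λ n → solveℚ 2 (λ a b → a := a) refl (seq a n) (seq b n))
    (pointwise λ n → solveℚ 2 (λ a b → :- (:- b) := b) refl (seq a n) (seq b n))

  conj-0 : conj 0ℂ ≈ 0ℂ
  conj-0 = mk≈ (pointwise λ _ → refl) (pointwise λ _ → refl)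

  conj-1 : conj 1ℂ ≈ 1ℂ
  conj-1 = mk≈ (pointwise λ _ → refl) (pointwise λ _ → refl)

  i*i : i * i ≈ - 1ℂ
  i*i = mk≈ (pointwise λ _ → refl) (pointwise λ _ → refl)

  conj-i : conj i ≈ - i
  conj-i = mk≈ (pointwise λ _ → refl) (pointwise λ _ → refl)

  Invertible : Pred ℂ 0ℓ
  Invertible = Nonzero

  inverse-of : ∀ {z} → Invertible z → ∃[ w ] z * w ≈ 1ℂ
  inverse-of nz = nz

  invertible-by : ∀ z {w} → z * w ≈ 1ℂ → Invertible z
  invertible-by z {w} zw≈1 = w , zw≈1

1≉0 : ¬ (1ℂ ≈ 0ℂ)
1≉0 (mk≈ (mk≈ℝ h) _) = let N , hN = h 1ℚ (ℚ.positive⁻¹ 1ℚ) in ℚ.<-irrefl refl (hN N ℕ.≤-refl)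

-- Gaussian rationals, where vanishing is decidable

gaussian : ℚ → ℚ → ℂ
gaussian p q = fromℚ p +i fromℚ q

-- A subring of ℂ that contains all phases and in which each element is either zero or invertible.
-- Whatever can be written as a sum of entries of Pauli matrices inherits this dichotomy.
Rational : Pred ℂ 0ℓ
Rational z = ∃[ p ] ∃[ q ] z ≈ gaussian p q

opaque
  unfolding _+_

  gaussian-+ : ∀ p q r s → gaussian p q + gaussian r s ≈ gaussian (p ℚ.+ r) (q ℚ.+ s)
  gaussian-+ p q r s = mk≈ (pointwise λ _ → refl) (pointwise λ _ → refl)

  gaussian-* : ∀ p q r s →
    gaussian p q * gaussian r s ≈ gaussian (p ℚ.* r ℚ.- q ℚ.* s) (p ℚ.* s ℚ.+ q ℚ.* r)
  gaussian-* p q r s = mk≈ (pointwise λ _ → refl) (pointwise λ _ → refl)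

private
  square-pos : ∀ p → p ≡ 0ℚ ⊎ 0ℚ ℚ.< p ℚ.* p
  square-pos p with ℚ.<-cmp p 0ℚ
  ... | tri< p<0 _ _ = inj₂ (ℚ.positive⁻¹ (p ℚ.* p) {{ℚ.neg*neg⇒pos p {{ℚ.negative p<0}} p {{ℚ.negative p<0}}}})
  ... | tri≈ _ p≡0 _ = inj₁ p≡0
  ... | tri> _ _ p>0 = inj₂ (ℚ.positive⁻¹ (p ℚ.* p) {{ℚ.pos*pos⇒pos p {{ℚ.positive p>0}} p {{ℚ.positive p>0}}}})

  square-nonneg : ∀ p → 0ℚ ℚ.≤ p ℚ.* p
  square-nonneg p with square-pos p
  ... | inj₁ refl = ℚ.≤-refl
  ... | inj₂ 0<p² = ℚ.<⇒≤ 0<p²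

  invert : ∀ p q → 0ℚ ℚ.< p ℚ.* p ℚ.+ q ℚ.* q → Invertible (gaussian p q)
  -- The witness is the conjugate divided by `p² + q²`.
  invert p q 0<m = invertible-by (gaussian p q) {gaussian (p ℚ.* r) (ℚ.- q ℚ.* r)}
    (≈-trans (gaussian-* p q (p ℚ.* r) (ℚ.- q ℚ.* r)) (mk≈
      (pointwise λ _ → trans
        (solveℚ 3 (λ p q r → p :* (p :* r) :- q :* (:- q :* r) := (p :* p :+ q :* q) :* r) refl p q r)
        (ℚ.*-inverseʳ (p ℚ.* p ℚ.+ q ℚ.* q)))
      (pointwise λ _ → solveℚ 3 (λ p q r → p :* (:- q :* r) :+ q :* (p :* r) := con 0ℚ) refl p q r)))
    where
    instance
      m≢0 : ℚ.NonZero (p ℚ.* p ℚ.+ q ℚ.* q)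
      m≢0 = ℚ.pos⇒nonZero (p ℚ.* p ℚ.+ q ℚ.* q) {{ℚ.positive 0<m}}
    r = ℚ.1/ (p ℚ.* p ℚ.+ q ℚ.* q)

gaussian-decide : ∀ p q → gaussian p q ≈ 0ℂ ⊎ Invertible (gaussian p q)
gaussian-decide p q = decide (square-pos p) (square-pos q)
  where
  decide : p ≡ 0ℚ ⊎ 0ℚ ℚ.< p ℚ.* p → q ≡ 0ℚ ⊎ 0ℚ ℚ.< q ℚ.* q → gaussian p q ≈ 0ℂ ⊎ Invertible (gaussian p q)
  decide (inj₁ refl) (inj₁ refl) = inj₁ ≈-refl
  decide (inj₁ p≡0)  (inj₂ 0<q²) = inj₂ (invert p q (ℚ.+-mono-≤-< (square-nonneg p) 0<q²))
  decide (inj₂ 0<p²) _           = inj₂ (invert p q (ℚ.+-mono-<-≤ 0<p² (square-nonneg q)))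

-- The ring ℂ: invertible elements, signs and powers of i

≈-setoid : Setoid 0ℓ 0ℓ
≈-setoid = record
  { Carrier = ℂ ; _≈_ = _≈_ ; isEquivalence = record { refl = ≈-refl ; sym = ≈-sym ; trans = ≈-trans } }

ℂ-commutativeRing : CommutativeRing 0ℓ 0ℓ
ℂ-commutativeRing = record
  { Carrier = ℂ ; _≈_ = _≈_ ; _+_ = _+_ ; _*_ = _*_ ; -_ = -_ ; 0# = 0ℂ ; 1# = 1ℂ
  ; isCommutativeRing = record
    { isRing = record
      { +-isAbelianGroup = record
        { isGroup = record
          { isMonoid = record
            { isSemigroup = record
              { isMagma = record
                { isEquivalence = Setoid.isEquivalence ≈-setoid
                ; ∙-cong = +-cong
                }
              ; assoc = +-assoc
              }
            ; identity = comm∧idˡ⇒id +-comm +-identityˡ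
            }
          ; inverse = comm∧invˡ⇒inv +-comm -‿inverseˡ
          ; ⁻¹-cong = -‿cong
          }
        ; comm = +-comm
        }
      ; *-cong = *-cong
      ; *-assoc = *-assoc
      ; *-identity = comm∧idˡ⇒id *-comm *-identityˡ
      ; distrib = comm∧distrˡ⇒distr +-cong *-comm *-distribˡ-+
      }
    ; *-comm = *-comm
    }
  }
  where open import Algebra.Consequences.Setoid ≈-setoid

open CommutativeRing ℂ-commutativeRing
  using (+-identityʳ; *-identityʳ; zeroˡ; zeroʳ; setoid; reflexive; ring; distribʳ; *-commutativeMonoid;
         +-commutativeSemigroup; *-commutativeSemigroup)
open import Algebra.Properties.Ring ring using (-‿distribˡ-*; -1*x≈-x; -‿involutive)
open import Algebra.Properties.CommutativeSemigroup +-commutativeSemigroup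
  using () renaming (interchange to +-interchange)
open import Algebra.Properties.CommutativeSemigroup *-commutativeSemigroup
  using (x∙yz≈y∙xz) renaming (interchange to *-interchange)
open import Relation.Binary.Reasoning.Setoid setoid
open import Algebra.Solver.CommutativeMonoid *-commutativeMonoid using (solve; _⊜_) renaming (_⊕_ to _⊗_)

*-congˡ : ∀ {z w w′} → w ≈ w′ → z * w ≈ z * w′
*-congˡ = *-cong ≈-refl

*-congʳ : ∀ {z z′ w} → z ≈ z′ → z * w ≈ z′ * w
*-congʳ z≈z′ = *-cong z≈z′ ≈-refl

invertible-resp : ∀ {z w} → z ≈ w → Invertible z → Invertible w
invertible-resp {z} {w} z≈w z≠0 = let z⁻¹ , zz⁻¹≈1 = inverse-of z≠0 in
  invertible-by w (≈-trans (*-congʳ (≈-sym z≈w)) zz⁻¹≈1)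

invertible⇒≉0 : ∀ {z} → Invertible z → ¬ (z ≈ 0ℂ)
invertible⇒≉0 z≠0 z≈0 = let z⁻¹ , zz⁻¹≈1 = inverse-of z≠0 in
  1≉0 (≈-trans (≈-sym zz⁻¹≈1) (≈-trans (*-congʳ z≈0) (zeroˡ z⁻¹)))

invertible-factorˡ : ∀ {z w} → Invertible (z * w) → Invertible z
invertible-factorˡ {z} {w} zw≠0 = let v , zwv≈1 = inverse-of zw≠0 in
  invertible-by z (≈-trans (≈-sym (*-assoc z w v)) zwv≈1)

invertible-factorʳ : ∀ {z w} → Invertible (z * w) → Invertible w
invertible-factorʳ {z} {w} zw≠0 = invertible-factorˡ (invertible-resp (*-comm z w) zw≠0)

invertible-product : ∀ {z w} → Invertible z → Invertible w → Invertible (z * w)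
invertible-product {z} {w} z≠0 w≠0 =
  let z⁻¹ , zz⁻¹≈1 = inverse-of z≠0 ; w⁻¹ , ww⁻¹≈1 = inverse-of w≠0 in
  invertible-by (z * w) (begin
    z * w * (z⁻¹ * w⁻¹)    ≈⟨ *-interchange z w z⁻¹ w⁻¹ ⟩
    z * z⁻¹ * (w * w⁻¹)    ≈⟨ *-cong zz⁻¹≈1 ww⁻¹≈1 ⟩
    1ℂ * 1ℂ                ≈⟨ *-identityˡ 1ℂ ⟩
    1ℂ                     ∎)

invertible-conj : ∀ {z} → Invertible z → Invertible (conj z)
invertible-conj {z} z≠0 = let z⁻¹ , zz⁻¹≈1 = inverse-of z≠0 in
  invertible-by (conj z) (≈-trans (≈-sym (conj-* z z⁻¹)) (≈-trans (conj-cong zz⁻¹≈1) conj-1))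

*-cancelˡ-invertible : ∀ {z w v} → Invertible z → z * w ≈ z * v → w ≈ v
*-cancelˡ-invertible {z} {w} {v} z≠0 zw≈zv = let z⁻¹ , zz⁻¹≈1 = inverse-of z≠0 in
  begin
    w                ≈⟨ *-identityˡ w ⟨
    1ℂ * w           ≈⟨ *-congʳ zz⁻¹≈1 ⟨
    z * z⁻¹ * w      ≈⟨ solve 3 (λ a b c → (a ⊗ b) ⊗ c ⊜ b ⊗ (a ⊗ c)) ≈-refl z z⁻¹ w ⟩
    z⁻¹ * (z * w)    ≈⟨ *-congˡ zw≈zv ⟩
    z⁻¹ * (z * v)    ≈⟨ solve 3 (λ a b c → (a ⊗ b) ⊗ c ⊜ b ⊗ (a ⊗ c)) ≈-refl z z⁻¹ v ⟨
    z * z⁻¹ * v      ≈⟨ *-congʳ zz⁻¹≈1 ⟩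
    1ℂ * v           ≈⟨ *-identityˡ v ⟩
    v                ∎

rational-+ : ∀ {z w} → Rational z → Rational w → Rational (z + w)
rational-+ (p , q , z≈) (r , s , w≈) = _ , _ , ≈-trans (+-cong z≈ w≈) (gaussian-+ p q r s)

rational-* : ∀ {z w} → Rational z → Rational w → Rational (z * w)
rational-* (p , q , z≈) (r , s , w≈) = _ , _ , ≈-trans (*-cong z≈ w≈) (gaussian-* p q r s)

rational-1 : Rational 1ℂ
rational-1 = 1ℚ , 0ℚ , ≈-refl

rational-decide : ∀ {z} → Rational z → z ≈ 0ℂ ⊎ Invertible z
rational-decide (p , q , z≈) with gaussian-decide p q
... | inj₁ ≈0 = inj₁ (≈-trans z≈ ≈0)
... | inj₂ ≠0 = inj₂ (invertible-resp (≈-sym z≈) ≠0)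

sgn : Bool → ℂ
sgn false = 1ℂ
sgn true  = - 1ℂ

-1*-1≈1 : - 1ℂ * - 1ℂ ≈ 1ℂ
-1*-1≈1 = ≈-trans (-1*x≈-x (- 1ℂ)) (-‿involutive 1ℂ)

sgn-xor : ∀ a b → sgn (a xor b) ≈ sgn a * sgn b
sgn-xor false b     = ≈-sym (*-identityˡ (sgn b))
sgn-xor true  false = ≈-sym (*-identityʳ (- 1ℂ))
sgn-xor true  true  = ≈-sym -1*-1≈1

sgn*sgn≈1 : ∀ a → sgn a * sgn a ≈ 1ℂ
sgn*sgn≈1 false = *-identityˡ 1ℂ
sgn*sgn≈1 true  = -1*-1≈1

opaque
  unfolding _+_

  conj-neg : ∀ z → conj (- z) ≈ - conj z
  conj-neg z = ≈-refl

conj-sgn : ∀ a → conj (sgn a) ≈ sgn a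
conj-sgn false = conj-1
conj-sgn true  = ≈-trans (conj-neg 1ℂ) (-‿cong conj-1)

opaque
  infix 9 i^_

  i^_ : ℕ → ℂ
  i^_ = D.i^_

opaque
  unfolding _+_ i^_

  i^-zero : i^ 0 ≡ 1ℂ
  i^-zero = refl

  i^-suc : ∀ k → i^ suc k ≡ i * i^ k
  i^-suc k = refl

i^-+ : ∀ k l → i^ (k ℕ.+ l) ≈ i^ k * i^ l
i^-+ zero l = begin
  i^ l           ≈⟨ *-identityˡ (i^ l) ⟨
  1ℂ * i^ l      ≡⟨ cong (_* i^ l) i^-zero ⟨
  i^ 0 * i^ l    ∎
i^-+ (suc k) l = begin
  i^ suc (k ℕ.+ l)       ≡⟨ i^-suc (k ℕ.+ l) ⟩
  i * i^ (k ℕ.+ l)       ≈⟨ *-congˡ (i^-+ k l) ⟩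
  i * (i^ k * i^ l)      ≈⟨ *-assoc i (i^ k) (i^ l) ⟨
  i * i^ k * i^ l        ≡⟨ cong (_* i^ l) (i^-suc k) ⟨
  i^ suc k * i^ l        ∎

i^1≈i : i^ 1 ≈ i
i^1≈i = ≈-trans (reflexive (trans (i^-suc 0) (cong (i *_) i^-zero))) (*-identityʳ i)

i^2≈-1 : i^ 2 ≈ - 1ℂ
i^2≈-1 = ≈-trans (reflexive (i^-suc 1)) (≈-trans (*-congˡ i^1≈i) i*i)

i^4≈1 : i^ 4 ≈ 1ℂ
i^4≈1 = ≈-trans (i^-+ 2 2) (≈-trans (*-cong i^2≈-1 i^2≈-1) -1*-1≈1)

Phase : Pred ℂ 0ℓ
Phase z = ∃[ k ] z ≈ i^ k

phase-* : ∀ {z w} → Phase z → Phase w → Phase (z * w)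
phase-* (k , z≈) (l , w≈) = k ℕ.+ l , ≈-trans (*-cong z≈ w≈) (≈-sym (i^-+ k l))

phase-resp : ∀ {z w} → z ≈ w → Phase z → Phase w
phase-resp z≈w (k , z≈) = k , ≈-trans (≈-sym z≈w) z≈

phase-1 : Phase 1ℂ
phase-1 = 0 , reflexive (sym i^-zero)

phase-i : Phase i
phase-i = 1 , ≈-sym i^1≈i

phase-sgn : ∀ a → Phase (sgn a)
phase-sgn false = phase-1
phase-sgn true  = 2 , ≈-sym i^2≈-1

phase-rational : ∀ {z} → Phase z → Rational z
phase-rational (k , z≈) = let p , q , ≈g = power k in p , q , ≈-trans z≈ ≈g
  where
  power : ∀ k → Rational (i^ k)
  power zero    = subst Rational (sym i^-zero) rational-1
  power (suc k) = subst Rational (sym (i^-suc k)) (rational-* (0ℚ , 1ℚ , ≈-refl) (power k))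

phase-norm : ∀ {z} → Phase z → conj z * z ≈ 1ℂ
phase-norm (k , z≈) = ≈-trans (*-cong (conj-cong z≈) z≈) (power k)
  where
  power : ∀ k → conj (i^ k) * i^ k ≈ 1ℂ
  power zero = subst (λ z → conj z * z ≈ 1ℂ) (sym i^-zero)
    (≈-trans (*-identityʳ (conj 1ℂ)) conj-1)
  power (suc k) = subst (λ z → conj z * z ≈ 1ℂ) (sym (i^-suc k)) (begin
    conj (i * i^ k) * (i * i^ k)          ≈⟨ *-congʳ (conj-* i (i^ k)) ⟩
    conj i * conj (i^ k) * (i * i^ k)     ≈⟨ *-interchange (conj i) (conj (i^ k)) i (i^ k) ⟩
    conj i * i * (conj (i^ k) * i^ k)     ≈⟨ *-cong (*-congʳ conj-i) (power k) ⟩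
    - i * i * 1ℂ                          ≈⟨ *-identityʳ (- i * i) ⟩
    - i * i                               ≈⟨ -‿distribˡ-* i i ⟨
    - (i * i)                             ≈⟨ -‿cong i*i ⟩
    - - 1ℂ                                ≈⟨ -‿involutive 1ℂ ⟩
    1ℂ                                    ∎)

phase-invertible : ∀ {z} → Phase z → Invertible z
phase-invertible {z} z∈ = invertible-by z (≈-trans (*-comm z (conj z)) (phase-norm z∈))

-- Bit strings and sums over them

open CommutativeRing xor-∧-commutativeRing using ()
  renaming (+-commutativeSemigroup to xor-commutativeSemigroup)
open import Algebra.Properties.CommutativeSemigroup xor-commutativeSemigroup
  using () renaming (interchange to xor-interchange)

infixl 6 _⊕_

_⊕_ : ∀ {n} → Bits n → Bits n → Bits n
_⊕_ = zipWith _xor_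

𝟎 : ∀ {n} → Bits n
𝟎 = replicate _ false

⊕-comm : ∀ {n} (x y : Bits n) → x ⊕ y ≡ y ⊕ x
⊕-comm = zipWith-comm xor-comm

⊕-assoc : ∀ {n} (x y z : Bits n) → (x ⊕ y) ⊕ z ≡ x ⊕ (y ⊕ z)
⊕-assoc = zipWith-assoc xor-assoc

⊕-identityˡ : ∀ {n} (x : Bits n) → 𝟎 ⊕ x ≡ x
⊕-identityˡ = zipWith-identityˡ (λ _ → refl)

⊕-identityʳ : ∀ {n} (x : Bits n) → x ⊕ 𝟎 ≡ x
⊕-identityʳ = zipWith-identityʳ xor-identityʳ

⊕-same : ∀ {n} (x : Bits n) → x ⊕ x ≡ 𝟎
⊕-same []      = refl
⊕-same (a ∷ x) = cong₂ _∷_ (xor-same a) (⊕-same x)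

⊕-cancelʳ : ∀ {n} (x u : Bits n) → (x ⊕ u) ⊕ u ≡ x
⊕-cancelʳ x u = trans (⊕-assoc x u u) (trans (cong (x ⊕_) (⊕-same u)) (⊕-identityʳ x))

⊕-cancelˡ : ∀ {n} (u x : Bits n) → u ⊕ (u ⊕ x) ≡ x
⊕-cancelˡ u x = trans (⊕-comm u (u ⊕ x)) (trans (cong (_⊕ u) (⊕-comm u x)) (⊕-cancelʳ x u))

⟨⟩-comm : ∀ {n} (x y : Bits n) → ⟨ x , y ⟩ ≡ ⟨ y , x ⟩
⟨⟩-comm []      []      = refl
⟨⟩-comm (a ∷ x) (b ∷ y) = cong₂ _xor_ (∧-comm a b) (⟨⟩-comm x y)

⟨⟩-⊕ʳ : ∀ {n} (a x y : Bits n) → ⟨ a , x ⊕ y ⟩ ≡ ⟨ a , x ⟩ xor ⟨ a , y ⟩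
⟨⟩-⊕ʳ []      []      []      = refl
⟨⟩-⊕ʳ (a ∷ r) (b ∷ x) (c ∷ y) = trans
  (cong₂ _xor_ (∧-distribˡ-xor a b c) (⟨⟩-⊕ʳ r x y))
  (xor-interchange (a ∧ b) (a ∧ c) ⟨ r , x ⟩ ⟨ r , y ⟩)

⟨⟩-⊕ˡ : ∀ {n} (a b x : Bits n) → ⟨ a ⊕ b , x ⟩ ≡ ⟨ a , x ⟩ xor ⟨ b , x ⟩
⟨⟩-⊕ˡ a b x = trans (⟨⟩-comm (a ⊕ b) x)
  (trans (⟨⟩-⊕ʳ x a b) (cong₂ _xor_ (⟨⟩-comm x a) (⟨⟩-comm x b)))

⟨⟩-𝟎ˡ : ∀ {n} (x : Bits n) → ⟨ 𝟎 , x ⟩ ≡ false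
⟨⟩-𝟎ˡ []      = refl
⟨⟩-𝟎ˡ (_ ∷ x) = ⟨⟩-𝟎ˡ x

⟨⟩-𝟎ʳ : ∀ {n} (x : Bits n) → ⟨ x , 𝟎 ⟩ ≡ false
⟨⟩-𝟎ʳ x = trans (⟨⟩-comm x 𝟎) (⟨⟩-𝟎ˡ x)

⟨⟩-++ : ∀ {m n} (a x : Bits m) (b y : Bits n) → ⟨ a ++ b , x ++ y ⟩ ≡ ⟨ a , x ⟩ xor ⟨ b , y ⟩
⟨⟩-++ []      []      b y = refl
⟨⟩-++ (s ∷ a) (t ∷ x) b y = trans (cong ((s ∧ t) xor_) (⟨⟩-++ a x b y))
  (sym (xor-assoc (s ∧ t) ⟨ a , x ⟩ ⟨ b , y ⟩))

⟨⟩-∷ʳ : ∀ {n} (a x : Bits n) s t → ⟨ a ∷ʳ s , x ∷ʳ t ⟩ ≡ ⟨ a , x ⟩ xor (s ∧ t)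
⟨⟩-∷ʳ []      []      s t = xor-comm (s ∧ t) false
⟨⟩-∷ʳ (b ∷ a) (c ∷ x) s t = trans (cong ((b ∧ c) xor_) (⟨⟩-∷ʳ a x s t))
  (sym (xor-assoc (b ∧ c) ⟨ a , x ⟩ (s ∧ t)))

⟨⟩-reverse : ∀ {n} (a x : Bits n) → ⟨ reverse a , reverse x ⟩ ≡ ⟨ a , x ⟩
⟨⟩-reverse []      []      = refl
⟨⟩-reverse (s ∷ a) (t ∷ x) =
  trans (cong₂ ⟨_,_⟩ (reverse-∷ s a) (reverse-∷ t x))
  (trans (⟨⟩-∷ʳ (reverse a) (reverse x) s t)
  (trans (cong (_xor (s ∧ t)) (⟨⟩-reverse a x)) (xor-comm ⟨ a , x ⟩ (s ∧ t))))

⊕-++ : ∀ {m n} (a x : Bits m) (b y : Bits n) → (a ++ b) ⊕ (x ++ y) ≡ (a ⊕ x) ++ (b ⊕ y)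
⊕-++ []      []      b y = refl
⊕-++ (s ∷ a) (t ∷ x) b y = cong ((s xor t) ∷_) (⊕-++ a x b y)

⊕-∷ʳ : ∀ {n} (a x : Bits n) s t → (a ∷ʳ s) ⊕ (x ∷ʳ t) ≡ (a ⊕ x) ∷ʳ (s xor t)
⊕-∷ʳ []      []      s t = refl
⊕-∷ʳ (b ∷ a) (c ∷ x) s t = cong ((b xor c) ∷_) (⊕-∷ʳ a x s t)

⊕-reverse : ∀ {n} (a x : Bits n) → reverse a ⊕ reverse x ≡ reverse (a ⊕ x)
⊕-reverse []      []      = refl
⊕-reverse (s ∷ a) (t ∷ x) =
  trans (cong₂ _⊕_ (reverse-∷ s a) (reverse-∷ t x))
  (trans (⊕-∷ʳ (reverse a) (reverse x) s t)
  (trans (cong (_∷ʳ (s xor t)) (⊕-reverse a x)) (sym (reverse-∷ (s xor t) (a ⊕ x)))))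

-- Finiteness of the cube takes the place of excluded middle. `Q` is kept separate from the negation
-- of `P` because the alternatives in use are positive on both sides, such as being invertible and
-- being zero.
search : ∀ n {P Q : Bits n → Set} → (∀ x → P x ⊎ Q x) → ∃ P ⊎ (∀ x → Q x)
search zero    P⊎Q with P⊎Q []
... | inj₁ p = inj₁ ([] , p)
... | inj₂ q = inj₂ λ { [] → q }
search (suc n) P⊎Q with search n (λ x → P⊎Q (false ∷ x)) | search n (λ x → P⊎Q (true ∷ x))
... | inj₁ (x , p) | _            = inj₁ (false ∷ x , p)
... | inj₂ _       | inj₁ (x , p) = inj₁ (true ∷ x , p)
... | inj₂ q₀      | inj₂ q₁      = inj₂ λ { (false ∷ x) → q₀ x ; (true ∷ x) → q₁ x }

_≟_ : ∀ {n} (x y : Bits n) → Dec (x ≡ y)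
_≟_ = ≡-dec _≟ᵇ_

-- Finite sums over bit strings and the identity matrix

opaque
  Σ[_] : ∀ n → (Bits n → ℂ) → ℂ
  Σ[_] = D.Σ[_]

opaque
  𝟙 : ∀ {n} → Mat n
  𝟙 = D.𝟙

private
  opaque
    unfolding _+_

    Σ-∷-defs : ∀ n f →
      D.Σ[ suc n ] f ≡ D.Σ[ n ] (λ x → f (false ∷ x)) + D.Σ[ n ] (λ x → f (true ∷ x))
    Σ-∷-defs n f = refl

    𝟙-∷-defs : ∀ {n} a b (x y : Bits n) → D.𝟙 (a ∷ x) (b ∷ y) ≡ δ₂ a b * D.𝟙 x y
    𝟙-∷-defs a b x y = refl

opaque
  unfolding Σ[_] 𝟙

  Σ-[] : ∀ f → Σ[ 0 ] f ≡ f []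
  Σ-[] f = refl

  Σ-∷ : ∀ n f → Σ[ suc n ] f ≡ Σ[ n ] (λ x → f (false ∷ x)) + Σ[ n ] (λ x → f (true ∷ x))
  Σ-∷ = Σ-∷-defs

  𝟙-[] : 𝟙 [] [] ≡ 1ℂ
  𝟙-[] = refl

  𝟙-∷ : ∀ {n} a b (x y : Bits n) → 𝟙 (a ∷ x) (b ∷ y) ≡ δ₂ a b * 𝟙 x y
  𝟙-∷ = 𝟙-∷-defs

Σ-cong : ∀ n {f g} → (∀ x → f x ≈ g x) → Σ[ n ] f ≈ Σ[ n ] g
Σ-cong zero    {f} {g} f≈g = begin
  Σ[ 0 ] f    ≡⟨ Σ-[] f ⟩
  f []        ≈⟨ f≈g [] ⟩
  g []        ≡⟨ Σ-[] g ⟨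
  Σ[ 0 ] g    ∎
Σ-cong (suc n) {f} {g} f≈g = begin
  Σ[ suc n ] f                                                   ≡⟨ Σ-∷ n f ⟩
  Σ[ n ] (λ x → f (false ∷ x)) + Σ[ n ] (λ x → f (true ∷ x))     ≈⟨ +-cong (Σ-cong n λ x → f≈g (false ∷ x))
                                                                           (Σ-cong n λ x → f≈g (true ∷ x)) ⟩
  Σ[ n ] (λ x → g (false ∷ x)) + Σ[ n ] (λ x → g (true ∷ x))     ≡⟨ Σ-∷ n g ⟨
  Σ[ suc n ] g                                                   ∎

Σ-closed : ∀ {P : Pred ℂ 0ℓ} → (∀ {z w} → P z → P w → P (z + w)) →
  ∀ n {f} → (∀ x → P (f x)) → P (Σ[ n ] f)
Σ-closed {P} _ zero {f} Pf    = subst P (sym (Σ-[] f)) (Pf [])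
Σ-closed {P} P+ (suc n) {f} Pf = subst P (sym (Σ-∷ n f))
  (P+ (Σ-closed {P} P+ n λ x → Pf (false ∷ x)) (Σ-closed {P} P+ n λ x → Pf (true ∷ x)))

Σ-zero : ∀ n {f} → (∀ x → f x ≈ 0ℂ) → Σ[ n ] f ≈ 0ℂ
Σ-zero = Σ-closed {_≈ 0ℂ} λ z≈0 w≈0 → ≈-trans (+-cong z≈0 w≈0) (+-identityˡ 0ℂ)

Σ-homo : (h : ℂ → ℂ) → (∀ {z w} → z ≈ w → h z ≈ h w) → (∀ z w → h (z + w) ≈ h z + h w) →
  ∀ n f → h (Σ[ n ] f) ≈ Σ[ n ] (λ x → h (f x))
Σ-homo h h-cong h-+ zero    f = ≈-trans (h-cong (reflexive (Σ-[] f))) (reflexive (sym (Σ-[] λ x → h (f x))))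
Σ-homo h h-cong h-+ (suc n) f = begin
  h (Σ[ suc n ] f)
    ≈⟨ h-cong (reflexive (Σ-∷ n f)) ⟩
  h (Σ[ n ] (λ x → f (false ∷ x)) + Σ[ n ] (λ x → f (true ∷ x)))
    ≈⟨ h-+ (Σ[ n ] (λ x → f (false ∷ x))) (Σ[ n ] (λ x → f (true ∷ x))) ⟩
  h (Σ[ n ] (λ x → f (false ∷ x))) + h (Σ[ n ] (λ x → f (true ∷ x)))
    ≈⟨ +-cong (Σ-homo h h-cong h-+ n λ x → f (false ∷ x)) (Σ-homo h h-cong h-+ n λ x → f (true ∷ x)) ⟩
  Σ[ n ] (λ x → h (f (false ∷ x))) + Σ[ n ] (λ x → h (f (true ∷ x)))
    ≡⟨ Σ-∷ n (λ x → h (f x)) ⟨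
  Σ[ suc n ] (λ x → h (f x))
    ∎

*-Σ : ∀ z n f → z * Σ[ n ] f ≈ Σ[ n ] (λ x → z * f x)
*-Σ z = Σ-homo (z *_) *-congˡ (*-distribˡ-+ z)

Σ-* : ∀ z n f → Σ[ n ] f * z ≈ Σ[ n ] (λ x → f x * z)
Σ-* z = Σ-homo (_* z) *-congʳ (distribʳ z)

Σ-+ : ∀ n f g → Σ[ n ] (λ x → f x + g x) ≈ Σ[ n ] f + Σ[ n ] g
Σ-+ zero    f g = begin
  Σ[ 0 ] (λ x → f x + g x)    ≡⟨ Σ-[] (λ x → f x + g x) ⟩
  f [] + g []                 ≡⟨ cong₂ _+_ (Σ-[] f) (Σ-[] g) ⟨
  Σ[ 0 ] f + Σ[ 0 ] g         ∎
Σ-+ (suc n) f g = begin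
  Σ[ suc n ] (λ x → f x + g x)              ≡⟨ Σ-∷ n (λ x → f x + g x) ⟩
  Σ[ n ] (λ x → f (false ∷ x) + g (false ∷ x)) + Σ[ n ] (λ x → f (true ∷ x) + g (true ∷ x))
                                            ≈⟨ +-cong (Σ-+ n _ _) (Σ-+ n _ _) ⟩
  (f₀ + g₀) + (f₁ + g₁)                     ≈⟨ +-interchange f₀ g₀ f₁ g₁ ⟩
  (f₀ + f₁) + (g₀ + g₁)                     ≡⟨ cong₂ _+_ (Σ-∷ n f) (Σ-∷ n g) ⟨
  Σ[ suc n ] f + Σ[ suc n ] g               ∎
  where
  f₀ = Σ[ n ] (λ x → f (false ∷ x))
  f₁ = Σ[ n ] (λ x → f (true ∷ x))
  g₀ = Σ[ n ] (λ x → g (false ∷ x))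
  g₁ = Σ[ n ] (λ x → g (true ∷ x))

Σ-swap : ∀ m n (f : Bits m → Bits n → ℂ) →
  Σ[ m ] (λ x → Σ[ n ] (λ y → f x y)) ≈ Σ[ n ] (λ y → Σ[ m ] (λ x → f x y))
Σ-swap zero n f = begin
  Σ[ 0 ] (λ x → Σ[ n ] (f x))              ≡⟨ Σ-[] (λ x → Σ[ n ] (f x)) ⟩
  Σ[ n ] (f [])                            ≈⟨ Σ-cong n (λ y → reflexive (sym (Σ-[] λ x → f x y))) ⟩
  Σ[ n ] (λ y → Σ[ 0 ] (λ x → f x y))      ∎
Σ-swap (suc m) n f = begin
  Σ[ suc m ] (λ x → Σ[ n ] (f x))
    ≡⟨ Σ-∷ m (λ x → Σ[ n ] (f x)) ⟩
  Σ[ m ] (λ x → Σ[ n ] (f (false ∷ x))) + Σ[ m ] (λ x → Σ[ n ] (f (true ∷ x)))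
    ≈⟨ +-cong (Σ-swap m n λ x → f (false ∷ x)) (Σ-swap m n λ x → f (true ∷ x)) ⟩
  Σ[ n ] (λ y → Σ[ m ] (λ x → f (false ∷ x) y)) + Σ[ n ] (λ y → Σ[ m ] (λ x → f (true ∷ x) y))
    ≈⟨ Σ-+ n _ _ ⟨
  Σ[ n ] (λ y → Σ[ m ] (λ x → f (false ∷ x) y) + Σ[ m ] (λ x → f (true ∷ x) y))
    ≈⟨ Σ-cong n (λ y → reflexive (sym (Σ-∷ m λ x → f x y))) ⟩
  Σ[ n ] (λ y → Σ[ suc m ] (λ x → f x y))
    ∎

-- The first bit of `u` decides whether the two halves of the sum stay in place or change places.
Σ-translate : ∀ n u f → Σ[ n ] (λ x → f (x ⊕ u)) ≈ Σ[ n ] f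
Σ-translate zero    []      f = Σ-cong 0 λ { [] → ≈-refl }
Σ-translate (suc n) (a ∷ u) f = ≈-trans (reflexive (Σ-∷ n λ x → f (x ⊕ (a ∷ u)))) (halves a)
  where
  halves : ∀ a → Σ[ n ] (λ x → f (a ∷ (x ⊕ u))) + Σ[ n ] (λ x → f (not a ∷ (x ⊕ u))) ≈ Σ[ suc n ] f
  halves false = ≈-trans (+-cong (Σ-translate n u λ x → f (false ∷ x)) (Σ-translate n u λ x → f (true ∷ x)))
    (reflexive (sym (Σ-∷ n f)))
  halves true  = ≈-trans (+-cong (Σ-translate n u λ x → f (true ∷ x)) (Σ-translate n u λ x → f (false ∷ x)))
    (≈-trans (+-comm _ _) (reflexive (sym (Σ-∷ n f))))

𝟙-refl : ∀ {n} (x : Bits n) → 𝟙 x x ≈ 1ℂ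
𝟙-refl []      = reflexive 𝟙-[]
𝟙-refl (a ∷ x) = begin
  𝟙 (a ∷ x) (a ∷ x)    ≡⟨ 𝟙-∷ a a x x ⟩
  δ₂ a a * 𝟙 x x       ≈⟨ *-cong (reflexive (δ₂-refl a)) (𝟙-refl x) ⟩
  1ℂ * 1ℂ              ≈⟨ *-identityˡ 1ℂ ⟩
  1ℂ                   ∎
  where
  δ₂-refl : ∀ a → δ₂ a a ≡ 1ℂ
  δ₂-refl false = refl
  δ₂-refl true  = refl

𝟙-≢ : ∀ {n} {x y : Bits n} → x ≢ y → 𝟙 x y ≈ 0ℂ
𝟙-≢ {x = []} {[]} x≢y = ⊥-elim (x≢y refl)
𝟙-≢ {x = a ∷ x} {b ∷ y} x≢y = ≈-trans (reflexive (𝟙-∷ a b x y)) (tail a b x≢y)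
  where
  tail : ∀ a b → a ∷ x ≢ b ∷ y → δ₂ a b * 𝟙 x y ≈ 0ℂ
  tail false true  _ = zeroˡ (𝟙 x y)
  tail true  false _ = zeroˡ (𝟙 x y)
  tail false false x≢y = ≈-trans (*-congˡ (𝟙-≢ λ { refl → x≢y refl })) (zeroʳ 1ℂ)
  tail true  true  x≢y = ≈-trans (*-congˡ (𝟙-≢ λ { refl → x≢y refl })) (zeroʳ 1ℂ)

𝟙-*-cong : ∀ {n} (x y : Bits n) {z w} → (x ≡ y → z ≈ w) → 𝟙 x y * z ≈ 𝟙 x y * w
𝟙-*-cong x y {z} {w} z≈w with x ≟ y
... | yes x≡y = *-congˡ (z≈w x≡y)
... | no  x≢y = begin
  𝟙 x y * z    ≈⟨ *-congʳ (𝟙-≢ x≢y) ⟩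
  0ℂ * z       ≈⟨ zeroˡ z ⟩
  0ℂ           ≈⟨ zeroˡ w ⟨
  0ℂ * w       ≈⟨ *-congʳ (𝟙-≢ x≢y) ⟨
  𝟙 x y * w    ∎

𝟙-resp : ∀ {m n} {x y : Bits m} {u v : Bits n} → (x ≡ y → u ≡ v) → (u ≡ v → x ≡ y) → 𝟙 x y ≈ 𝟙 u v
𝟙-resp {x = x} {y} {u} {v} to from with x ≟ y
... | yes refl = ≈-trans (𝟙-refl x) (subst (λ w → 1ℂ ≈ 𝟙 u w) (to refl) (≈-sym (𝟙-refl u)))
... | no x≢y   = ≈-trans (𝟙-≢ x≢y) (≈-sym (𝟙-≢ λ u≡v → x≢y (from u≡v)))

𝟙-sym : ∀ {n} (x y : Bits n) → 𝟙 x y ≈ 𝟙 y x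
𝟙-sym x y = 𝟙-resp sym sym

𝟙-⊕ : ∀ {n} (x u y : Bits n) → 𝟙 (x ⊕ u) y ≈ 𝟙 x (y ⊕ u)
𝟙-⊕ x u y = 𝟙-resp
  (λ eq → trans (sym (⊕-cancelʳ x u)) (cong (_⊕ u) eq))
  (λ eq → trans (cong (_⊕ u) eq) (⊕-cancelʳ y u))

Σ-𝟙 : ∀ n x f → Σ[ n ] (λ z → 𝟙 x z * f z) ≈ f x
Σ-𝟙 zero    []      f = ≈-trans
  (reflexive (trans (Σ-[] λ z → 𝟙 [] z * f z) (cong (_* f []) 𝟙-[]))) (*-identityˡ (f []))
Σ-𝟙 (suc n) (a ∷ x) f = ≈-trans (reflexive (Σ-∷ n λ z → 𝟙 (a ∷ x) z * f z)) (halves a)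
  where
  half : ∀ a b → Σ[ n ] (λ z → 𝟙 (a ∷ x) (b ∷ z) * f (b ∷ z)) ≈ δ₂ a b * f (b ∷ x)
  half a b = begin
    Σ[ n ] (λ z → 𝟙 (a ∷ x) (b ∷ z) * f (b ∷ z))
      ≈⟨ Σ-cong n (λ z → ≈-trans (*-congʳ (reflexive (𝟙-∷ a b x z))) (*-assoc (δ₂ a b) (𝟙 x z) (f (b ∷ z)))) ⟩
    Σ[ n ] (λ z → δ₂ a b * (𝟙 x z * f (b ∷ z)))
      ≈⟨ *-Σ (δ₂ a b) n (λ z → 𝟙 x z * f (b ∷ z)) ⟨
    δ₂ a b * Σ[ n ] (λ z → 𝟙 x z * f (b ∷ z))
      ≈⟨ *-congˡ (Σ-𝟙 n x λ z → f (b ∷ z)) ⟩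
    δ₂ a b * f (b ∷ x)
      ∎
  halves : ∀ a → Σ[ n ] (λ z → 𝟙 (a ∷ x) (false ∷ z) * f (false ∷ z))
               + Σ[ n ] (λ z → 𝟙 (a ∷ x) (true ∷ z) * f (true ∷ z)) ≈ f (a ∷ x)
  halves false = begin
    _                                            ≈⟨ +-cong (half false false) (half false true) ⟩
    1ℂ * f (false ∷ x) + 0ℂ * f (true ∷ x)       ≈⟨ +-cong (*-identityˡ _) (zeroˡ _) ⟩
    f (false ∷ x) + 0ℂ                           ≈⟨ +-identityʳ _ ⟩
    f (false ∷ x)                                ∎
  halves true = begin
    _                                            ≈⟨ +-cong (half true false) (half true true) ⟩
    0ℂ * f (false ∷ x) + 1ℂ * f (true ∷ x)       ≈⟨ +-cong (zeroˡ _) (*-identityˡ _) ⟩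
    0ℂ + f (true ∷ x)                            ≈⟨ +-identityˡ _ ⟩
    f (true ∷ x)                                 ∎

infix 9 2^_

2^_ : ℕ → ℂ
2^ zero    = 1ℂ
2^ (suc n) = 2^ n + 2^ n

opaque
  unfolding _+_

  1+1 : Invertible (1ℂ + 1ℂ)
  1+1 = gaussian ½ 0ℚ , mk≈ (pointwise λ _ → refl) (pointwise λ _ → refl)

double : ∀ z → (1ℂ + 1ℂ) * z ≈ z + z
double z = ≈-trans (distribʳ z 1ℂ 1ℂ) (+-cong (*-identityˡ z) (*-identityˡ z))

2^-invertible : ∀ n → Invertible (2^ n)
2^-invertible zero    = phase-invertible phase-1
2^-invertible (suc n) = invertible-resp (double (2^ n)) (invertible-product 1+1 (2^-invertible n))

-- Orthogonality of the characters of 𝔽₂ⁿ. When the first bits differ, the two halves cancel;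
-- otherwise they are equal and the factor doubles.
Σ-sgn : ∀ n (x y : Bits n) → Σ[ n ] (λ b → sgn ⟨ b , x ⊕ y ⟩) ≈ 2^ n * 𝟙 x y
Σ-sgn zero    []      []      = ≈-trans (reflexive (trans (Σ-[] λ b → sgn ⟨ b , [] ⟩) (sym 𝟙-[])))
  (≈-sym (*-identityˡ (𝟙 [] [])))
Σ-sgn (suc n) (a ∷ x) (c ∷ y) = begin
  Σ[ suc n ] (λ b → sgn ⟨ b , (a xor c) ∷ (x ⊕ y) ⟩)
    ≡⟨ Σ-∷ n (λ b → sgn ⟨ b , (a xor c) ∷ (x ⊕ y) ⟩) ⟩
  S + Σ[ n ] (λ b → sgn ((a xor c) xor ⟨ b , x ⊕ y ⟩))
    ≈⟨ +-cong (Σ-sgn n x y) (≈-trans (Σ-cong n λ b → sgn-xor (a xor c) ⟨ b , x ⊕ y ⟩)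
              (≈-trans (≈-sym (*-Σ (sgn (a xor c)) n (λ b → sgn ⟨ b , x ⊕ y ⟩))) (*-congˡ (Σ-sgn n x y)))) ⟩
  t * 𝟙 x y + sgn (a xor c) * (t * 𝟙 x y)
    ≈⟨ head a c ⟩
  (t + t) * (δ₂ a c * 𝟙 x y)
    ≡⟨ cong ((t + t) *_) (𝟙-∷ a c x y) ⟨
  (t + t) * 𝟙 (a ∷ x) (c ∷ y)
    ∎
  where
  t = 2^ n
  S = Σ[ n ] (λ b → sgn ⟨ b , x ⊕ y ⟩)
  same : t * 𝟙 x y + 1ℂ * (t * 𝟙 x y) ≈ (t + t) * (1ℂ * 𝟙 x y)
  same = begin
    t * 𝟙 x y + 1ℂ * (t * 𝟙 x y)    ≈⟨ +-cong ≈-refl (*-identityˡ _) ⟩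
    t * 𝟙 x y + t * 𝟙 x y           ≈⟨ distribʳ (𝟙 x y) t t ⟨
    (t + t) * 𝟙 x y                 ≈⟨ *-congˡ (*-identityˡ (𝟙 x y)) ⟨
    (t + t) * (1ℂ * 𝟙 x y)          ∎
  differ : t * 𝟙 x y + - 1ℂ * (t * 𝟙 x y) ≈ (t + t) * (0ℂ * 𝟙 x y)
  differ = begin
    t * 𝟙 x y + - 1ℂ * (t * 𝟙 x y)    ≈⟨ +-cong ≈-refl (-1*x≈-x _) ⟩
    t * 𝟙 x y + - (t * 𝟙 x y)         ≈⟨ ≈-trans (+-comm _ _) (-‿inverseˡ _) ⟩
    0ℂ                                ≈⟨ zeroʳ (t + t) ⟨
    (t + t) * 0ℂ                      ≈⟨ *-congˡ (zeroˡ (𝟙 x y)) ⟨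
    (t + t) * (0ℂ * 𝟙 x y)            ∎
  head : ∀ a c → t * 𝟙 x y + sgn (a xor c) * (t * 𝟙 x y) ≈ (t + t) * (δ₂ a c * 𝟙 x y)
  head false false = same
  head false true  = differ
  head true  false = differ
  head true  true  = same

phase-conj : ∀ {z} → Phase z → Phase (conj z)
phase-conj (k , z≈) = phase-resp (≈-sym (conj-cong z≈)) (power k)
  where
  power : ∀ k → Phase (conj (i^ k))
  power zero    = subst (λ z → Phase (conj z)) (sym i^-zero) (phase-resp (≈-sym conj-1) phase-1)
  power (suc k) = subst (λ z → Phase (conj z)) (sym (i^-suc k))
    (phase-resp (≈-sym (conj-* i (i^ k)))
      (phase-* (phase-resp (≈-trans (-1*x≈-x i) (≈-sym conj-i)) (phase-* (phase-sgn true) phase-i)) (power k)))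

-- Intertwining relations and the Gram matrix

sgn-xor-* : ∀ a b z → sgn (a xor b) * z ≈ sgn a * (sgn b * z)
sgn-xor-* a b z = ≈-trans (*-congʳ (sgn-xor a b)) (*-assoc (sgn a) (sgn b) z)

sgn-cancel : ∀ a z → sgn a * (sgn a * z) ≈ z
sgn-cancel a z = ≈-trans (≈-sym (*-assoc (sgn a) (sgn a) z)) (≈-trans (*-congʳ (sgn*sgn≈1 a)) (*-identityˡ z))

-- Up to a phase, (X^u Z^w) M = M (X^v Z^b).
record Intertwines {n} (M : Mat n) (u w v b : Bits n) : Set where
  constructor intertwines
  field
    {scalar} : ℂ
    phase    : Phase scalar
    relation : ∀ x y → M (x ⊕ u) (y ⊕ v) ≈ scalar * (sgn (⟨ w , x ⟩ xor ⟨ b , y ⟩) * M x y)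

-- The second relation is applied at the point already shifted by the first. Its sign is linear in
-- the point, so the shift contributes only the constant `s₀`, the sign from commuting a Z past an
-- X, and the phase absorbs it.
intertwines-⊕ : ∀ {n} (M : Mat n) {u w v b u′ w′ v′ b′} →
  Intertwines M u w v b → Intertwines M u′ w′ v′ b′ →
  Intertwines M (u ⊕ u′) (w ⊕ w′) (v ⊕ v′) (b ⊕ b′)
intertwines-⊕ M {u} {w} {v} {b} {u′} {w′} {v′} {b′} (intertwines {c} c∈ h) (intertwines {c′} c′∈ h′) =
  intertwines (phase-* c′∈ (phase-* (phase-sgn s₀) c∈)) λ x y →
  let s = ⟨ w , x ⟩ xor ⟨ b , y ⟩ ; s′ = ⟨ w′ , x ⟩ xor ⟨ b′ , y ⟩ in begin
  M (x ⊕ (u ⊕ u′)) (y ⊕ (v ⊕ v′))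
    ≡⟨ cong₂ M (⊕-assoc x u u′) (⊕-assoc y v v′) ⟨
  M (x ⊕ u ⊕ u′) (y ⊕ v ⊕ v′)
    ≈⟨ h′ (x ⊕ u) (y ⊕ v) ⟩
  c′ * (sgn (⟨ w′ , x ⊕ u ⟩ xor ⟨ b′ , y ⊕ v ⟩) * M (x ⊕ u) (y ⊕ v))
    ≡⟨ cong (λ t → c′ * (sgn t * M (x ⊕ u) (y ⊕ v))) (trans (cong₂ _xor_ (⟨⟩-⊕ʳ w′ x u) (⟨⟩-⊕ʳ b′ y v))
         (xor-interchange ⟨ w′ , x ⟩ ⟨ w′ , u ⟩ ⟨ b′ , y ⟩ ⟨ b′ , v ⟩)) ⟩
  c′ * (sgn (s′ xor s₀) * M (x ⊕ u) (y ⊕ v))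
    ≈⟨ *-congˡ (*-cong (sgn-xor s′ s₀) (h x y)) ⟩
  c′ * (sgn s′ * sgn s₀ * (c * (sgn s * M x y)))
    ≈⟨ solve 6 (λ c′ s′ s₀ c s m → c′ ⊗ ((s′ ⊗ s₀) ⊗ (c ⊗ (s ⊗ m))) ⊜ (c′ ⊗ (s₀ ⊗ c)) ⊗ ((s ⊗ s′) ⊗ m))
         ≈-refl c′ (sgn s′) (sgn s₀) c (sgn s) (M x y) ⟩
  c′ * (sgn s₀ * c) * (sgn s * sgn s′ * M x y)
    ≈⟨ *-congˡ (*-congʳ (sgn-xor s s′)) ⟨
  c′ * (sgn s₀ * c) * (sgn (s xor s′) * M x y)
    ≡⟨ cong (λ t → c′ * (sgn s₀ * c) * (sgn t * M x y)) (trans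
         (xor-interchange ⟨ w , x ⟩ ⟨ b , y ⟩ ⟨ w′ , x ⟩ ⟨ b′ , y ⟩)
         (sym (cong₂ _xor_ (⟨⟩-⊕ˡ w w′ x) (⟨⟩-⊕ˡ b b′ y)))) ⟩
  c′ * (sgn s₀ * c) * (sgn (⟨ w ⊕ w′ , x ⟩ xor ⟨ b ⊕ b′ , y ⟩) * M x y)
    ∎
  where s₀ = ⟨ w′ , u ⟩ xor ⟨ b′ , v ⟩

-- This form compares the entries of `M X^v Z^b` and `c X^u Z^w M`. It follows from the symmetric
-- form at the row `x ⊕ u`, since a sign is its own inverse. The symmetric form suits simultaneous
-- shifts of both indices, this one suits products of matrices.
intertwines-moved : ∀ {n} (M : Mat n) {u w v b c} →
  (∀ x y → M (x ⊕ u) (y ⊕ v) ≈ c * (sgn (⟨ w , x ⟩ xor ⟨ b , y ⟩) * M x y)) →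
  ∀ x y → M x (y ⊕ v) * sgn ⟨ b , y ⟩ ≈ c * sgn ⟨ w , x ⊕ u ⟩ * M (x ⊕ u) y
intertwines-moved M {u} {w} {v} {b} {c} h x y = begin
  M x (y ⊕ v) * sgn ⟨ b , y ⟩
    ≡⟨ cong (λ t → M t (y ⊕ v) * sgn ⟨ b , y ⟩) (⊕-cancelʳ x u) ⟨
  M (x ⊕ u ⊕ u) (y ⊕ v) * sgn ⟨ b , y ⟩
    ≈⟨ *-congʳ (≈-trans (h (x ⊕ u) y) (*-congˡ (*-congʳ (sgn-xor ⟨ w , x ⊕ u ⟩ ⟨ b , y ⟩)))) ⟩
  c * (sgn ⟨ w , x ⊕ u ⟩ * sgn ⟨ b , y ⟩ * M (x ⊕ u) y) * sgn ⟨ b , y ⟩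
    ≈⟨ solve 4 (λ c s t m → (c ⊗ ((s ⊗ t) ⊗ m)) ⊗ t ⊜ (t ⊗ t) ⊗ ((c ⊗ s) ⊗ m)) ≈-refl
         c (sgn ⟨ w , x ⊕ u ⟩) (sgn ⟨ b , y ⟩) (M (x ⊕ u) y) ⟩
  sgn ⟨ b , y ⟩ * sgn ⟨ b , y ⟩ * (c * sgn ⟨ w , x ⊕ u ⟩ * M (x ⊕ u) y)
    ≈⟨ *-congʳ (sgn*sgn≈1 ⟨ b , y ⟩) ⟩
  1ℂ * (c * sgn ⟨ w , x ⊕ u ⟩ * M (x ⊕ u) y)
    ≈⟨ *-identityˡ _ ⟩
  c * sgn ⟨ w , x ⊕ u ⟩ * M (x ⊕ u) y
    ∎

intertwines-from-moved : ∀ {n} (M : Mat n) {u w v b c} →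
  (∀ x y → M x (y ⊕ v) * sgn ⟨ b , y ⟩ ≈ c * sgn ⟨ w , x ⊕ u ⟩ * M (x ⊕ u) y) →
  ∀ x y → M (x ⊕ u) (y ⊕ v) ≈ c * (sgn (⟨ w , x ⟩ xor ⟨ b , y ⟩) * M x y)
intertwines-from-moved M {u} {w} {v} {b} {c} h x y = begin
  M (x ⊕ u) (y ⊕ v)
    ≈⟨ sgn-cancel ⟨ b , y ⟩ _ ⟨
  sgn ⟨ b , y ⟩ * (sgn ⟨ b , y ⟩ * M (x ⊕ u) (y ⊕ v))
    ≈⟨ *-congˡ (≈-trans (*-comm _ _) (h (x ⊕ u) y)) ⟩
  sgn ⟨ b , y ⟩ * (c * sgn ⟨ w , x ⊕ u ⊕ u ⟩ * M (x ⊕ u ⊕ u) y)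
    ≡⟨ cong (λ t → sgn ⟨ b , y ⟩ * (c * sgn ⟨ w , t ⟩ * M t y)) (⊕-cancelʳ x u) ⟩
  sgn ⟨ b , y ⟩ * (c * sgn ⟨ w , x ⟩ * M x y)
    ≈⟨ solve 4 (λ t c s m → t ⊗ ((c ⊗ s) ⊗ m) ⊜ c ⊗ ((s ⊗ t) ⊗ m)) ≈-refl (sgn ⟨ b , y ⟩) c (sgn ⟨ w , x ⟩) (M x y) ⟩
  c * (sgn ⟨ w , x ⟩ * sgn ⟨ b , y ⟩ * M x y)
    ≈⟨ *-congˡ (*-congʳ (sgn-xor ⟨ w , x ⟩ ⟨ b , y ⟩)) ⟨
  c * (sgn (⟨ w , x ⟩ xor ⟨ b , y ⟩) * M x y)
    ∎

-- The normaliser condition with U† moved to the other side, hence meaningful without unitarity.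
Clifford : ∀ {n} → Mat n → Set
Clifford M = ∀ v b → ∃[ u ] ∃[ w ] Intertwines M u w v b

gram : ∀ {n} → Mat n → Mat n
gram {n} M y y′ = Σ[ n ] (λ x → conj (M x y) * M x y′)

-- Summing over all rows absorbs the row shift `u`. The phase meets its conjugate, and the two signs
-- from `w` cancel because both factors have the same row; only the signs from `b` survive.
gram-shift : ∀ {n} (M : Mat n) {u w v b} → Intertwines M u w v b →
  ∀ y y′ → gram M (y ⊕ v) (y′ ⊕ v) ≈ sgn ⟨ b , y ⊕ y′ ⟩ * gram M y y′
gram-shift {n} M {u} {w} {v} {b} (intertwines {c} c∈ h) y y′ = begin
  Σ[ n ] (λ x → conj (M x (y ⊕ v)) * M x (y′ ⊕ v))
    ≈⟨ Σ-translate n u (λ x → conj (M x (y ⊕ v)) * M x (y′ ⊕ v)) ⟨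
  Σ[ n ] (λ x → conj (M (x ⊕ u) (y ⊕ v)) * M (x ⊕ u) (y′ ⊕ v))
    ≈⟨ Σ-cong n term ⟩
  Σ[ n ] (λ x → sgn ⟨ b , y ⊕ y′ ⟩ * (conj (M x y) * M x y′))
    ≈⟨ *-Σ (sgn ⟨ b , y ⊕ y′ ⟩) n (λ x → conj (M x y) * M x y′) ⟨
  sgn ⟨ b , y ⊕ y′ ⟩ * gram M y y′
    ∎
  where
  signs : ∀ x → (⟨ w , x ⟩ xor ⟨ b , y ⟩) xor (⟨ w , x ⟩ xor ⟨ b , y′ ⟩) ≡ ⟨ b , y ⊕ y′ ⟩
  signs x = trans (xor-interchange ⟨ w , x ⟩ ⟨ b , y ⟩ ⟨ w , x ⟩ ⟨ b , y′ ⟩)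
    (trans (cong (_xor (⟨ b , y ⟩ xor ⟨ b , y′ ⟩)) (xor-same ⟨ w , x ⟩)) (sym (⟨⟩-⊕ʳ b y y′)))
  term : ∀ x → conj (M (x ⊕ u) (y ⊕ v)) * M (x ⊕ u) (y′ ⊕ v) ≈ sgn ⟨ b , y ⊕ y′ ⟩ * (conj (M x y) * M x y′)
  term x = let s = ⟨ w , x ⟩ xor ⟨ b , y ⟩ ; s′ = ⟨ w , x ⟩ xor ⟨ b , y′ ⟩ in begin
    conj (M (x ⊕ u) (y ⊕ v)) * M (x ⊕ u) (y′ ⊕ v)
      ≈⟨ *-cong (conj-cong (h x y)) (h x y′) ⟩
    conj (c * (sgn s * M x y)) * (c * (sgn s′ * M x y′))
      ≈⟨ *-congʳ (≈-trans (conj-* c (sgn s * M x y))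
           (*-congˡ (≈-trans (conj-* (sgn s) (M x y)) (*-congʳ (conj-sgn s))))) ⟩
    conj c * (sgn s * conj (M x y)) * (c * (sgn s′ * M x y′))
      ≈⟨ solve 6 (λ d s m c t k → (d ⊗ (s ⊗ m)) ⊗ (c ⊗ (t ⊗ k)) ⊜ (d ⊗ c) ⊗ ((s ⊗ t) ⊗ (m ⊗ k))) ≈-refl
           (conj c) (sgn s) (conj (M x y)) c (sgn s′) (M x y′) ⟩
    conj c * c * (sgn s * sgn s′ * (conj (M x y) * M x y′))
      ≈⟨ *-cong (phase-norm c∈) (*-congʳ (≈-trans (≈-sym (sgn-xor s s′)) (reflexive (cong sgn (signs x))))) ⟩
    1ℂ * (sgn ⟨ b , y ⊕ y′ ⟩ * (conj (M x y) * M x y′))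
      ≈⟨ *-identityˡ _ ⟩
    sgn ⟨ b , y ⊕ y′ ⟩ * (conj (M x y) * M x y′)
      ∎

-- M†M commutes with the Pauli group: the Z part makes it diagonal, the X part constant on the diagonal.
gram-scalar : ∀ {n} (M : Mat n) → Clifford M → ∀ y y′ → gram M y y′ ≈ gram M 𝟎 𝟎 * 𝟙 y y′
gram-scalar {n} M M∈ y y′ = *-cancelˡ-invertible (2^-invertible n) (begin
  2^ n * gram M y y′
    -- The factor 2ⁿ is spread into one summand for each Z^b, so that each copy of the entry can
    -- acquire the sign of its own relation; the character sum then produces `𝟙`.
    ≈⟨ *-congʳ (count 𝟎) ⟨
  Σ[ n ] (λ b → sgn ⟨ b , 𝟎 ⟩) * gram M y y′
    ≈⟨ Σ-* (gram M y y′) n (λ b → sgn ⟨ b , 𝟎 ⟩) ⟩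
  Σ[ n ] (λ b → sgn ⟨ b , 𝟎 ⟩ * gram M y y′)
    ≈⟨ Σ-cong n diagonal ⟩
  Σ[ n ] (λ b → sgn ⟨ b , y ⊕ y′ ⟩ * gram M y y′)
    ≈⟨ Σ-* (gram M y y′) n (λ b → sgn ⟨ b , y ⊕ y′ ⟩) ⟨
  Σ[ n ] (λ b → sgn ⟨ b , y ⊕ y′ ⟩) * gram M y y′
    ≈⟨ *-congʳ (Σ-sgn n y y′) ⟩
  2^ n * 𝟙 y y′ * gram M y y′
    ≈⟨ *-assoc (2^ n) (𝟙 y y′) (gram M y y′) ⟩
  2^ n * (𝟙 y y′ * gram M y y′)
    ≈⟨ *-congˡ (𝟙-*-cong y y′ constant) ⟩
  2^ n * (𝟙 y y′ * gram M 𝟎 𝟎)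
    ≈⟨ *-congˡ (*-comm (𝟙 y y′) (gram M 𝟎 𝟎)) ⟩
  2^ n * (gram M 𝟎 𝟎 * 𝟙 y y′)
    ∎)
  where
  count : ∀ (x : Bits n) → Σ[ n ] (λ b → sgn ⟨ b , 𝟎 ⟩) ≈ 2^ n
  count x = begin
    Σ[ n ] (λ b → sgn ⟨ b , 𝟎 ⟩)        ≡⟨ cong (λ t → Σ[ n ] (λ b → sgn ⟨ b , t ⟩)) (⊕-same x) ⟨
    Σ[ n ] (λ b → sgn ⟨ b , x ⊕ x ⟩)    ≈⟨ Σ-sgn n x x ⟩
    2^ n * 𝟙 x x                      ≈⟨ ≈-trans (*-congˡ (𝟙-refl x)) (*-identityʳ (2^ n)) ⟩
    2^ n                              ∎
  shift : ∀ v b y y′ → gram M (y ⊕ v) (y′ ⊕ v) ≈ sgn ⟨ b , y ⊕ y′ ⟩ * gram M y y′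
  shift v b = let u , w , M∼ = M∈ v b in gram-shift M M∼
  diagonal : ∀ b → sgn ⟨ b , 𝟎 ⟩ * gram M y y′ ≈ sgn ⟨ b , y ⊕ y′ ⟩ * gram M y y′
  diagonal b = begin
    sgn ⟨ b , 𝟎 ⟩ * gram M y y′         ≡⟨ cong (λ t → sgn t * gram M y y′) (⟨⟩-𝟎ʳ b) ⟩
    1ℂ * gram M y y′                    ≈⟨ *-identityˡ _ ⟩
    gram M y y′                         ≡⟨ cong₂ (gram M) (⊕-identityʳ y) (⊕-identityʳ y′) ⟨
    gram M (y ⊕ 𝟎) (y′ ⊕ 𝟎)             ≈⟨ shift 𝟎 b y y′ ⟩
    sgn ⟨ b , y ⊕ y′ ⟩ * gram M y y′    ∎
  constant : y ≡ y′ → gram M y y′ ≈ gram M 𝟎 𝟎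
  constant refl = begin
    gram M y y                             ≡⟨ cong₂ (gram M) (⊕-identityˡ y) (⊕-identityˡ y) ⟨
    gram M (𝟎 ⊕ y) (𝟎 ⊕ y)                 ≈⟨ shift y 𝟎 𝟎 𝟎 ⟩
    sgn ⟨ 𝟎 {n} , 𝟎 ⊕ 𝟎 ⟩ * gram M 𝟎 𝟎         ≡⟨ cong (λ t → sgn t * gram M 𝟎 𝟎) (⟨⟩-𝟎ˡ {n} (𝟎 ⊕ 𝟎)) ⟩
    1ℂ * gram M 𝟎 𝟎                        ≈⟨ *-identityˡ _ ⟩
    gram M 𝟎 𝟎                             ∎

-- The Pauli group as phases times X^u Z^w

XZ : ∀ {n} → Bits n → Bits n → Mat n
XZ u w x y = 𝟙 x (y ⊕ u) * sgn ⟨ w , y ⟩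

xz-pauli : Bool → Bool → Pauli
xz-pauli false false = I
xz-pauli true  false = X
xz-pauli true  true  = Y
xz-pauli false true  = Z

pauli-x pauli-z : Pauli → Bool
pauli-x I = false
pauli-x X = true
pauli-x Y = true
pauli-x Z = false
pauli-z I = false
pauli-z X = false
pauli-z Y = true
pauli-z Z = true

-- The only correction is for Y = i X Z.
pauli-phase : Pauli → ℂ
pauli-phase I = 1ℂ
pauli-phase X = 1ℂ
pauli-phase Y = i
pauli-phase Z = 1ℂ

phase-pauli : ∀ σ → Phase (pauli-phase σ)
phase-pauli I = phase-1
phase-pauli X = phase-1
phase-pauli Y = phase-i
phase-pauli Z = phase-1

opaque
  ⨂ : ∀ {n} → Vec Pauli n → Mat n
  ⨂ = D.⨂

opaque
  unfolding _+_

  •-elim : ∀ {n} c {M N : Mat n} → M ≋ c • N → ∀ x y → M x y ≈ c * N x y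
  •-elim c M≋cN = M≋cN

  •-intro : ∀ {n} c {M N : Mat n} → (∀ x y → M x y ≈ c * N x y) → M ≋ c • N
  •-intro c M≈cN = M≈cN

  ⟦Y⟧₀₁ : ⟦ Y ⟧ false true ≡ - i
  ⟦Y⟧₀₁ = refl

  ⟦Z⟧₁₁ : ⟦ Z ⟧ true true ≡ - 1ℂ
  ⟦Z⟧₁₁ = refl

private
  opaque
    unfolding _+_

    ⨂-∷-defs : ∀ {n} σ (σs : Vec Pauli n) a b x y →
      D.⨂ (σ ∷ σs) (a ∷ x) (b ∷ y) ≡ ⟦ σ ⟧ a b * D.⨂ σs x y
    ⨂-∷-defs σ σs a b x y = refl

opaque
  unfolding ⨂

  ⨂-[] : ⨂ [] [] [] ≡ 1ℂ
  ⨂-[] = refl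

  ⨂-∷ : ∀ {n} σ (σs : Vec Pauli n) a b x y → ⨂ (σ ∷ σs) (a ∷ x) (b ∷ y) ≡ ⟦ σ ⟧ a b * ⨂ σs x y
  ⨂-∷ = ⨂-∷-defs

⟦⟧-xz : ∀ σ a b → ⟦ σ ⟧ a b ≈ pauli-phase σ * (δ₂ a (b xor pauli-x σ) * sgn (pauli-z σ ∧ b))
⟦⟧-xz σ a b = ≈-sym (entry σ a b)
  where
  one : 1ℂ * (1ℂ * 1ℂ) ≈ 1ℂ
  one = ≈-trans (*-identityˡ _) (*-identityˡ _)
  nil : ∀ z w → z * (0ℂ * w) ≈ 0ℂ
  nil z w = ≈-trans (*-congˡ (zeroˡ w)) (zeroʳ z)
  entry : ∀ σ a b → pauli-phase σ * (δ₂ a (b xor pauli-x σ) * sgn (pauli-z σ ∧ b)) ≈ ⟦ σ ⟧ a b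
  entry I false false = one
  entry I false true  = nil _ _
  entry I true  false = nil _ _
  entry I true  true  = one
  entry X false false = nil _ _
  entry X false true  = one
  entry X true  false = one
  entry X true  true  = nil _ _
  entry Y false false = nil _ _
  entry Y false true  = begin
    i * (1ℂ * - 1ℂ)       ≈⟨ *-congˡ (*-identityˡ (- 1ℂ)) ⟩
    i * - 1ℂ              ≈⟨ *-comm i (- 1ℂ) ⟩
    - 1ℂ * i              ≈⟨ -1*x≈-x i ⟩
    - i                   ≡⟨ ⟦Y⟧₀₁ ⟨
    ⟦ Y ⟧ false true      ∎
  entry Y true  false = ≈-trans (*-congˡ (*-identityˡ 1ℂ)) (*-identityʳ i)
  entry Y true  true  = nil _ _
  entry Z false false = one
  entry Z false true  = nil _ _
  entry Z true  false = nil _ _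
  entry Z true  true  = ≈-trans (*-identityˡ _) (≈-trans (*-identityˡ _) (reflexive (sym ⟦Z⟧₁₁)))

⨂-xz : ∀ {n} (σs : Vec Pauli n) → ∃[ c ] (Phase c ×
  ∀ x y → ⨂ σs x y ≈ c * XZ (map pauli-x σs) (map pauli-z σs) x y)
⨂-xz []       = 1ℂ , phase-1 , λ { [] [] →
  ≈-trans (reflexive ⨂-[]) (≈-sym (≈-trans (*-identityˡ _) (≈-trans (*-identityʳ _) (𝟙-refl [])))) }
⨂-xz (σ ∷ σs) = let c , c∈ , h = ⨂-xz σs in
  pauli-phase σ * c , phase-* (phase-pauli σ) c∈ , λ { (a ∷ x) (b ∷ y) →
    let u = map pauli-x σs ; w = map pauli-z σs
        d = δ₂ a (b xor pauli-x σ) ; s = pauli-z σ ∧ b in begin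
    ⨂ (σ ∷ σs) (a ∷ x) (b ∷ y)
      ≡⟨ ⨂-∷ σ σs a b x y ⟩
    ⟦ σ ⟧ a b * ⨂ σs x y
      ≈⟨ *-cong (⟦⟧-xz σ a b) (h x y) ⟩
    pauli-phase σ * (d * sgn s) * (c * (𝟙 x (y ⊕ u) * sgn ⟨ w , y ⟩))
      ≈⟨ solve 6 (λ p d s c e t → (p ⊗ (d ⊗ s)) ⊗ (c ⊗ (e ⊗ t)) ⊜ (p ⊗ c) ⊗ ((d ⊗ e) ⊗ (s ⊗ t))) ≈-refl
           (pauli-phase σ) d (sgn s) c (𝟙 x (y ⊕ u)) (sgn ⟨ w , y ⟩) ⟩
    pauli-phase σ * c * (d * 𝟙 x (y ⊕ u) * (sgn s * sgn ⟨ w , y ⟩))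
      ≈⟨ *-congˡ (*-cong (reflexive (𝟙-∷ a (b xor pauli-x σ) x (y ⊕ u))) (sgn-xor s ⟨ w , y ⟩)) ⟨
    pauli-phase σ * c * XZ (pauli-x σ ∷ u) (pauli-z σ ∷ w) (a ∷ x) (b ∷ y)
      ∎ }

-- The converse of `⨂-xz`: the scalar there has modulus one, so its conjugate is its inverse and
-- again a phase.
xz-⨂ : ∀ {n} (u w : Bits n) → ∃[ c ] (Phase c ×
  ∀ x y → XZ u w x y ≈ c * ⨂ (zipWith xz-pauli u w) x y)
xz-⨂ {n} u w = let c , c∈ , h = ⨂-xz (zipWith xz-pauli u w) in
  conj c , phase-conj c∈ , λ x y → begin
  XZ u w x y
    ≈⟨ *-identityˡ _ ⟨
  1ℂ * XZ u w x y
    ≈⟨ *-cong (phase-norm c∈) (reflexive (cong₂ (λ s t → XZ s t x y) (xs u w) (zs u w))) ⟨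
  conj c * c * XZ (map pauli-x (zipWith xz-pauli u w)) (map pauli-z (zipWith xz-pauli u w)) x y
    ≈⟨ *-assoc (conj c) c _ ⟩
  conj c * (c * XZ (map pauli-x (zipWith xz-pauli u w)) (map pauli-z (zipWith xz-pauli u w)) x y)
    ≈⟨ *-congˡ (h x y) ⟨
  conj c * ⨂ (zipWith xz-pauli u w) x y
    ∎
  where
  x-of : ∀ a b → pauli-x (xz-pauli a b) ≡ a
  x-of false false = refl
  x-of false true  = refl
  x-of true  false = refl
  x-of true  true  = refl
  z-of : ∀ a b → pauli-z (xz-pauli a b) ≡ b
  z-of false false = refl
  z-of false true  = refl
  z-of true  false = refl
  z-of true  true  = refl
  xs : ∀ {m} (u w : Bits m) → map pauli-x (zipWith xz-pauli u w) ≡ u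
  xs []      []      = refl
  xs (a ∷ u) (b ∷ w) = cong₂ _∷_ (x-of a b) (xs u w)
  zs : ∀ {m} (u w : Bits m) → map pauli-z (zipWith xz-pauli u w) ≡ w
  zs []      []      = refl
  zs (a ∷ u) (b ∷ w) = cong₂ _∷_ (z-of a b) (zs u w)

opaque
  unfolding i^_ ⨂

  𝒫-elim : ∀ {n} {M : Mat n} → 𝒫 n M → ∃[ c ] ∃[ σs ] (Phase c × ∀ x y → M x y ≈ c * ⨂ σs x y)
  𝒫-elim {M = M} (k , σs , M≋) = i^ k , σs , (k , ≈-refl) , •-elim (D.i^ k) {M} {D.⨂ σs} M≋

  𝒫-intro : ∀ {n} {M : Mat n} k σs → (∀ x y → M x y ≈ i^ k * ⨂ σs x y) → 𝒫 n M
  𝒫-intro {M = M} k σs M≋ = k , σs , •-intro (D.i^ k) {M} {D.⨂ σs} M≋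

pauli⇒xz : ∀ {n} {M : Mat n} → 𝒫 n M → ∃[ u ] ∃[ w ] ∃[ c ] (Phase c × ∀ x y → M x y ≈ c * XZ u w x y)
pauli⇒xz M∈ =
  let c , σs , c∈ , M≋ = 𝒫-elim M∈ ; d , d∈ , h = ⨂-xz σs in
  map pauli-x σs , map pauli-z σs , c * d , phase-* c∈ d∈ , λ x y →
    ≈-trans (M≋ x y) (≈-trans (*-congˡ (h x y)) (≈-sym (*-assoc c d _)))

xz⇒pauli : ∀ {n} {M : Mat n} u w {c} → Phase c → (∀ x y → M x y ≈ c * XZ u w x y) → 𝒫 n M
xz⇒pauli u w {c} c∈ M≋ =
  let d , d∈ , h = xz-⨂ u w ; k , cd≈ = phase-* c∈ d∈ in
  𝒫-intro k (zipWith xz-pauli u w) λ x y → begin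
    _                                            ≈⟨ M≋ x y ⟩
    c * XZ u w x y                               ≈⟨ *-congˡ (h x y) ⟩
    c * (d * ⨂ (zipWith xz-pauli u w) x y)       ≈⟨ *-assoc c d _ ⟨
    c * d * ⨂ (zipWith xz-pauli u w) x y         ≈⟨ *-congʳ cd≈ ⟩
    i^ k * ⨂ (zipWith xz-pauli u w) x y          ∎

-- Unitaries, conjugation and the normaliser

private
  opaque
    unfolding _+_

    ⊡-entry-defs : ∀ {n} (M N : Mat n) x y → (M ⊡ N) x y ≡ D.Σ[ n ] (λ z → M x z * N z y)
    ⊡-entry-defs M N x y = refl

opaque
  unfolding _+_

  †-entry : ∀ {n} (M : Mat n) x y → (M †) x y ≡ conj (M y x)
  †-entry M x y = refl

  •-entry : ∀ {n} c (M : Mat n) x y → (c • M) x y ≡ c * M x y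
  •-entry c M x y = refl

opaque
  unfolding Σ[_] 𝟙

  ⊡-entry : ∀ {n} (M N : Mat n) x y → (M ⊡ N) x y ≡ Σ[ n ] (λ z → M x z * N z y)
  ⊡-entry = ⊡-entry-defs

  𝟙-entry : ∀ {n} (x y : Bits n) → D.𝟙 x y ≡ 𝟙 x y
  𝟙-entry x y = refl

inverse-entry : ∀ {n} (M N : Mat n) → M ⊡ N ≋ D.𝟙 → ∀ x y → Σ[ n ] (λ z → M x z * N z y) ≈ 𝟙 x y
inverse-entry M N MN≋𝟙 x y =
  ≈-trans (reflexive (sym (⊡-entry M N x y))) (≈-trans (MN≋𝟙 x y) (reflexive (𝟙-entry x y)))

entry-inverse : ∀ {n} (M N : Mat n) → (∀ x y → Σ[ n ] (λ z → M x z * N z y) ≈ 𝟙 x y) → M ⊡ N ≋ D.𝟙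
entry-inverse M N MN≈𝟙 x y =
  ≈-trans (reflexive (⊡-entry M N x y)) (≈-trans (MN≈𝟙 x y) (reflexive (sym (𝟙-entry x y))))

record Orthonormal {n} (U : Mat n) : Set where
  field
    rows    : ∀ x y → Σ[ n ] (λ z → U x z * conj (U y z)) ≈ 𝟙 x y
    columns : ∀ x y → gram U x y ≈ 𝟙 x y

open Orthonormal

unitary⇒orthonormal : ∀ {n} (U : Mat n) → Unitary n U → Orthonormal U
unitary⇒orthonormal {n} U (UU†≋𝟙 , U†U≋𝟙) = record
  { rows    = λ x y → ≈-trans
      (Σ-cong n λ z → *-congˡ (reflexive (sym (†-entry U z y)))) (inverse-entry U (U †) UU†≋𝟙 x y)
  ; columns = λ x y → ≈-trans
      (Σ-cong n λ z → *-congʳ (reflexive (sym (†-entry U x z)))) (inverse-entry (U †) U U†U≋𝟙 x y)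
  }

orthonormal⇒unitary : ∀ {n} (U : Mat n) → Orthonormal U → Unitary n U
orthonormal⇒unitary {n} U U∈ =
    entry-inverse U (U †) (λ x y → ≈-trans
      (Σ-cong n λ z → *-congˡ (reflexive (†-entry U z y))) (rows U∈ x y))
  , entry-inverse (U †) U (λ x y → ≈-trans
      (Σ-cong n λ z → *-congʳ (reflexive (†-entry U x z))) (columns U∈ x y))

⊡-xz : ∀ {n} (U σ : Mat n) {d} v b → (∀ x y → σ x y ≈ d * XZ v b x y) →
  ∀ x z → (U ⊡ σ) x z ≈ d * (U x (z ⊕ v) * sgn ⟨ b , z ⟩)
⊡-xz {n} U σ {d} v b σ≈ x z = begin
  (U ⊡ σ) x z
    ≡⟨ ⊡-entry U σ x z ⟩
  Σ[ n ] (λ t → U x t * σ t z)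
    ≈⟨ Σ-cong n (λ t → begin
       U x t * σ t z
         ≈⟨ *-congˡ (≈-trans (σ≈ t z) (*-congˡ (*-congʳ (𝟙-sym t (z ⊕ v))))) ⟩
       U x t * (d * (𝟙 (z ⊕ v) t * sgn ⟨ b , z ⟩))
         ≈⟨ solve 4 (λ m d e s → m ⊗ (d ⊗ (e ⊗ s)) ⊜ e ⊗ (d ⊗ (m ⊗ s))) ≈-refl
              (U x t) d (𝟙 (z ⊕ v) t) (sgn ⟨ b , z ⟩) ⟩
       𝟙 (z ⊕ v) t * (d * (U x t * sgn ⟨ b , z ⟩))
         ∎) ⟩
  Σ[ n ] (λ t → 𝟙 (z ⊕ v) t * (d * (U x t * sgn ⟨ b , z ⟩)))
    ≈⟨ Σ-𝟙 n (z ⊕ v) (λ t → d * (U x t * sgn ⟨ b , z ⟩)) ⟩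
  d * (U x (z ⊕ v) * sgn ⟨ b , z ⟩)
    ∎

conjugate-xz : ∀ {n} (U σ : Mat n) {d} v b → (∀ x y → σ x y ≈ d * XZ v b x y) →
  ∀ x y → (U ⊡ σ ⊡ U †) x y ≈ d * Σ[ n ] (λ z → U x (z ⊕ v) * sgn ⟨ b , z ⟩ * conj (U y z))
conjugate-xz {n} U σ {d} v b σ≈ x y = begin
  (U ⊡ σ ⊡ U †) x y
    ≡⟨ ⊡-entry (U ⊡ σ) (U †) x y ⟩
  Σ[ n ] (λ z → (U ⊡ σ) x z * (U †) z y)
    ≈⟨ Σ-cong n (λ z → ≈-trans (*-cong (⊡-xz U σ v b σ≈ x z) (reflexive (†-entry U z y)))
         (*-assoc d (U x (z ⊕ v) * sgn ⟨ b , z ⟩) (conj (U y z)))) ⟩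
  Σ[ n ] (λ z → d * (U x (z ⊕ v) * sgn ⟨ b , z ⟩ * conj (U y z)))
    ≈⟨ *-Σ d n (λ z → U x (z ⊕ v) * sgn ⟨ b , z ⟩ * conj (U y z)) ⟨
  d * Σ[ n ] (λ z → U x (z ⊕ v) * sgn ⟨ b , z ⟩ * conj (U y z))
    ∎

-- The equation `U X^v Z^b U† = c X^u Z^w` is multiplied by `U` on the right. In entries this
-- inserts U†U = 1 as a double sum and exchanges the order of summation.
normalizer⇒clifford : ∀ {n} (U : Mat n) → PauliNormalizer n U → Clifford U
normalizer⇒clifford {n} U (U-unitary , normal) v b =
  let u , w , c , c∈ , conjugate≈ = pauli⇒xz (normal (XZ v b) (xz⇒pauli v b phase-1 λ x y → ≈-sym (*-identityˡ _)))
  in u , w , intertwines c∈ (intertwines-from-moved U {u} {w} {v} {b} (moved u w c λ x y → begin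
    Σ[ n ] (λ z → F x z * conj (U y z))          ≈⟨ *-identityˡ _ ⟨
    1ℂ * Σ[ n ] (λ z → F x z * conj (U y z))     ≈⟨ conjugate-xz U (XZ v b) v b (λ _ _ → ≈-sym (*-identityˡ _)) x y ⟨
    (U ⊡ XZ v b ⊡ U †) x y                       ≈⟨ conjugate≈ x y ⟩
    c * XZ u w x y                               ∎))
  where
  F : Mat n
  F x z = U x (z ⊕ v) * sgn ⟨ b , z ⟩
  moved : ∀ u w c → (∀ x y → Σ[ n ] (λ z → F x z * conj (U y z)) ≈ c * XZ u w x y) →
    ∀ x y → F x y ≈ c * sgn ⟨ w , x ⊕ u ⟩ * U (x ⊕ u) y
  moved u w c conjugate≈ x y = begin
    F x y
      ≈⟨ Σ-𝟙 n y (F x) ⟨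
    Σ[ n ] (λ z → 𝟙 y z * F x z)
      ≈⟨ Σ-cong n (λ z → ≈-trans
           (*-congʳ (≈-trans (𝟙-sym y z) (≈-sym (columns (unitary⇒orthonormal U U-unitary) z y))))
           (Σ-* (F x z) n (λ t → conj (U t z) * U t y))) ⟩
    Σ[ n ] (λ z → Σ[ n ] (λ t → conj (U t z) * U t y * F x z))
      ≈⟨ Σ-swap n n (λ z t → conj (U t z) * U t y * F x z) ⟩
    Σ[ n ] (λ t → Σ[ n ] (λ z → conj (U t z) * U t y * F x z))
      ≈⟨ Σ-cong n (λ t → begin
         Σ[ n ] (λ z → conj (U t z) * U t y * F x z)
           ≈⟨ Σ-cong n (λ z → solve 3 (λ a b c → (a ⊗ b) ⊗ c ⊜ (c ⊗ a) ⊗ b) ≈-refl (conj (U t z)) (U t y) (F x z)) ⟩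
         Σ[ n ] (λ z → F x z * conj (U t z) * U t y)
           ≈⟨ Σ-* (U t y) n (λ z → F x z * conj (U t z)) ⟨
         Σ[ n ] (λ z → F x z * conj (U t z)) * U t y
           ≈⟨ *-congʳ (≈-trans (conjugate≈ x t) (*-congˡ (*-congʳ (≈-sym (𝟙-⊕ x u t))))) ⟩
         c * (𝟙 (x ⊕ u) t * sgn ⟨ w , t ⟩) * U t y
           ≈⟨ solve 4 (λ c e s m → (c ⊗ (e ⊗ s)) ⊗ m ⊜ e ⊗ ((c ⊗ s) ⊗ m)) ≈-refl
                c (𝟙 (x ⊕ u) t) (sgn ⟨ w , t ⟩) (U t y) ⟩
         𝟙 (x ⊕ u) t * (c * sgn ⟨ w , t ⟩ * U t y)
           ∎) ⟩
    Σ[ n ] (λ t → 𝟙 (x ⊕ u) t * (c * sgn ⟨ w , t ⟩ * U t y))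
      ≈⟨ Σ-𝟙 n (x ⊕ u) (λ t → c * sgn ⟨ w , t ⟩ * U t y) ⟩
    c * sgn ⟨ w , x ⊕ u ⟩ * U (x ⊕ u) y
      ∎

-- The left side is the (x, y) entry of U X^v Z^b U†.
intertwines-conjugate : ∀ {n} (U : Mat n) → Orthonormal U → ∀ {u w v b c} →
  (∀ x y → U (x ⊕ u) (y ⊕ v) ≈ c * (sgn (⟨ w , x ⟩ xor ⟨ b , y ⟩) * U x y)) →
  ∀ x y → Σ[ n ] (λ z → U x (z ⊕ v) * sgn ⟨ b , z ⟩ * conj (U y z)) ≈ c * sgn ⟨ w , x ⊕ u ⟩ * 𝟙 (x ⊕ u) y
intertwines-conjugate {n} U U∈ {u} {w} {v} {b} {c} relation x y = begin
  Σ[ n ] (λ z → U x (z ⊕ v) * sgn ⟨ b , z ⟩ * conj (U y z))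
    ≈⟨ Σ-cong n (λ z → ≈-trans (*-congʳ (intertwines-moved U {u} {w} {v} {b} relation x z))
         (*-assoc (c * sgn ⟨ w , x ⊕ u ⟩) (U (x ⊕ u) z) (conj (U y z)))) ⟩
  Σ[ n ] (λ z → c * sgn ⟨ w , x ⊕ u ⟩ * (U (x ⊕ u) z * conj (U y z)))
    ≈⟨ *-Σ (c * sgn ⟨ w , x ⊕ u ⟩) n (λ z → U (x ⊕ u) z * conj (U y z)) ⟨
  c * sgn ⟨ w , x ⊕ u ⟩ * Σ[ n ] (λ z → U (x ⊕ u) z * conj (U y z))
    ≈⟨ *-congˡ (rows U∈ (x ⊕ u) y) ⟩
  c * sgn ⟨ w , x ⊕ u ⟩ * 𝟙 (x ⊕ u) y
    ∎

clifford⇒normalizer : ∀ {n} (U : Mat n) → Unitary n U → Clifford U → PauliNormalizer n U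
clifford⇒normalizer {n} U U-unitary U∈ = U-unitary , λ σ σ∈ →
  let v , b , d , d∈ , σ≈ = pauli⇒xz σ∈
      u , w , intertwines {c} c∈ relation = U∈ v b
  in xz⇒pauli u w (phase-* d∈ c∈) λ x y → begin
    (U ⊡ σ ⊡ U †) x y
      ≈⟨ conjugate-xz U σ v b σ≈ x y ⟩
    d * Σ[ n ] (λ z → U x (z ⊕ v) * sgn ⟨ b , z ⟩ * conj (U y z))
      ≈⟨ *-congˡ (intertwines-conjugate U (unitary⇒orthonormal U U-unitary) {u} {w} {v} {b} relation x y) ⟩
    d * (c * sgn ⟨ w , x ⊕ u ⟩ * 𝟙 (x ⊕ u) y)
      ≈⟨ solve 4 (λ d c s e → d ⊗ ((c ⊗ s) ⊗ e) ⊜ (d ⊗ c) ⊗ (e ⊗ s)) ≈-refl d c (sgn ⟨ w , x ⊕ u ⟩) (𝟙 (x ⊕ u) y) ⟩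
    d * c * (𝟙 (x ⊕ u) y * sgn ⟨ w , x ⊕ u ⟩)
      -- Where the indicator does not vanish, `x ⊕ u` is `y`, so the sign may be read at the column
      -- index, as `XZ` does.
      ≈⟨ *-congˡ (𝟙-*-cong (x ⊕ u) y λ x⊕u≡y → reflexive (cong (λ t → sgn ⟨ w , t ⟩) x⊕u≡y)) ⟩
    d * c * (𝟙 (x ⊕ u) y * sgn ⟨ w , y ⟩)
      ≈⟨ *-congˡ (*-congʳ (𝟙-⊕ x u y)) ⟩
    d * c * XZ u w x y
      ∎

-- The Gram matrix directly yields only orthonormal columns. For the rows, M†M = h and M N = 1 force
-- M† = h N, which is `adjoint`; then the row products reduce to M N.
scale-unitary : ∀ {n} (M N : Mat n) → M ⊡ N ≋ D.𝟙 → ∀ {h e} → (∀ x y → gram M x y ≈ h * 𝟙 x y) →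
  conj e * e * h ≈ 1ℂ → Unitary n (e • M)
scale-unitary {n} M N MN≋𝟙 {h} {e} gram≈ eeh≈1 = orthonormal⇒unitary (e • M) record
  { rows = λ x y → begin
      Σ[ n ] (λ z → (e • M) x z * conj ((e • M) y z))
        ≈⟨ Σ-cong n (λ z → begin
           (e • M) x z * conj ((e • M) y z)
             ≡⟨ cong₂ (λ s t → s * conj t) (•-entry e M x z) (•-entry e M y z) ⟩
           e * M x z * conj (e * M y z)
             ≈⟨ *-congˡ (≈-trans (conj-* e (M y z)) (*-congˡ (adjoint y z))) ⟩
           e * M x z * (conj e * (h * N z y))
             ≈⟨ solve 5 (λ e m d h k → (e ⊗ m) ⊗ (d ⊗ (h ⊗ k)) ⊜ ((d ⊗ e) ⊗ h) ⊗ (m ⊗ k)) ≈-refl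
                  e (M x z) (conj e) h (N z y) ⟩
           conj e * e * h * (M x z * N z y)
             ≈⟨ unit _ ⟩
           M x z * N z y
             ∎) ⟩
      Σ[ n ] (λ z → M x z * N z y)
        ≈⟨ inverse-entry M N MN≋𝟙 x y ⟩
      𝟙 x y
        ∎
  ; columns = λ x y → begin
      Σ[ n ] (λ z → conj ((e • M) z x) * (e • M) z y)
        ≈⟨ Σ-cong n (λ z → begin
           conj ((e • M) z x) * (e • M) z y
             ≡⟨ cong₂ (λ s t → conj s * t) (•-entry e M z x) (•-entry e M z y) ⟩
           conj (e * M z x) * (e * M z y)
             ≈⟨ ≈-trans (*-congʳ (conj-* e (M z x))) (*-interchange (conj e) (conj (M z x)) e (M z y)) ⟩
           conj e * e * (conj (M z x) * M z y)
             ∎) ⟩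
      Σ[ n ] (λ z → conj e * e * (conj (M z x) * M z y))
        ≈⟨ *-Σ (conj e * e) n (λ z → conj (M z x) * M z y) ⟨
      conj e * e * gram M x y
        ≈⟨ *-congˡ (gram≈ x y) ⟩
      conj e * e * (h * 𝟙 x y)
        ≈⟨ *-assoc (conj e * e) h (𝟙 x y) ⟨
      conj e * e * h * 𝟙 x y
        ≈⟨ unit _ ⟩
      𝟙 x y
        ∎
  }
  where
  unit : ∀ z → conj e * e * h * z ≈ z
  unit z = ≈-trans (*-congʳ eeh≈1) (*-identityˡ z)
  adjoint : ∀ y z → conj (M y z) ≈ h * N z y
  adjoint y z = begin
    conj (M y z)
      ≈⟨ Σ-𝟙 n y (λ t → conj (M t z)) ⟨
    Σ[ n ] (λ t → 𝟙 y t * conj (M t z))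
      ≈⟨ Σ-cong n (λ t → ≈-trans
           (*-congʳ (≈-trans (𝟙-sym y t) (≈-sym (inverse-entry M N MN≋𝟙 t y))))
           (Σ-* (conj (M t z)) n (λ s → M t s * N s y))) ⟩
    Σ[ n ] (λ t → Σ[ n ] (λ s → M t s * N s y * conj (M t z)))
      ≈⟨ Σ-swap n n (λ t s → M t s * N s y * conj (M t z)) ⟩
    Σ[ n ] (λ s → Σ[ n ] (λ t → M t s * N s y * conj (M t z)))
      ≈⟨ Σ-cong n (λ s → begin
         Σ[ n ] (λ t → M t s * N s y * conj (M t z))
           ≈⟨ Σ-cong n (λ t → solve 3 (λ a b c → (a ⊗ b) ⊗ c ⊜ (c ⊗ a) ⊗ b) ≈-refl (M t s) (N s y) (conj (M t z))) ⟩
         Σ[ n ] (λ t → conj (M t z) * M t s * N s y)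
           ≈⟨ Σ-* (N s y) n (λ t → conj (M t z) * M t s) ⟨
         gram M z s * N s y
           ≈⟨ *-congʳ (gram≈ z s) ⟩
         h * 𝟙 z s * N s y
           ≈⟨ solve 3 (λ h e m → (h ⊗ e) ⊗ m ⊜ e ⊗ (h ⊗ m)) ≈-refl h (𝟙 z s) (N s y) ⟩
         𝟙 z s * (h * N s y)
           ∎) ⟩
    Σ[ n ] (λ s → 𝟙 z s * (h * N s y))
      ≈⟨ Σ-𝟙 n z (λ s → h * N s y) ⟩
    h * N z y
      ∎

-- Affine matrices normalise the Pauli group

allBits : ∀ n → List (Bits n)
allBits zero    = [] ∷ []
allBits (suc n) = List.map (false ∷_) (allBits n) List.++ List.map (true ∷_) (allBits n)

∈-allBits : ∀ {n} (x : Bits n) → x ∈ allBits n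
∈-allBits []          = here refl
∈-allBits (false ∷ x) = ∈-++⁺ˡ (∈-map⁺ (false ∷_) (∈-allBits x))
∈-allBits (true ∷ x)  = ∈-++⁺ʳ (List.map (false ∷_) (allBits _)) (∈-map⁺ (true ∷_) (∈-allBits x))

Orthogonal : ∀ {n} → List (Bits n) → Bits n → Set
Orthogonal A u = All (λ r → ⟨ r , u ⟩ ≡ false) A

orthogonal-⊕ : ∀ {n} {A : List (Bits n)} {u v} → Orthogonal A u → Orthogonal A v → Orthogonal A (u ⊕ v)
orthogonal-⊕ {u = u} {v} A⊥u A⊥v = All.zipWith
  (λ {r} (r⊥u , r⊥v) → trans (⟨⟩-⊕ʳ r u v) (cong₂ _xor_ r⊥u r⊥v)) (A⊥u , A⊥v)

private
  nonzero-pairing : ∀ {n} (b : Bits n) → b ≡ 𝟎 ⊎ ∃[ u ] ⟨ b , u ⟩ ≡ true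
  nonzero-pairing []          = inj₁ refl
  nonzero-pairing (true ∷ b)  = inj₂ (true ∷ 𝟎 , cong not (⟨⟩-𝟎ʳ b))
  nonzero-pairing (false ∷ b) with nonzero-pairing b
  ... | inj₁ refl       = inj₁ refl
  ... | inj₂ (u , b·u)  = inj₂ (false ∷ u , b·u)

-- The Fredholm alternative over 𝔽₂; P stands for the span of A.
span-or-separate : ∀ {n} {P : Bits n → Set} → P 𝟎 → (∀ {a b} → P a → P b → P (a ⊕ b)) →
  ∀ A → All P A → ∀ b → P b ⊎ ∃[ u ] (Orthogonal A u × ⟨ b , u ⟩ ≡ true)
span-or-separate P0 P⊕ [] [] b with nonzero-pairing b
... | inj₁ refl      = inj₁ P0
... | inj₂ (u , b·u) = inj₂ (u , [] , b·u)
span-or-separate {P = P} P0 P⊕ (r ∷ A) (Pr ∷ PA) b with span-or-separate {P = P} P0 P⊕ A PA b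
... | inj₁ Pb                = inj₁ Pb
... | inj₂ (u , A⊥u , b·u) with ⟨ r , u ⟩ in r·u
... | false = inj₂ (u , r·u ∷ A⊥u , b·u)
-- Here `u` is orthogonal to `A` but not to `r`. If `b ⊕ r` lies in the span, so does `b`; otherwise
-- a second separating vector is available to repair `u`.
... | true with span-or-separate {P = P} P0 P⊕ A PA (b ⊕ r)
... | inj₁ Pb⊕r = inj₁ (subst P (⊕-cancelʳ b r) (P⊕ Pb⊕r Pr))
... | inj₂ (u′ , A⊥u′ , br·u′) with ⟨ r , u′ ⟩ in r·u′
... | false = inj₂ (u′ , r·u′ ∷ A⊥u′ , trans (sym (xor-identityʳ ⟨ b , u′ ⟩))
        (trans (cong (⟨ b , u′ ⟩ xor_) (sym r·u′)) (trans (sym (⟨⟩-⊕ˡ b r u′)) br·u′)))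
-- Both vectors pair to 1 with `r`, so their sum is orthogonal to it. As `u′` pairs to 1 with `r`
-- and with `b ⊕ r`, it pairs to 0 with `b`, and the sum still separates `b`.
... | true = inj₂ (u ⊕ u′ , trans (⟨⟩-⊕ʳ r u u′) (cong₂ _xor_ r·u r·u′) ∷ orthogonal-⊕ A⊥u A⊥u′ ,
        trans (⟨⟩-⊕ʳ b u u′) (cong₂ _xor_ b·u b·u′))
  where
  b·u′ : ⟨ b , u′ ⟩ ≡ false
  b·u′ = xor-true (trans (cong (⟨ b , u′ ⟩ xor_) (sym r·u′)) (trans (sym (⟨⟩-⊕ˡ b r u′)) br·u′))
    where
    xor-true : ∀ {a} → a xor true ≡ true → a ≡ false
    xor-true {false} _ = refl

-- Supports and exponents of affine functions under translation

indicator : Bool → ℂ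
indicator b = if b then 1ℂ else 0ℂ

vanishes : ∀ {k} → List (Bits k) → Bits k → Bool
vanishes A z = all (λ row → not ⟨ row , z ⟩) A

vanishes⇒orthogonal : ∀ {k} (A : List (Bits k)) {z} → vanishes A z ≡ true → Orthogonal A z
vanishes⇒orthogonal []      _ = []
vanishes⇒orthogonal (r ∷ A) {z} eq with ⟨ r , z ⟩ in r·z
... | false = r·z ∷ vanishes⇒orthogonal A eq

orthogonal⇒vanishes : ∀ {k} {A : List (Bits k)} {z} → Orthogonal A z → vanishes A z ≡ true
orthogonal⇒vanishes []            = refl
orthogonal⇒vanishes (r⊥z ∷ A⊥z) = cong₂ _∧_ (cong not r⊥z) (orthogonal⇒vanishes A⊥z)

vanishes-⊕ : ∀ {k} {A : List (Bits k)} {w} z → Orthogonal A w → vanishes A (z ⊕ w) ≡ vanishes A z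
vanishes-⊕ z []                          = refl
vanishes-⊕ {A = r ∷ A} {w} z (r⊥w ∷ A⊥w) = cong₂ _∧_
  (cong not (trans (⟨⟩-⊕ʳ r z w) (trans (cong (⟨ r , z ⟩ xor_) r⊥w) (xor-identityʳ ⟨ r , z ⟩))))
  (vanishes-⊕ z A⊥w)

exponent : ∀ {k} → List (Bits k) → Bits k → ℕ
exponent αs z = sum (List.map (λ α → bit ⟨ α , z ⟩) αs)

scale : ∀ {k} → Bool → Bits k → Bits k
scale b α = if b then α else 𝟎

⟨⟩-scale : ∀ {k} b (α z : Bits k) → ⟨ scale b α , z ⟩ ≡ b ∧ ⟨ α , z ⟩
⟨⟩-scale true  α z = refl
⟨⟩-scale false α z = ⟨⟩-𝟎ˡ z

-- Polarisation of the exponent: from `a xor b = a + b − 2ab`, translating by `w` adds the exponent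
-- of `w` and subtracts twice the sum of all `⟨ α , w ⟩ ⟨ α , z ⟩`. Doubled exponents matter only
-- modulo 2, so this is a sign given by a linear form in `z`, and `polar αs w` is its coefficient
-- vector.
polar : ∀ {k} → List (Bits k) → Bits k → Bits k
polar []       w = 𝟎
polar (α ∷ αs) w = scale ⟨ α , w ⟩ α ⊕ polar αs w

⟨⟩-polar-∷ : ∀ {k} (α : Bits k) αs w z →
  ⟨ polar (α ∷ αs) w , z ⟩ ≡ (⟨ α , w ⟩ ∧ ⟨ α , z ⟩) xor ⟨ polar αs w , z ⟩
⟨⟩-polar-∷ α αs w z = trans (⟨⟩-⊕ˡ (scale ⟨ α , w ⟩ α) (polar αs w) z)
  (cong (_xor ⟨ polar αs w , z ⟩) (⟨⟩-scale ⟨ α , w ⟩ α z))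

-- Symmetry of this bilinear form lets `separated` turn a fact about translations of rows into one
-- about translations of columns.
polar-sym : ∀ {k} (αs : List (Bits k)) w z → ⟨ polar αs w , z ⟩ ≡ ⟨ polar αs z , w ⟩
polar-sym []       w z = trans (⟨⟩-𝟎ˡ z) (sym (⟨⟩-𝟎ˡ w))
polar-sym (α ∷ αs) w z = trans (⟨⟩-polar-∷ α αs w z)
  (trans (cong₂ _xor_ (∧-comm ⟨ α , w ⟩ ⟨ α , z ⟩) (polar-sym αs w z)) (sym (⟨⟩-polar-∷ α αs z w)))

i^-bit-xor : ∀ a b → i^ bit (a xor b) ≈ sgn (b ∧ a) * (i^ bit b * i^ bit a)
i^-bit-xor a b = ≈-sym (cases a b)
  where
  one : i^ 0 ≈ 1ℂ
  one = reflexive i^-zero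
  cases : ∀ a b → sgn (b ∧ a) * (i^ bit b * i^ bit a) ≈ i^ bit (a xor b)
  cases false false = ≈-trans (*-identityˡ _) (≈-trans (*-congʳ one) (*-identityˡ _))
  cases true  false = ≈-trans (*-identityˡ _) (≈-trans (*-congʳ one) (*-identityˡ _))
  cases false true  = ≈-trans (*-identityˡ _) (≈-trans (*-congˡ one) (*-identityʳ _))
  cases true  true  = begin
    - 1ℂ * (i^ 1 * i^ 1)    ≈⟨ *-congˡ (i^-+ 1 1) ⟨
    - 1ℂ * i^ 2             ≈⟨ *-congˡ i^2≈-1 ⟩
    - 1ℂ * - 1ℂ             ≈⟨ -1*-1≈1 ⟩
    1ℂ                      ≈⟨ one ⟨
    i^ 0                    ∎

i^-exponent-⊕ : ∀ {k} (αs : List (Bits k)) z w →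
  i^ exponent αs (z ⊕ w) ≈ sgn ⟨ polar αs w , z ⟩ * (i^ exponent αs w * i^ exponent αs z)
i^-exponent-⊕ [] z w = begin
  i^ 0                                   ≈⟨ ≈-trans (*-identityˡ _) (*-identityˡ _) ⟨
  1ℂ * (1ℂ * i^ 0)                       ≡⟨ cong (λ t → 1ℂ * (t * i^ 0)) i^-zero ⟨
  1ℂ * (i^ 0 * i^ 0)                     ≡⟨ cong (λ t → sgn t * (i^ 0 * i^ 0)) (⟨⟩-𝟎ˡ z) ⟨
  sgn ⟨ 𝟎 , z ⟩ * (i^ 0 * i^ 0)          ∎
i^-exponent-⊕ (α ∷ αs) z w = begin
  i^ (bit ⟨ α , z ⊕ w ⟩ ℕ.+ exponent αs (z ⊕ w))
    ≈⟨ i^-+ (bit ⟨ α , z ⊕ w ⟩) (exponent αs (z ⊕ w)) ⟩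
  i^ bit ⟨ α , z ⊕ w ⟩ * i^ exponent αs (z ⊕ w)
    ≈⟨ *-cong (≈-trans (reflexive (cong (λ t → i^ bit t) (⟨⟩-⊕ʳ α z w))) (i^-bit-xor a b)) (i^-exponent-⊕ αs z w) ⟩
  sgn (b ∧ a) * (i^ bit b * i^ bit a) * (sgn s * (i^ exponent αs w * i^ exponent αs z))
    ≈⟨ solve 6 (λ s b a t w z → (s ⊗ (b ⊗ a)) ⊗ (t ⊗ (w ⊗ z)) ⊜ (s ⊗ t) ⊗ ((b ⊗ w) ⊗ (a ⊗ z))) ≈-refl
         (sgn (b ∧ a)) (i^ bit b) (i^ bit a) (sgn s) (i^ exponent αs w) (i^ exponent αs z) ⟩
  sgn (b ∧ a) * sgn s * (i^ bit b * i^ exponent αs w * (i^ bit a * i^ exponent αs z))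
    ≈⟨ *-cong (≈-trans (reflexive (cong sgn (⟨⟩-polar-∷ α αs w z))) (sgn-xor (b ∧ a) s))
              (*-cong (i^-+ (bit b) (exponent αs w)) (i^-+ (bit a) (exponent αs z))) ⟨
  sgn ⟨ polar (α ∷ αs) w , z ⟩ * (i^ exponent (α ∷ αs) w * i^ exponent (α ∷ αs) z)
    ∎
  where
  a = ⟨ α , z ⟩
  b = ⟨ α , w ⟩
  s = ⟨ polar αs w , z ⟩

private
  opaque
    unfolding _+_

    *-defs : ∀ z w → z D.* w ≡ z * w
    *-defs z w = refl

  affine-unfold : ∀ {k} c (A αs : List (Bits (suc k))) z →
    affine c A αs z ≡ c D.* χ[ A · z ∷ʳ true ≡0] D.* (D.i^ sum (List.map (λ α → bit ⟨ α , z ∷ʳ true ⟩) αs))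
  affine-unfold c A αs z = refl

  *-*-defs : ∀ z w v → z D.* w D.* v ≡ z * w * v
  *-*-defs z w v = trans (*-defs (z D.* w) v) (cong (_* v) (*-defs z w))

  affine-entry-defs : ∀ {k} c (A αs : List (Bits (suc k))) z →
    affine c A αs z ≡ c * χ[ A · z ∷ʳ true ≡0] * (D.i^ sum (List.map (λ α → bit ⟨ α , z ∷ʳ true ⟩) αs))
  affine-entry-defs c A αs z = trans (affine-unfold c A αs z)
    (*-*-defs c χ[ A · z ∷ʳ true ≡0] (D.i^ sum (List.map (λ α → bit ⟨ α , z ∷ʳ true ⟩) αs)))

opaque
  unfolding i^_

  affine-entry : ∀ {k} c (A αs : List (Bits (suc k))) z →
    affine c A αs z ≡ c * indicator (vanishes A (z ∷ʳ true)) * i^ exponent αs (z ∷ʳ true)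
  affine-entry = affine-entry-defs

-- Row and column coordinates of an affine signature

join : ∀ {n} → Bits n → Bits n → Bits (n ℕ.+ n)
join x y = x ++ reverse y

⟨⟩-join : ∀ {n} (r s x y : Bits n) → ⟨ join r s , join x y ⟩ ≡ ⟨ r , x ⟩ xor ⟨ s , y ⟩
⟨⟩-join r s x y = trans (⟨⟩-++ r x (reverse s) (reverse y)) (cong (⟨ r , x ⟩ xor_) (⟨⟩-reverse s y))

join-⊕ : ∀ {n} (x y u v : Bits n) → join x y ⊕ join u v ≡ join (x ⊕ u) (y ⊕ v)
join-⊕ x y u v = trans (⊕-++ x u (reverse y) (reverse v)) (cong ((x ⊕ u) ++_) (⊕-reverse y v))

unjoin : ∀ {n} (z : Bits (n ℕ.+ n)) → ∃[ x ] ∃[ y ] z ≡ join {n} x y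
unjoin {n} z = let x , y , z≡ = splitAt n z in
  x , reverse y , trans z≡ (cong (x ++_) (sym (reverse-involutive y)))

-- Homogeneous coordinates: a point ends in 1 and a difference of points ends in 0, so the constant
-- term of an affine equation disappears on directions.
point direction : ∀ {n} → Bits n → Bits n → Bits (suc (n ℕ.+ n))
point x y     = join x y ∷ʳ true
direction u v = join u v ∷ʳ false

point-⊕-direction : ∀ {n} (x y u v : Bits n) → point x y ⊕ direction u v ≡ point (x ⊕ u) (y ⊕ v)
point-⊕-direction x y u v = trans (⊕-∷ʳ (join x y) (join u v) true false) (cong (_∷ʳ true) (join-⊕ x y u v))

point-⊕-point : ∀ {n} (x y u v : Bits n) → point x y ⊕ point u v ≡ direction (x ⊕ u) (y ⊕ v)
point-⊕-point x y u v = trans (⊕-∷ʳ (join x y) (join u v) true true) (cong (_∷ʳ false) (join-⊕ x y u v))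

-- A linear form on points, split into its parts on the row index, the column index and the constant 1.
module FormParts (n : ℕ) where

  left right : Bits (suc (n ℕ.+ n)) → Bits n
  left α  = proj₁ (unjoin {n} (proj₁ (initLast α)))
  right α = proj₁ (proj₂ (unjoin {n} (proj₁ (initLast α))))

  constant : Bits (suc (n ℕ.+ n)) → Bool
  constant α = proj₁ (proj₂ (initLast α))

  private
    parts : ∀ α → α ≡ join (left α) (right α) ∷ʳ constant α
    parts α = trans (proj₂ (proj₂ (initLast α)))
      (cong (_∷ʳ constant α) (proj₂ (proj₂ (unjoin {n} (proj₁ (initLast α))))))

    ⟨⟩-parts : ∀ α x y t → ⟨ α , join x y ∷ʳ t ⟩ ≡ (⟨ left α , x ⟩ xor ⟨ right α , y ⟩) xor (constant α ∧ t)
    ⟨⟩-parts α x y t = trans (cong (λ a → ⟨ a , join x y ∷ʳ t ⟩) (parts α))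
      (trans (⟨⟩-∷ʳ (join (left α) (right α)) (join x y) (constant α) t)
        (cong (_xor (constant α ∧ t)) (⟨⟩-join (left α) (right α) x y)))

  ⟨⟩-point : ∀ α x y → ⟨ α , point x y ⟩ ≡ (⟨ left α , x ⟩ xor ⟨ right α , y ⟩) xor constant α
  ⟨⟩-point α x y = trans (⟨⟩-parts α x y true)
    (cong ((⟨ left α , x ⟩ xor ⟨ right α , y ⟩) xor_) (∧-identityʳ (constant α)))

  ⟨⟩-direction : ∀ α u v → ⟨ α , direction u v ⟩ ≡ ⟨ left α , u ⟩ xor ⟨ right α , v ⟩
  ⟨⟩-direction α u v = trans (⟨⟩-parts α u v false)
    (trans (cong ((⟨ left α , u ⟩ xor ⟨ right α , v ⟩) xor_) (∧-zeroʳ (constant α)))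
      (xor-identityʳ (⟨ left α , u ⟩ xor ⟨ right α , v ⟩)))

record AffineEntries {n} (M : Mat n) : Set where
  field
    coefficient : ℂ
    equations   : List (Bits (suc (n ℕ.+ n)))
    exponents   : List (Bits (suc (n ℕ.+ n)))
    entry       : ∀ x y → M x y ≈
      coefficient * indicator (vanishes equations (point x y)) * i^ exponent exponents (point x y)

affine⇒entries : ∀ {n} {M : Mat n} → 𝒜 n M → AffineEntries M
affine⇒entries (f , (c , A , αs , f≈) , M≋) = record
  { coefficient = c ; equations = A ; exponents = αs
  ; entry = λ x y → ≈-trans (M≋ x y) (≈-trans (f≈ (join x y)) (reflexive (affine-entry c A αs (join x y)))) }

true≢false : true ≢ false
true≢false ()

true-or-false : ∀ b → b ≡ true ⊎ b ≡ false
true-or-false true  = inj₁ refl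
true-or-false false = inj₂ refl

-- Nonsingular affine matrices meet every Pauli matrix on the right

intertwines-𝟎 : ∀ {n} (M : Mat n) → Intertwines M 𝟎 𝟎 𝟎 𝟎
intertwines-𝟎 M = intertwines phase-1 λ x y → begin
  M (x ⊕ 𝟎) (y ⊕ 𝟎)                                      ≡⟨ cong₂ M (⊕-identityʳ x) (⊕-identityʳ y) ⟩
  M x y                                                  ≈⟨ ≈-trans (*-identityˡ _) (*-identityˡ _) ⟨
  1ℂ * (1ℂ * M x y)                                      ≡⟨ cong (λ t → 1ℂ * (sgn t * M x y))
                                                              (cong₂ _xor_ (⟨⟩-𝟎ˡ x) (⟨⟩-𝟎ˡ y)) ⟨
  1ℂ * (sgn (⟨ 𝟎 , x ⟩ xor ⟨ 𝟎 , y ⟩) * M x y)           ∎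

intertwines-resp : ∀ {n} (M : Mat n) {u u′ w w′ v v′ b b′} → u ≡ u′ → w ≡ w′ → v ≡ v′ → b ≡ b′ →
  Intertwines M u w v b → Intertwines M u′ w′ v′ b′
intertwines-resp M refl refl refl refl M∼ = M∼

-- Without a Z on the left the sign is the same in all rows, so column `v` would be a multiple of
-- column `𝟎`. For distinct columns a left inverse forbids this.
no-shift : ∀ {n} (M N : Mat n) → (∀ x y → Σ[ n ] (λ z → N x z * M z y) ≈ 𝟙 x y) →
  ∀ {v b} → Intertwines M 𝟎 𝟎 v b → v ≡ 𝟎
no-shift {n} M N NM≈𝟙 {v} {b} (intertwines {c} c∈ relation) with v ≟ 𝟎
... | yes v≡𝟎 = v≡𝟎
... | no v≢𝟎 = ⊥-elim (1≉0 (begin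
  1ℂ
    ≈⟨ 𝟙-refl v ⟨
  𝟙 v v
    ≈⟨ NM≈𝟙 v v ⟨
  Σ[ n ] (λ x → N v x * M x v)
    ≈⟨ Σ-cong n (λ x → begin
       N v x * M x v
         ≡⟨ cong₂ (λ s t → N v x * M s t) (⊕-identityʳ x) (⊕-identityˡ v) ⟨
       N v x * M (x ⊕ 𝟎) (𝟎 ⊕ v)
         ≈⟨ *-congˡ (relation x 𝟎) ⟩
       N v x * (c * (sgn (⟨ 𝟎 , x ⟩ xor ⟨ b , 𝟎 ⟩) * M x 𝟎))
         ≡⟨ cong (λ t → N v x * (c * (sgn t * M x 𝟎))) (cong₂ _xor_ (⟨⟩-𝟎ˡ x) (⟨⟩-𝟎ʳ b)) ⟩
       N v x * (c * (1ℂ * M x 𝟎))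
         ≈⟨ *-congˡ (*-congˡ (*-identityˡ (M x 𝟎))) ⟩
       N v x * (c * M x 𝟎)
         ≈⟨ x∙yz≈y∙xz (N v x) c (M x 𝟎) ⟩
       c * (N v x * M x 𝟎)
         ∎) ⟩
  Σ[ n ] (λ x → c * (N v x * M x 𝟎))
    ≈⟨ *-Σ c n (λ x → N v x * M x 𝟎) ⟨
  c * Σ[ n ] (λ x → N v x * M x 𝟎)
    ≈⟨ *-congˡ (≈-trans (NM≈𝟙 v 𝟎) (𝟙-≢ v≢𝟎)) ⟩
  c * 0ℂ
    ≈⟨ zeroʳ c ⟩
  0ℂ
    ∎))

module Affine {n} (M : Mat n) (form : AffineEntries M) where
  open FormParts n
  open AffineEntries form renaming (coefficient to c; equations to A; exponents to αs)

  private
    phase : Bits n → Bits n → ℂ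
    phase x y = i^ exponent αs (point x y)

  entry-zero : ∀ {x y} → vanishes A (point x y) ≡ false → M x y ≈ 0ℂ
  entry-zero {x} {y} off = begin
    M x y                                                   ≈⟨ entry x y ⟩
    c * indicator (vanishes A (point x y)) * phase x y      ≡⟨ cong (λ b → c * indicator b * phase x y) off ⟩
    c * 0ℂ * phase x y                                      ≈⟨ *-congʳ (zeroʳ c) ⟩
    0ℂ * phase x y                                          ≈⟨ zeroˡ (phase x y) ⟩
    0ℂ                                                      ∎

  -- The support is invariant under the translation. The polar form `p` supplies the Z parts on both
  -- sides, while its constant bit is one more sign in the phase.
  direction-intertwines : ∀ {u v} → Orthogonal A (direction u v) →
    Intertwines M u (left (polar αs (direction u v))) v (right (polar αs (direction u v)))
  direction-intertwines {u} {v} A⊥ =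
    intertwines (phase-* (exponent αs (direction u v) , ≈-refl) (phase-sgn (constant p))) λ x y →
    let s = ⟨ left p , x ⟩ xor ⟨ right p , y ⟩ ; χ = indicator (vanishes A (point x y)) in begin
    M (x ⊕ u) (y ⊕ v)
      ≈⟨ entry (x ⊕ u) (y ⊕ v) ⟩
    c * indicator (vanishes A (point (x ⊕ u) (y ⊕ v))) * phase (x ⊕ u) (y ⊕ v)
      ≡⟨ cong (λ z → c * indicator (vanishes A z) * i^ exponent αs z) (point-⊕-direction x y u v) ⟨
    c * indicator (vanishes A (point x y ⊕ direction u v)) * i^ exponent αs (point x y ⊕ direction u v)
      ≈⟨ *-cong (*-congˡ (reflexive (cong indicator (vanishes-⊕ (point x y) A⊥))))
                (i^-exponent-⊕ αs (point x y) (direction u v)) ⟩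
    c * χ * (sgn ⟨ p , point x y ⟩ * (q * phase x y))
      ≈⟨ *-congˡ (*-congʳ (≈-trans (reflexive (cong sgn (⟨⟩-point p x y))) (sgn-xor s (constant p)))) ⟩
    c * χ * (sgn s * sgn (constant p) * (q * phase x y))
      ≈⟨ solve 6 (λ c χ s t q r → (c ⊗ χ) ⊗ ((s ⊗ t) ⊗ (q ⊗ r)) ⊜ (q ⊗ t) ⊗ (s ⊗ ((c ⊗ χ) ⊗ r))) ≈-refl
           c χ (sgn s) (sgn (constant p)) q (phase x y) ⟩
    q * sgn (constant p) * (sgn s * (c * χ * phase x y))
      ≈⟨ *-congˡ (*-congˡ (entry x y)) ⟨
    q * sgn (constant p) * (sgn s * M x y)
      ∎
    where
    p = polar αs (direction u v)
    q = i^ exponent αs (direction u v)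

  -- On the support the equation holds and its sign is 1; off the support both sides are zero.
  equation-intertwines : ∀ {row} → row ∈ A → Intertwines M 𝟎 (left row) 𝟎 (right row)
  equation-intertwines {row} row∈A = intertwines (phase-sgn (constant row)) λ x y →
    let s = ⟨ left row , x ⟩ xor ⟨ right row , y ⟩ in begin
    M (x ⊕ 𝟎) (y ⊕ 𝟎)
      ≡⟨ cong₂ M (⊕-identityʳ x) (⊕-identityʳ y) ⟩
    M x y
      ≈⟨ fixed x y (true-or-false (vanishes A (point x y))) ⟩
    sgn ⟨ row , point x y ⟩ * M x y
      ≡⟨ cong (λ t → sgn t * M x y) (⟨⟩-point row x y) ⟩
    sgn (s xor constant row) * M x y
      ≡⟨ cong (λ t → sgn t * M x y) (xor-comm s (constant row)) ⟩
    sgn (constant row xor s) * M x y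
      ≈⟨ sgn-xor-* (constant row) s (M x y) ⟩
    sgn (constant row) * (sgn s * M x y)
      ∎
    where
    fixed : ∀ x y → vanishes A (point x y) ≡ true ⊎ vanishes A (point x y) ≡ false →
      M x y ≈ sgn ⟨ row , point x y ⟩ * M x y
    fixed x y (inj₁ on) = ≈-trans (≈-sym (*-identityˡ _))
      (*-congʳ (reflexive (cong sgn (sym (All.lookup (vanishes⇒orthogonal A on) row∈A)))))
    fixed x y (inj₂ off) = ≈-trans (entry-zero off)
      (≈-trans (≈-sym (zeroʳ (sgn ⟨ row , point x y ⟩))) (*-congˡ (≈-sym (entry-zero off))))

  module _ (N : Mat n) (NM≈𝟙 : ∀ x y → Σ[ n ] (λ z → N x z * M z y) ≈ 𝟙 x y) where

    -- A column without support would be zero, contrary to the diagonal entry 1 of N M.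
    occupied : ∀ y → ∃[ x ] vanishes A (point x y) ≡ true
    occupied y with search n (λ x → true-or-false (vanishes A (point x y)))
    ... | inj₁ found = found
    ... | inj₂ none  = ⊥-elim (1≉0 (begin
      1ℂ                              ≈⟨ 𝟙-refl y ⟨
      𝟙 y y                           ≈⟨ NM≈𝟙 y y ⟨
      Σ[ n ] (λ x → N y x * M x y)    ≈⟨ Σ-zero n (λ x → ≈-trans (*-congˡ (entry-zero (none x))) (zeroʳ (N y x))) ⟩
      0ℂ                              ∎))

    -- Every entry of `M` contains the factor `c`. Taking it out of one diagonal entry of N M leaves
    -- an explicit inverse, more than a refutation of `c ≈ 0ℂ` would give.
    coefficient-invertible : Invertible c
    coefficient-invertible = invertible-by c (begin
      c * Σ[ n ] (λ x → N 𝟎 x * (indicator (vanishes A (point x 𝟎)) * phase x 𝟎))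
        ≈⟨ *-Σ c n (λ x → N 𝟎 x * (indicator (vanishes A (point x 𝟎)) * phase x 𝟎)) ⟩
      Σ[ n ] (λ x → c * (N 𝟎 x * (indicator (vanishes A (point x 𝟎)) * phase x 𝟎)))
        ≈⟨ Σ-cong n (λ x → begin
           c * (N 𝟎 x * (indicator (vanishes A (point x 𝟎)) * phase x 𝟎))
             ≈⟨ solve 4 (λ c m χ p → c ⊗ (m ⊗ (χ ⊗ p)) ⊜ m ⊗ ((c ⊗ χ) ⊗ p)) ≈-refl
                  c (N 𝟎 x) (indicator (vanishes A (point x 𝟎))) (phase x 𝟎) ⟩
           N 𝟎 x * (c * indicator (vanishes A (point x 𝟎)) * phase x 𝟎)
             ≈⟨ *-congˡ (entry x 𝟎) ⟨
           N 𝟎 x * M x 𝟎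
             ∎) ⟩
      Σ[ n ] (λ x → N 𝟎 x * M x 𝟎)
        ≈⟨ NM≈𝟙 𝟎 𝟎 ⟩
      𝟙 𝟎 𝟎
        ≈⟨ 𝟙-refl (𝟎 {n}) ⟩
      1ℂ
        ∎)

    -- The sum of a support point in column `𝟎` and one in column `v` is a direction of the support
    -- with column part `v`.
    x-part : ∀ v → ∃[ u ] ∃[ w ] ∃[ b ] Intertwines M u w v b
    x-part v =
      let x₀ , on₀ = occupied 𝟎 ; x₁ , on₁ = occupied v in
      _ , _ , _ , direction-intertwines (subst (Orthogonal A)
        (trans (point-⊕-point x₀ 𝟎 x₁ v) (cong (direction (x₀ ⊕ x₁)) (⊕-identityˡ v)))
        (orthogonal-⊕ (vanishes⇒orthogonal A on₀) (vanishes⇒orthogonal A on₁)))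

    private
      -- The Z part on the right of the relation for the direction `(u , 𝟎)`. If this is not a
      -- direction of the support, the default `𝟎` stands for the trivial relation, so that all `u`
      -- can be listed uniformly.
      column : Bits n → Bits n
      column u = if vanishes A (direction u 𝟎) then right (polar αs (direction u 𝟎)) else 𝟎

      Right Left : Bits n → Set
      Right b = ∃[ u ] ∃[ w ] Intertwines M u w 𝟎 b
      Left w  = ∃[ b ] Intertwines M 𝟎 w 𝟎 b

      right-⊕ : ∀ {a b} → Right a → Right b → Right (a ⊕ b)
      right-⊕ (_ , _ , M∼) (_ , _ , M∼′) = _ , _ ,
        intertwines-resp M refl refl (⊕-identityˡ 𝟎) refl (intertwines-⊕ M M∼ M∼′)

      left-⊕ : ∀ {a b} → Left a → Left b → Left (a ⊕ b)
      left-⊕ (_ , M∼) (_ , M∼′) = _ ,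
        intertwines-resp M (⊕-identityˡ 𝟎) refl (⊕-identityˡ 𝟎) refl (intertwines-⊕ M M∼ M∼′)

      right-column : ∀ u → Right (column u)
      right-column u with vanishes A (direction u 𝟎) in on
      ... | true  = _ , _ , direction-intertwines (vanishes⇒orthogonal A on)
      ... | false = 𝟎 , 𝟎 , intertwines-𝟎 M

      vertical : ∀ {v} → Orthogonal (List.map right A) v → Orthogonal A (direction 𝟎 v)
      vertical {v} A·v = All.map
        (λ {row} r·v → trans (⟨⟩-direction row 𝟎 v) (cong₂ _xor_ (⟨⟩-𝟎ʳ (left row)) r·v)) (All.map⁻ A·v)

      horizontal : ∀ {u} → Orthogonal (List.map left A) u → Orthogonal A (direction u 𝟎)
      horizontal {u} A·u = All.map
        (λ {row} r·u → trans (⟨⟩-direction row u 𝟎) (cong₂ _xor_ r·u (⟨⟩-𝟎ʳ (right row)))) (All.map⁻ A·u)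

      -- The first hypothesis makes `(𝟎 , v)` a direction of the support, so X^v with some Z's on
      -- the right corresponds to the Z part `left p` alone on the left. By symmetry of the polar
      -- form and the second hypothesis, `left p` is orthogonal to every `u` that satisfies the left
      -- parts of the equations. Hence `left p` lies in their span, and a sum of equation relations
      -- cancels it without touching `v`; `no-shift` applies to what remains.
      separated : ∀ {v} → Orthogonal (List.map right A) v → Orthogonal (List.map column (allBits n)) v → v ≡ 𝟎
      separated {v} A·v columns·v = conclude (span-or-separate {P = Left} (𝟎 , intertwines-𝟎 M) left-⊕
          (List.map left A) (All.map⁺ (All.tabulate λ row∈A → _ , equation-intertwines row∈A)) (left p))
        where
        p : Bits (suc (n ℕ.+ n))
        p = polar αs (direction 𝟎 v)
        left-p : ∀ {u} → Orthogonal (List.map left A) u → ⟨ left p , u ⟩ ≡ false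
        left-p {u} A·u =
          trans (sym (trans (cong (⟨ left p , u ⟩ xor_) (⟨⟩-𝟎ʳ (right p))) (xor-identityʳ ⟨ left p , u ⟩)))
          (trans (sym (⟨⟩-direction p u 𝟎))
          (trans (polar-sym αs (direction 𝟎 v) (direction u 𝟎))
          (trans (⟨⟩-direction q 𝟎 v)
          (cong₂ _xor_ (⟨⟩-𝟎ʳ (left q)) (trans
            -- For this `u` the test inside `column u` succeeds, so the orthogonality of `v`
            -- concerns `right q` and not the default.
            (cong (λ t → ⟨ (if t then right q else 𝟎) , v ⟩) (sym (orthogonal⇒vanishes (horizontal A·u))))
            (All.lookup (All.map⁻ columns·v) (∈-allBits u)))))))
          where
          q : Bits (suc (n ℕ.+ n))
          q = polar αs (direction u 𝟎)
        conclude : Left (left p) ⊎ ∃[ u ] (Orthogonal (List.map left A) u × ⟨ left p , u ⟩ ≡ true) → v ≡ 𝟎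
        conclude (inj₁ (_ , M∼)) = no-shift M N NM≈𝟙
          (intertwines-resp M (⊕-identityˡ 𝟎) (⊕-same (left p)) (⊕-identityʳ v) refl
            (intertwines-⊕ M (direction-intertwines (vertical A·v)) M∼))
        conclude (inj₂ (u , A·u , p·u)) = ⊥-elim (true≢false (trans (sym p·u) (left-p A·u)))

    -- If Z^b were missing, some v ≠ 0 would pair trivially with all relations having no X on the right;
    -- then X^v times some Z's would fix M up to a phase.
    z-part : ∀ b → ∃[ u ] ∃[ w ] Intertwines M u w 𝟎 b
    z-part b = conclude (span-or-separate {P = Right} (𝟎 , 𝟎 , intertwines-𝟎 M) right-⊕
        (List.map right A List.++ List.map column (allBits n))
        (All.++⁺ (All.map⁺ (All.tabulate λ row∈A → 𝟎 , _ , equation-intertwines row∈A))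
                 (All.map⁺ (All.universal right-column (allBits n))))
        b)
      where
      conclude : Right b ⊎
        ∃[ v ] (Orthogonal (List.map right A List.++ List.map column (allBits n)) v × ⟨ b , v ⟩ ≡ true) →
        Right b
      conclude (inj₁ found) = found
      conclude (inj₂ (v , ·v , b·v)) = ⊥-elim (true≢false (trans (sym b·v) (trans (cong ⟨ b ,_⟩
        (separated (All.++⁻ˡ (List.map right A) ·v) (All.++⁻ʳ (List.map right A) ·v))) (⟨⟩-𝟎ʳ b))))

    affine⇒clifford : Clifford M
    affine⇒clifford v b =
      -- The first relation brings an uncontrolled Z^r along with X^v; the second corrects `r` to
      -- `b`.
      let u , w , r , M∼ = x-part v ; _ , _ , M∼′ = z-part (r ⊕ b) in
      _ , _ , intertwines-resp M refl refl (⊕-identityʳ v) (⊕-cancelˡ r b) (intertwines-⊕ M M∼ M∼′)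

-- Scaling an affine matrix to a unitary

opaque
  unfolding _+_

  -- Only the squared modulus matters, and `(1 + i) / 2` has squared modulus ½. So the normalisation
  -- stays within Gaussian rationals even when an odd power of 2 has to be removed.
  √½ : ∃[ r ] conj r * r * (1ℂ + 1ℂ) ≈ 1ℂ
  √½ = gaussian ½ ½ , mk≈ (pointwise λ _ → refl) (pointwise λ _ → refl)

private
  true-ext : ∀ {a b} → (a ≡ true → b ≡ true) → (b ≡ true → a ≡ true) → a ≡ b
  true-ext {true}  to _    = sym (to refl)
  true-ext {false} {false} _ _ = refl
  true-ext {false} {true}  _ from = from refl

-- An affine subspace has 2ʳ points, and 2 = |1 + i|².
affine-subspace-norm : ∀ n (p : Bits n → Bool) →
  (∀ {x y z} → p x ≡ true → p y ≡ true → p z ≡ true → p (x ⊕ y ⊕ z) ≡ true) →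
  ∀ {x} → p x ≡ true → ∃[ d ] conj d * d * Σ[ n ] (λ x → indicator (p x)) ≈ 1ℂ
affine-subspace-norm zero    p closed {[]} on = 1ℂ , (begin
  conj 1ℂ * 1ℂ * Σ[ 0 ] (λ x → indicator (p x))    ≡⟨ cong (conj 1ℂ * 1ℂ *_) (Σ-[] λ x → indicator (p x)) ⟩
  conj 1ℂ * 1ℂ * indicator (p [])                  ≡⟨ cong (λ b → conj 1ℂ * 1ℂ * indicator b) on ⟩
  conj 1ℂ * 1ℂ * 1ℂ                                ≈⟨ ≈-trans (*-identityʳ _) (*-identityʳ _) ⟩
  conj 1ℂ                                          ≈⟨ conj-1 ⟩
  1ℂ                                               ∎)
affine-subspace-norm (suc n) p closed {x} on =
  combine (search n λ x → true-or-false (p (false ∷ x))) (search n λ x → true-or-false (p (true ∷ x)))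
  where
  S : Bool → ℂ
  S a = Σ[ n ] (λ x → indicator (p (a ∷ x)))
  split : Σ[ suc n ] (λ x → indicator (p x)) ≈ S false + S true
  split = reflexive (Σ-∷ n λ x → indicator (p x))
  empty : ∀ a → (∀ x → p (a ∷ x) ≡ false) → S a ≈ 0ℂ
  empty a off = Σ-zero n λ x → reflexive (cong indicator (off x))
  off-everywhere : ∀ x → (∀ x → p (false ∷ x) ≡ false) → (∀ x → p (true ∷ x) ≡ false) → p x ≡ false
  off-everywhere (false ∷ x) off₀ off₁ = off₀ x
  off-everywhere (true ∷ x)  off₀ off₁ = off₁ x
  half₀ : ∀ {x} → p (false ∷ x) ≡ true → ∃[ d ] conj d * d * S false ≈ 1ℂ
  half₀ = affine-subspace-norm n (λ x → p (false ∷ x)) closed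
  half₁ : ∀ {x} → p (true ∷ x) ≡ true → ∃[ d ] conj d * d * S true ≈ 1ℂ
  half₁ = affine-subspace-norm n (λ x → p (true ∷ x)) closed
  equal : ∀ a b → p (false ∷ a) ≡ true → p (true ∷ b) ≡ true → S true ≈ S false
  -- When both halves are occupied, translation by `a ⊕ b` carries one onto the other: adding the
  -- two known points to a third one flips its first bit and stays in the subspace.
  equal a b pa pb = ≈-trans (≈-sym (Σ-translate n (a ⊕ b) λ x → indicator (p (true ∷ x))))
    (Σ-cong n λ x → reflexive (cong indicator (true-ext
      (λ p₁ → subst (λ t → p (false ∷ t) ≡ true)
        (trans (⊕-assoc (x ⊕ (a ⊕ b)) a b) (⊕-cancelʳ x (a ⊕ b))) (closed p₁ pa pb))
      (λ p₀ → subst (λ t → p (true ∷ t) ≡ true) (⊕-assoc x a b) (closed p₀ pa pb)))))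
  combine : (∃[ x ] p (false ∷ x) ≡ true) ⊎ (∀ x → p (false ∷ x) ≡ false) →
    (∃[ x ] p (true ∷ x) ≡ true) ⊎ (∀ x → p (true ∷ x) ≡ false) →
    ∃[ d ] conj d * d * Σ[ suc n ] (λ x → indicator (p x)) ≈ 1ℂ
  combine (inj₂ off₀) (inj₂ off₁) = ⊥-elim (true≢false (trans (sym on) (off-everywhere x off₀ off₁)))
  combine (inj₁ (_ , pa)) (inj₂ off₁) = let d , norm = half₀ pa in d , ≈-trans
    (*-congˡ (≈-trans split (≈-trans (+-cong ≈-refl (empty true off₁)) (+-identityʳ (S false))))) norm
  combine (inj₂ off₀) (inj₁ (_ , pb)) = let d , norm = half₁ pb in d , ≈-trans
    (*-congˡ (≈-trans split (≈-trans (+-cong (empty false off₀) ≈-refl) (+-identityˡ (S true))))) norm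
  -- The number of points doubles, which the extra factor `r` compensates.
  combine (inj₁ (a , pa)) (inj₁ (b , pb)) = let d , norm = half₀ pa ; r , r-norm = √½ in d * r , (begin
    conj (d * r) * (d * r) * Σ[ suc n ] (λ x → indicator (p x))
      ≈⟨ *-cong (*-congʳ (conj-* d r)) (≈-trans split
           (≈-trans (+-cong ≈-refl (equal a b pa pb)) (≈-sym (double (S false))))) ⟩
    conj d * conj r * (d * r) * ((1ℂ + 1ℂ) * S false)
      ≈⟨ solve 6 (λ d′ r′ d r t s → ((d′ ⊗ r′) ⊗ (d ⊗ r)) ⊗ (t ⊗ s) ⊜ ((d′ ⊗ d) ⊗ s) ⊗ ((r′ ⊗ r) ⊗ t)) ≈-refl
           (conj d) (conj r) d r (1ℂ + 1ℂ) (S false) ⟩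
    conj d * d * S false * (conj r * r * (1ℂ + 1ℂ))
      ≈⟨ *-cong norm r-norm ⟩
    1ℂ * 1ℂ
      ≈⟨ *-identityˡ 1ℂ ⟩
    1ℂ
      ∎)

module _ {n} (M : Mat n) (form : AffineEntries M) where
  open AffineEntries form renaming (coefficient to c; equations to A; exponents to αs)

  private
    on : Bits n → Bool
    on x = vanishes A (point x 𝟎)

    on-closed : ∀ {x y z} → on x ≡ true → on y ≡ true → on z ≡ true → on (x ⊕ y ⊕ z) ≡ true
    on-closed {x} {y} {z} x∈ y∈ z∈ = trans (cong (vanishes A) points) (trans (vanishes-⊕ (point x 𝟎)
        (subst (Orthogonal A) (point-⊕-point y 𝟎 z 𝟎)
          (orthogonal-⊕ (vanishes⇒orthogonal A y∈) (vanishes⇒orthogonal A z∈)))) x∈)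
      where
      points : point (x ⊕ y ⊕ z) 𝟎 ≡ point x 𝟎 ⊕ direction (y ⊕ z) (𝟎 ⊕ 𝟎)
      points = sym (trans (point-⊕-direction x 𝟎 (y ⊕ z) (𝟎 ⊕ 𝟎))
        (cong₂ point (sym (⊕-assoc x y z)) (trans (⊕-identityˡ (𝟎 ⊕ 𝟎)) (⊕-identityˡ 𝟎))))

    -- Powers of i have modulus one, so each support point of the column contributes the squared
    -- modulus of `c`.
    column-norm : gram M 𝟎 𝟎 ≈ conj c * c * Σ[ n ] (λ x → indicator (on x))
    column-norm = ≈-trans (Σ-cong n λ x → ≈-trans
        (*-cong (conj-cong (entry x 𝟎)) (entry x 𝟎)) (square x (on x)))
      (≈-sym (*-Σ (conj c * c) n λ x → indicator (on x)))
      where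
      phase : Bits n → ℂ
      phase x = i^ exponent αs (point x 𝟎)
      conj-indicator : ∀ b → conj (indicator b) * indicator b ≈ indicator b
      conj-indicator true  = ≈-trans (*-identityʳ _) conj-1
      conj-indicator false = zeroʳ _
      square : ∀ x b → conj (c * indicator b * phase x) * (c * indicator b * phase x) ≈ conj c * c * indicator b
      square x b = begin
        conj (c * indicator b * phase x) * (c * indicator b * phase x)
          ≈⟨ *-congʳ (≈-trans (conj-* (c * indicator b) (phase x)) (*-congʳ (conj-* c (indicator b)))) ⟩
        conj c * conj (indicator b) * conj (phase x) * (c * indicator b * phase x)
          ≈⟨ solve 6 (λ c′ χ′ p′ c χ p → ((c′ ⊗ χ′) ⊗ p′) ⊗ ((c ⊗ χ) ⊗ p) ⊜ ((c′ ⊗ c) ⊗ (χ′ ⊗ χ)) ⊗ (p′ ⊗ p)) ≈-refl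
               (conj c) (conj (indicator b)) (conj (phase x)) c (indicator b) (phase x) ⟩
        conj c * c * (conj (indicator b) * indicator b) * (conj (phase x) * phase x)
          ≈⟨ *-cong (*-congˡ (conj-indicator b)) (phase-norm (exponent αs (point x 𝟎) , ≈-refl)) ⟩
        conj c * c * indicator b * 1ℂ
          ≈⟨ *-identityʳ _ ⟩
        conj c * c * indicator b
          ∎

  affine-column-scale : ∀ N → (∀ x y → Σ[ n ] (λ z → N x z * M z y) ≈ 𝟙 x y) →
    ∃[ e ] conj e * e * gram M 𝟎 𝟎 ≈ 1ℂ
  affine-column-scale N NM≈𝟙 =
    let c⁻¹ , cc⁻¹≈1 = inverse-of (Affine.coefficient-invertible M form N NM≈𝟙)
        _ , x∈ = Affine.occupied M form N NM≈𝟙 𝟎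
        d , norm = affine-subspace-norm n on on-closed x∈
        S = Σ[ n ] (λ x → indicator (on x))
    in c⁻¹ * d , (begin
    conj (c⁻¹ * d) * (c⁻¹ * d) * gram M 𝟎 𝟎
      ≈⟨ *-cong (*-congʳ (conj-* c⁻¹ d)) column-norm ⟩
    conj c⁻¹ * conj d * (c⁻¹ * d) * (conj c * c * S)
      ≈⟨ solve 7 (λ k′ d′ k d c′ c s → ((k′ ⊗ d′) ⊗ (k ⊗ d)) ⊗ ((c′ ⊗ c) ⊗ s) ⊜
           ((c′ ⊗ k′) ⊗ (c ⊗ k)) ⊗ ((d′ ⊗ d) ⊗ s)) ≈-refl
           (conj c⁻¹) (conj d) c⁻¹ d (conj c) c S ⟩
    conj c * conj c⁻¹ * (c * c⁻¹) * (conj d * d * S)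
      ≈⟨ *-cong (*-cong (≈-trans (≈-sym (conj-* c c⁻¹)) (≈-trans (conj-cong cc⁻¹≈1) conj-1)) cc⁻¹≈1) norm ⟩
    1ℂ * 1ℂ * 1ℂ
      ≈⟨ ≈-trans (*-identityʳ _) (*-identityʳ _) ⟩
    1ℂ
      ∎)

opaque
  unfolding Invertible

  invertible⇒nonzero : ∀ z → Invertible z → Nonzero z
  invertible⇒nonzero z z≠0 = z≠0

affine⇒scaled-unitary : ∀ {n} {M : Mat n} → 𝒢𝒜 n M → ∃[ c ] (Nonzero c × Unitary n (c • M))
affine⇒scaled-unitary {n} {M} ((N , MN≋𝟙 , NM≋𝟙) , M∈𝒜) =
  let form = affine⇒entries {n} {M} M∈𝒜
      e , norm = affine-column-scale M form N (inverse-entry N M NM≋𝟙)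
  in e
   -- `e` is a factor of a product equal to 1.
   , invertible⇒nonzero e (invertible-factorʳ (invertible-factorˡ
       (invertible-resp (≈-sym norm) (phase-invertible phase-1))))
   , scale-unitary M N MN≋𝟙 {gram M 𝟎 𝟎} {e}
       (gram-scalar M (Affine.affine⇒clifford M form N (inverse-entry N M NM≋𝟙))) norm

𝒢𝒜∩unitary⇒normalizer : ∀ {n} {V : Mat n} → 𝒢𝒜 n V → Unitary n V → PauliNormalizer n V
𝒢𝒜∩unitary⇒normalizer {n} {V} ((N , _ , NV≋𝟙) , V∈𝒜) V-unitary =
  clifford⇒normalizer V V-unitary (Affine.affine⇒clifford V (affine⇒entries {n} {V} V∈𝒜) N (inverse-entry N V NV≋𝟙))

-- Clifford matrices are affine

record AffineFunction {N} (ψ : Bits N → ℂ) : Set where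
  constructor affineFunction
  field
    coefficient : ℂ
    equations   : List (Bits (suc N))
    exponents   : List (Bits (suc N))
    value       : ∀ x → ψ x ≈
      coefficient * indicator (vanishes equations (x ∷ʳ true)) * i^ exponent exponents (x ∷ʳ true)

affineFunction⇒isAffine : ∀ {N} {ψ : Bits N → ℂ} → AffineFunction ψ → IsAffine ψ
affineFunction⇒isAffine (affineFunction c A αs value) = c , A , αs , λ x →
  ≈-trans (value x) (reflexive (sym (affine-entry c A αs x)))

-- The one-index form of `Intertwines`. The induction removes bits one at a time and does not
-- respect the division into rows and columns.
record Differs {N} (ψ : Bits N → ℂ) (w : Bits N) : Set where
  constructor differs
  field
    {scalar}   : ℂ
    phase      : Phase scalar
    slope      : Bits N
    difference : ∀ x → ψ (x ⊕ w) ≈ scalar * (sgn ⟨ slope , x ⟩ * ψ x)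

half-differs : ∀ {N} {ψ : Bits (suc N) → ℂ} a {w} → Differs ψ (false ∷ w) → Differs (λ x → ψ (a ∷ x)) w
half-differs {ψ = ψ} a {w} (differs {c} c∈ (s ∷ ℓ) difference) =
  differs (phase-* c∈ (phase-sgn (s ∧ a))) ℓ λ x → begin
  ψ (a ∷ (x ⊕ w))                                 ≡⟨ cong (λ b → ψ (b ∷ (x ⊕ w))) (xor-identityʳ a) ⟨
  ψ ((a ∷ x) ⊕ (false ∷ w))                       ≈⟨ difference (a ∷ x) ⟩
  c * (sgn ((s ∧ a) xor ⟨ ℓ , x ⟩) * ψ (a ∷ x))   ≈⟨ *-congˡ (sgn-xor-* (s ∧ a) ⟨ ℓ , x ⟩ (ψ (a ∷ x))) ⟩
  c * (sgn (s ∧ a) * (sgn ⟨ ℓ , x ⟩ * ψ (a ∷ x))) ≈⟨ *-assoc c (sgn (s ∧ a)) _ ⟨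
  c * sgn (s ∧ a) * (sgn ⟨ ℓ , x ⟩ * ψ (a ∷ x))   ∎

-- `g` acts on forms as the transpose of a substitution that takes `z′` to `z`; equations and
-- exponents are pulled back along it.
module _ {k l} (g : Bits k → Bits l) {z z′} (g-dual : ∀ r → ⟨ g r , z′ ⟩ ≡ ⟨ r , z ⟩) where

  vanishes-map : ∀ A → vanishes (List.map g A) z′ ≡ vanishes A z
  vanishes-map []      = refl
  vanishes-map (r ∷ A) = cong₂ (λ b c → not b ∧ c) (g-dual r) (vanishes-map A)

  exponent-map : ∀ αs → exponent (List.map g αs) z′ ≡ exponent αs z
  exponent-map []       = refl
  exponent-map (α ∷ αs) = cong₂ (λ b m → bit b ℕ.+ m) (g-dual α) (exponent-map αs)

i^-exponent-++ : ∀ {k} (αs βs : List (Bits k)) z →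
  i^ exponent (αs List.++ βs) z ≈ i^ exponent αs z * i^ exponent βs z
i^-exponent-++ αs βs z = ≈-trans
  (reflexive (cong i^_ (trans (cong sum (map-++ (λ α → bit ⟨ α , z ⟩) αs βs))
    (sum-++ (List.map (λ α → bit ⟨ α , z ⟩) αs) (List.map (λ α → bit ⟨ α , z ⟩) βs)))))
  (i^-+ (exponent αs z) (exponent βs z))

head-form : ∀ {k} → Bits (suc k)
head-form = true ∷ 𝟎

⟨⟩-head-form : ∀ {k} a (z : Bits k) → ⟨ head-form , a ∷ z ⟩ ≡ a
⟨⟩-head-form a z = trans (cong (a xor_) (⟨⟩-𝟎ˡ z)) (xor-identityʳ a)

head-power : ∀ {k} a (z : Bits k) m →
  i^ exponent (List.replicate m head-form) (a ∷ z) ≈ (if a then i^ m else 1ℂ)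
head-power a z m = ≈-trans (reflexive (cong i^_ (count m))) (cases a)
  where
  count : ∀ m → exponent (List.replicate m head-form) (a ∷ z) ≡ m ℕ.* bit a
  count zero    = refl
  count (suc m) = cong₂ (λ b e → bit b ℕ.+ e) (⟨⟩-head-form a z) (count m)
  cases : ∀ a → i^ (m ℕ.* bit a) ≈ (if a then i^ m else 1ℂ)
  cases true  = reflexive (cong i^_ (ℕ.*-identityʳ m))
  cases false = reflexive (trans (cong i^_ (ℕ.*-zeroʳ m)) i^-zero)

-- a + b − (a ⊕ b) = 2ab, and −1 = 3 modulo 4.
sign-forms : ∀ {k} → Bits k → List (Bits (suc k))
sign-forms m = head-form ∷ (false ∷ m) ∷ (true ∷ m) ∷ (true ∷ m) ∷ (true ∷ m) ∷ []

head-sign : ∀ {k} a (z m : Bits k) → i^ exponent (sign-forms m) (a ∷ z) ≈ sgn (a ∧ ⟨ m , z ⟩)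
head-sign a z m = ≈-trans
  (reflexive (cong (λ t → i^ (bit t ℕ.+ rest a ⟨ m , z ⟩)) (⟨⟩-head-form a z))) (cases a ⟨ m , z ⟩)
  where
  rest : Bool → Bool → ℕ
  rest a b = bit b ℕ.+ (bit (a xor b) ℕ.+ (bit (a xor b) ℕ.+ (bit (a xor b) ℕ.+ 0)))
  cases : ∀ a b → i^ (bit a ℕ.+ rest a b) ≈ sgn (a ∧ b)
  cases false false = reflexive i^-zero
  cases false true  = i^4≈1
  cases true  false = i^4≈1
  cases true  true  = i^2≈-1

one-sided : ∀ {N} {ψ : Bits (suc N) → ℂ} s → (∀ x → ψ (not s ∷ x) ≈ 0ℂ) →
  AffineFunction (λ x → ψ (s ∷ x)) → AffineFunction ψ
one-sided {N} {ψ} s ψ≈0 (affineFunction c A αs value) = affineFunction c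
  -- The new row evaluates to `a xor s`, the bit `s` being multiplied by the final 1 of the point;
  -- it confines the support to the half with first bit `s`.
  ((true ∷ (𝟎 ∷ʳ s)) ∷ List.map (false ∷_) A) (List.map (false ∷_) αs) λ { (a ∷ x) → begin
  ψ (a ∷ x)
    ≈⟨ sides s a x ψ≈0 value ⟩
  c * indicator (not (a xor s) ∧ vanishes A (x ∷ʳ true)) * i^ exponent αs (x ∷ʳ true)
    ≡⟨ cong₂ (λ b e → c * indicator b * i^ e)
         (cong₂ (λ t v → not (a xor t) ∧ v) (selector x)
           (vanishes-map (false ∷_) {z′ = a ∷ (x ∷ʳ true)} (λ _ → refl) A))
         (exponent-map (false ∷_) {z′ = a ∷ (x ∷ʳ true)} (λ _ → refl) αs) ⟨
  c * indicator (not (a xor ⟨ 𝟎 ∷ʳ s , x ∷ʳ true ⟩) ∧ vanishes (List.map (false ∷_) A) (a ∷ (x ∷ʳ true)))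
    * i^ exponent (List.map (false ∷_) αs) (a ∷ (x ∷ʳ true))
    ∎ }
  where
  selector : ∀ x → ⟨ 𝟎 ∷ʳ s , x ∷ʳ true ⟩ ≡ s
  selector x = trans (⟨⟩-∷ʳ 𝟎 x s true) (trans (cong (_xor (s ∧ true)) (⟨⟩-𝟎ˡ x)) (∧-identityʳ s))
  off : ∀ {z} w → z ≈ 0ℂ → z ≈ c * 0ℂ * w
  off w z≈0 = ≈-trans z≈0 (≈-sym (≈-trans (*-congʳ (zeroʳ c)) (zeroˡ w)))
  sides : ∀ s a x → (∀ x → ψ (not s ∷ x) ≈ 0ℂ) →
    (∀ x → ψ (s ∷ x) ≈ c * indicator (vanishes A (x ∷ʳ true)) * i^ exponent αs (x ∷ʳ true)) →
    ψ (a ∷ x) ≈ c * indicator (not (a xor s) ∧ vanishes A (x ∷ʳ true)) * i^ exponent αs (x ∷ʳ true)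
  sides false false x ψ≈0 value = value x
  sides false true  x ψ≈0 value = off _ (ψ≈0 x)
  sides true  false x ψ≈0 value = off _ (ψ≈0 x)
  sides true  true  x ψ≈0 value = value x

-- The relation evaluates ψ at `a ∷ x` as the first half at x plus a times `w`, multiplied when a =
-- 1 by `i^ k` and by a sign linear in x. The substitution is realised by `shear`, the power by k
-- copies of the first coordinate, and the sign, now quadratic in `(a , x)`, by `sign-forms`.
two-sided : ∀ {N} {ψ : Bits (suc N) → ℂ} {w} → Differs ψ (true ∷ w) →
  AffineFunction (λ x → ψ (false ∷ x)) → AffineFunction ψ
two-sided {N} {ψ} {w} (differs {d} (k , d≈) (s ∷ ℓ) difference) (affineFunction c A αs value) = affineFunction c
  (List.map shear A) (List.map shear αs List.++ (List.replicate k head-form List.++ sign-forms m))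
  λ { (a ∷ x) → ≈-trans (sides a x) (≈-sym (*-cong
    (*-congˡ (reflexive (cong indicator (vanishes-map shear (⟨⟩-shear a x) A))))
    (≈-trans (i^-exponent-++ (List.map shear αs) _ (a ∷ (x ∷ʳ true)))
    (*-cong (reflexive (cong i^_ (exponent-map shear (⟨⟩-shear a x) αs)))
      (≈-trans (i^-exponent-++ (List.replicate k head-form) (sign-forms m) (a ∷ (x ∷ʳ true)))
        (*-cong (head-power a (x ∷ʳ true) k) (head-sign a (x ∷ʳ true) m))))))) }
  where
  ŵ = w ∷ʳ false
  -- The slope is evaluated at `x ⊕ w`; the last bit of `m` carries the resulting constant.
  m = ℓ ∷ʳ ⟨ ℓ , w ⟩
  shear : Bits (suc N) → Bits (suc (suc N))
  shear r = ⟨ r , ŵ ⟩ ∷ r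
  moved : Bool → Bits N → Bits (suc N)
  moved a x = (x ∷ʳ true) ⊕ scale a ŵ
  ⟨⟩-shear : ∀ a x r → ⟨ shear r , a ∷ (x ∷ʳ true) ⟩ ≡ ⟨ r , moved a x ⟩
  ⟨⟩-shear a x r = sym (trans (⟨⟩-⊕ʳ r (x ∷ʳ true) (scale a ŵ))
    (trans (xor-comm ⟨ r , x ∷ʳ true ⟩ ⟨ r , scale a ŵ ⟩) (cong (_xor ⟨ r , x ∷ʳ true ⟩)
      (trans (⟨⟩-comm r (scale a ŵ)) (trans (⟨⟩-scale a ŵ r)
        (trans (∧-comm a ⟨ ŵ , r ⟩) (cong (_∧ a) (⟨⟩-comm ŵ r))))))))
  ⟨⟩-m : ∀ x → ⟨ m , x ∷ʳ true ⟩ ≡ ⟨ ℓ , x ⊕ w ⟩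
  ⟨⟩-m x = trans (⟨⟩-∷ʳ ℓ x ⟨ ℓ , w ⟩ true)
    (trans (cong (⟨ ℓ , x ⟩ xor_) (∧-identityʳ ⟨ ℓ , w ⟩)) (sym (⟨⟩-⊕ʳ ℓ x w)))
  sides : ∀ a x → ψ (a ∷ x) ≈ c * indicator (vanishes A (moved a x)) *
    (i^ exponent αs (moved a x) * ((if a then i^ k else 1ℂ) * sgn (a ∧ ⟨ m , x ∷ʳ true ⟩)))
  sides false x = begin
    ψ (false ∷ x)
      ≈⟨ value x ⟩
    c * indicator (vanishes A (x ∷ʳ true)) * i^ exponent αs (x ∷ʳ true)
      ≡⟨ cong (λ z → c * indicator (vanishes A z) * i^ exponent αs z) (⊕-identityʳ (x ∷ʳ true)) ⟨
    c * indicator (vanishes A (moved false x)) * i^ exponent αs (moved false x)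
      ≈⟨ *-congˡ (≈-trans (*-congˡ (*-identityˡ 1ℂ)) (*-identityʳ _)) ⟨
    c * indicator (vanishes A (moved false x)) * (i^ exponent αs (moved false x) * (1ℂ * 1ℂ))
      ∎
  sides true x = begin
    ψ (true ∷ x)
      ≡⟨ cong (λ z → ψ (true ∷ z)) (⊕-cancelʳ x w) ⟨
    ψ ((false ∷ (x ⊕ w)) ⊕ (true ∷ w))
      ≈⟨ difference (false ∷ (x ⊕ w)) ⟩
    d * (sgn ((s ∧ false) xor ⟨ ℓ , x ⊕ w ⟩) * ψ (false ∷ (x ⊕ w)))
      ≈⟨ *-cong d≈ (*-cong
           (reflexive (cong sgn (trans (cong (_xor ⟨ ℓ , x ⊕ w ⟩) (∧-zeroʳ s)) (sym (⟨⟩-m x)))))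
           (≈-trans (value (x ⊕ w)) (reflexive (cong (λ z → c * indicator (vanishes A z) * i^ exponent αs z)
             (sym (⊕-∷ʳ x w true false)))))) ⟩
    i^ k * (sgn ⟨ m , x ∷ʳ true ⟩ * (c * indicator (vanishes A (moved true x)) * i^ exponent αs (moved true x)))
      ≈⟨ solve 5 (λ k s c χ p → k ⊗ (s ⊗ ((c ⊗ χ) ⊗ p)) ⊜ (c ⊗ χ) ⊗ (p ⊗ (k ⊗ s))) ≈-refl
           (i^ k) (sgn ⟨ m , x ∷ʳ true ⟩) c (indicator (vanishes A (moved true x))) (i^ exponent αs (moved true x)) ⟩
    c * indicator (vanishes A (moved true x)) * (i^ exponent αs (moved true x) * (i^ k * sgn ⟨ m , x ∷ʳ true ⟩))
      ∎

-- Split off the first bit: if both halves are nonzero, a difference relation expresses one by the other.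
recognise-affine : ∀ N (ψ : Bits N → ℂ) → (∀ x → Invertible (ψ x) ⊎ ψ x ≈ 0ℂ) →
  (∀ x w → Invertible (ψ x) → Invertible (ψ (x ⊕ w)) → Differs ψ w) → AffineFunction ψ
-- A single value serves as the coefficient, even if it is zero.
recognise-affine zero    ψ decide relate = affineFunction (ψ []) [] [] λ { [] →
  ≈-sym (≈-trans (*-cong (*-identityʳ (ψ [])) (reflexive i^-zero)) (*-identityʳ (ψ []))) }
recognise-affine (suc N) ψ decide relate = combine
  (search N λ x → decide (false ∷ x)) (search N λ x → decide (true ∷ x))
  where
  half : ∀ a → AffineFunction (λ x → ψ (a ∷ x))
  half a = recognise-affine N (λ x → ψ (a ∷ x)) (λ x → decide (a ∷ x)) λ x w ≠0 ≠0′ →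
    half-differs a (relate (a ∷ x) (false ∷ w) ≠0
      (subst (λ b → Invertible (ψ (b ∷ (x ⊕ w)))) (sym (xor-identityʳ a)) ≠0′))
  combine : (∃[ x ] Invertible (ψ (false ∷ x))) ⊎ (∀ x → ψ (false ∷ x) ≈ 0ℂ) →
    (∃[ x ] Invertible (ψ (true ∷ x))) ⊎ (∀ x → ψ (true ∷ x) ≈ 0ℂ) → AffineFunction ψ
  -- This case includes ψ = 0: the other half is affine in any event.
  combine (inj₂ ψ≈0)      _               = one-sided true ψ≈0 (half true)
  combine (inj₁ _)        (inj₂ ψ≈0)      = one-sided false ψ≈0 (half false)
  combine (inj₁ (x , ≠0)) (inj₁ (y , ≠0′)) = two-sided
    (relate (false ∷ x) (true ∷ (x ⊕ y)) ≠0 (subst (λ z → Invertible (ψ (true ∷ z))) (sym (⊕-cancelˡ x y)) ≠0′))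
    (half false)

-- Entries of a Clifford unitary

join-injective : ∀ {n} {x y x′ y′ : Bits n} → join x y ≡ join x′ y′ → x ≡ x′ × y ≡ y′
join-injective {x = x} {y} {x′} {y′} eq =
  let x≡ , y≡ = ++-injective x x′ eq in x≡ , reverse-injective y≡

rational-𝟙 : ∀ {n} (x y : Bits n) → Rational (𝟙 x y)
rational-𝟙 x y = decide (x ≟ y)
  where
  decide : Dec (x ≡ y) → Rational (𝟙 x y)
  decide (yes refl) = 1ℚ , 0ℚ , 𝟙-refl x
  decide (no x≢y)   = 0ℚ , 0ℚ , 𝟙-≢ x≢y

module CliffordEntries {n} (U : Mat n) (U⊥ : Orthonormal U) (U∈ : Clifford U) where

  private
    z-row z-sign : Bits n → Bits n
    z-row b  = proj₁ (U∈ 𝟎 b)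
    z-sign b = proj₁ (proj₂ (U∈ 𝟎 b))

    z-intertwines : ∀ b → Intertwines U (z-row b) (z-sign b) 𝟎 b
    z-intertwines b = proj₂ (proj₂ (U∈ 𝟎 b))

    -- The entries of U Z^b U†.
    z-image : Bits n → Mat n
    z-image b x′ x = Intertwines.scalar (z-intertwines b) * sgn ⟨ z-sign b , x′ ⊕ z-row b ⟩ * 𝟙 (x′ ⊕ z-row b) x

    -- e_y e_y† = 2⁻ⁿ Σ_b (-1)^⟨b,y⟩ Z^b, conjugated by U.
    projector : ∀ x′ x y → 2^ n * (U x′ y * conj (U x y)) ≈ Σ[ n ] (λ b → sgn ⟨ b , y ⟩ * z-image b x′ x)
    projector x′ x y = begin
      2^ n * E y
        ≈⟨ Σ-𝟙 n y (λ z → 2^ n * E z) ⟨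
      Σ[ n ] (λ z → 𝟙 y z * (2^ n * E z))
        ≈⟨ Σ-cong n (λ z → begin
           𝟙 y z * (2^ n * E z)
             ≈⟨ solve 3 (λ e t m → e ⊗ (t ⊗ m) ⊜ (t ⊗ e) ⊗ m) ≈-refl (𝟙 y z) (2^ n) (E z) ⟩
           2^ n * 𝟙 y z * E z
             ≈⟨ *-congʳ (Σ-sgn n y z) ⟨
           Σ[ n ] (λ b → sgn ⟨ b , y ⊕ z ⟩) * E z
             ≈⟨ Σ-* (E z) n (λ b → sgn ⟨ b , y ⊕ z ⟩) ⟩
           Σ[ n ] (λ b → sgn ⟨ b , y ⊕ z ⟩ * E z)
             ∎) ⟩
      Σ[ n ] (λ z → Σ[ n ] (λ b → sgn ⟨ b , y ⊕ z ⟩ * E z))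
        ≈⟨ Σ-swap n n (λ z b → sgn ⟨ b , y ⊕ z ⟩ * E z) ⟩
      Σ[ n ] (λ b → Σ[ n ] (λ z → sgn ⟨ b , y ⊕ z ⟩ * E z))
        ≈⟨ Σ-cong n (λ b → begin
           Σ[ n ] (λ z → sgn ⟨ b , y ⊕ z ⟩ * E z)
             ≈⟨ Σ-cong n (λ z → begin
                sgn ⟨ b , y ⊕ z ⟩ * E z
                  ≈⟨ *-congʳ (≈-trans (reflexive (cong sgn (⟨⟩-⊕ʳ b y z))) (sgn-xor ⟨ b , y ⟩ ⟨ b , z ⟩)) ⟩
                sgn ⟨ b , y ⟩ * sgn ⟨ b , z ⟩ * E z
                  ≈⟨ solve 4 (λ s t m k → (s ⊗ t) ⊗ (m ⊗ k) ⊜ s ⊗ ((m ⊗ t) ⊗ k)) ≈-refl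
                       (sgn ⟨ b , y ⟩) (sgn ⟨ b , z ⟩) (U x′ z) (conj (U x z)) ⟩
                sgn ⟨ b , y ⟩ * (U x′ z * sgn ⟨ b , z ⟩ * conj (U x z))
                  ≡⟨ cong (λ t → sgn ⟨ b , y ⟩ * (U x′ t * sgn ⟨ b , z ⟩ * conj (U x z))) (⊕-identityʳ z) ⟨
                sgn ⟨ b , y ⟩ * (U x′ (z ⊕ 𝟎) * sgn ⟨ b , z ⟩ * conj (U x z))
                  ∎) ⟩
           Σ[ n ] (λ z → sgn ⟨ b , y ⟩ * (U x′ (z ⊕ 𝟎) * sgn ⟨ b , z ⟩ * conj (U x z)))
             ≈⟨ *-Σ (sgn ⟨ b , y ⟩) n (λ z → U x′ (z ⊕ 𝟎) * sgn ⟨ b , z ⟩ * conj (U x z)) ⟨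
           sgn ⟨ b , y ⟩ * Σ[ n ] (λ z → U x′ (z ⊕ 𝟎) * sgn ⟨ b , z ⟩ * conj (U x z))
             ≈⟨ *-congˡ (intertwines-conjugate U U⊥ {z-row b} {z-sign b} {𝟎} {b}
                  (Intertwines.relation (z-intertwines b)) x′ x) ⟩
           sgn ⟨ b , y ⟩ * z-image b x′ x
             ∎) ⟩
      Σ[ n ] (λ b → sgn ⟨ b , y ⟩ * z-image b x′ x)
        ∎
      where
      E : Bits n → ℂ
      E z = U x′ z * conj (U x z)

    -- Conjugation removes the arbitrary phase of `U`. By `projector`, 2ⁿ times the product is a sum
    -- of phases and zeros, hence a Gaussian rational.
    product-decide : ∀ x′ x y → Invertible (U x′ y * conj (U x y)) ⊎ U x′ y * conj (U x y) ≈ 0ℂ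
    product-decide x′ x y = decide (rational-decide (subst-rational (Σ-closed {Rational} rational-+ n λ b →
        rational-* (phase-rational (phase-sgn ⟨ b , y ⟩))
          (rational-* (phase-rational (phase-* (Intertwines.phase (z-intertwines b))
                                               (phase-sgn ⟨ z-sign b , x′ ⊕ z-row b ⟩)))
                      (rational-𝟙 (x′ ⊕ z-row b) x)))))
      where
      subst-rational : Rational (Σ[ n ] (λ b → sgn ⟨ b , y ⟩ * z-image b x′ x)) →
        Rational (2^ n * (U x′ y * conj (U x y)))
      subst-rational (p , q , ≈pq) = p , q , ≈-trans (projector x′ x y) ≈pq
      decide : 2^ n * (U x′ y * conj (U x y)) ≈ 0ℂ ⊎ Invertible (2^ n * (U x′ y * conj (U x y))) →
        Invertible (U x′ y * conj (U x y)) ⊎ U x′ y * conj (U x y) ≈ 0ℂ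
      decide (inj₁ ≈0) = inj₂ (*-cancelˡ-invertible (2^-invertible n) (≈-trans ≈0 (≈-sym (zeroʳ (2^ n)))))
      decide (inj₂ ≠0) = inj₁ (invertible-factorʳ ≠0)

  -- One invertible product makes the entry invertible. If the products with all entries of the
  -- column vanish, then so does the conjugate entry times the squared norm of the column, which is
  -- 1. This avoids extracting a zero from a vanishing squared modulus.
  entry-decide : ∀ x y → Invertible (U x y) ⊎ U x y ≈ 0ℂ
  entry-decide x y = decide (search n λ x′ → product-decide x′ x y)
    where
    conj-back : ∀ {z w} → conj z ≈ conj w → z ≈ w
    conj-back {z} {w} eq = ≈-trans (≈-sym (conj-involutive z)) (≈-trans (conj-cong eq) (conj-involutive w))
    decide : (∃[ x′ ] Invertible (U x′ y * conj (U x y))) ⊎ (∀ x′ → U x′ y * conj (U x y) ≈ 0ℂ) →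
      Invertible (U x y) ⊎ U x y ≈ 0ℂ
    decide (inj₁ (_ , ≠0)) = inj₁
      (invertible-resp (conj-involutive (U x y)) (invertible-conj (invertible-factorʳ ≠0)))
    decide (inj₂ ≈0) = inj₂ (conj-back (begin
      conj (U x y)
        ≈⟨ *-identityˡ _ ⟨
      1ℂ * conj (U x y)
        ≈⟨ *-congʳ (≈-trans (columns U⊥ y y) (𝟙-refl y)) ⟨
      gram U y y * conj (U x y)
        ≈⟨ Σ-* (conj (U x y)) n (λ x′ → conj (U x′ y) * U x′ y) ⟩
      Σ[ n ] (λ x′ → conj (U x′ y) * U x′ y * conj (U x y))
        ≈⟨ Σ-zero n (λ x′ → ≈-trans (*-assoc _ _ _) (≈-trans (*-congˡ (≈0 x′)) (zeroʳ _))) ⟩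
      0ℂ
        ≈⟨ conj-0 ⟨
      conj 0ℂ
        ∎))

  private
    -- In `projector` for these two entries, the summand of `b` vanishes unless `z-row b` equals
    -- `t`. The product of the entries is invertible, so some `b` has this row shift.
    same-column : ∀ x t y → Invertible (U x y) → Invertible (U (x ⊕ t) y) → ∃[ w ] ∃[ b ] Intertwines U t w 𝟎 b
    same-column x t y ≠0 ≠0′ = decide (search n λ b → ≟-decide (x ⊕ z-row b) (x ⊕ t))
      where
      ≟-decide : ∀ (x y : Bits n) → x ≡ y ⊎ x ≢ y
      ≟-decide x y = from-dec (x ≟ y)
        where
        from-dec : Dec (x ≡ y) → x ≡ y ⊎ x ≢ y
        from-dec (yes eq) = inj₁ eq
        from-dec (no neq) = inj₂ neq
      decide : (∃[ b ] x ⊕ z-row b ≡ x ⊕ t) ⊎ (∀ b → x ⊕ z-row b ≢ x ⊕ t) → ∃[ w ] ∃[ b ] Intertwines U t w 𝟎 b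
      decide (inj₁ (b , eq)) = z-sign b , b , intertwines-resp U
        (trans (sym (⊕-cancelˡ x (z-row b))) (trans (cong (x ⊕_) eq) (⊕-cancelˡ x t)))
        refl refl refl (z-intertwines b)
      decide (inj₂ none) = ⊥-elim (invertible⇒≉0
        (invertible-product (2^-invertible n) (invertible-product ≠0 (invertible-conj ≠0′)))
        (≈-trans (projector x (x ⊕ t) y) (Σ-zero n λ b →
          ≈-trans (*-congˡ (≈-trans (*-congˡ (𝟙-≢ (none b))) (zeroʳ _))) (zeroʳ _))))

  -- The relation of X^v takes the first entry to a nonzero entry in the column of the second, with
  -- an uncontrolled row shift `u′`; `same-column` supplies the remaining shift `u′ ⊕ u`.
  entries-related : ∀ x y u v → Invertible (U x y) → Invertible (U (x ⊕ u) (y ⊕ v)) →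
    ∃[ w ] ∃[ b ] Intertwines U u w v b
  entries-related x y u v ≠0 ≠0′ =
    let u′ , w′ , U∼ = U∈ v 𝟎
        _ , _ , U∼′ = same-column (x ⊕ u′) (u′ ⊕ u) (y ⊕ v)
          (invertible-resp (≈-sym (Intertwines.relation U∼ x y))
            (invertible-product (phase-invertible (Intertwines.phase U∼))
            (invertible-product (phase-invertible (phase-sgn (⟨ w′ , x ⟩ xor ⟨ 𝟎 , y ⟩))) ≠0)))
          (subst (λ t → Invertible (U t (y ⊕ v)))
            (sym (trans (⊕-assoc x u′ (u′ ⊕ u)) (cong (x ⊕_) (⊕-cancelˡ u′ u)))) ≠0′)
    in _ , _ , intertwines-resp U (⊕-cancelˡ u′ u) refl (⊕-identityʳ v) refl (intertwines-⊕ U U∼ U∼′)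

  private
    row column : Bits (n ℕ.+ n) → Bits n
    row z    = proj₁ (unjoin {n} z)
    column z = proj₁ (proj₂ (unjoin {n} z))

    z≡join : ∀ z → z ≡ join (row z) (column z)
    z≡join z = proj₂ (proj₂ (unjoin {n} z))

    ψ : Bits (n ℕ.+ n) → ℂ
    ψ z = U (row z) (column z)

    ψ-join : ∀ x y → ψ (join x y) ≡ U x y
    ψ-join x y = let x≡ , y≡ = join-injective {n} (z≡join (join x y)) in sym (cong₂ U x≡ y≡)

    ψ-⊕ : ∀ z w → ψ (z ⊕ w) ≡ U (row z ⊕ row w) (column z ⊕ column w)
    ψ-⊕ z w = trans (cong ψ (trans (cong₂ _⊕_ (z≡join z) (z≡join w)) (join-⊕ (row z) (column z) (row w) (column w))))
      (ψ-join (row z ⊕ row w) (column z ⊕ column w))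

    ψ-differs : ∀ w {s b} → Intertwines U (row w) s (column w) b → Differs ψ w
    ψ-differs w {s} {b} (intertwines {c} c∈ relation) = differs c∈ (join s b) λ z → begin
      ψ (z ⊕ w)
        ≡⟨ ψ-⊕ z w ⟩
      U (row z ⊕ row w) (column z ⊕ column w)
        ≈⟨ relation (row z) (column z) ⟩
      c * (sgn (⟨ s , row z ⟩ xor ⟨ b , column z ⟩) * ψ z)
        ≡⟨ cong (λ t → c * (sgn t * ψ z)) (trans (cong ⟨ join s b ,_⟩ (z≡join z)) (⟨⟩-join s b (row z) (column z))) ⟨
      c * (sgn ⟨ join s b , z ⟩ * ψ z)
        ∎

  signature : Bits (n ℕ.+ n) → ℂ
  signature = ψ

  signature-affine : AffineFunction signature
  signature-affine = recognise-affine (n ℕ.+ n) ψ (λ z → entry-decide (row z) (column z)) λ z w ≠0 ≠0′ →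
    let _ , _ , U∼ = entries-related (row z) (column z) (row w) (column w) ≠0 (subst Invertible (ψ-⊕ z w) ≠0′)
    in ψ-differs w U∼

  matrix-signature : ∀ x y → U x y ≈ signature (join x y)
  matrix-signature x y = reflexive (sym (ψ-join x y))

normalizer⇒𝒢𝒜 : ∀ {n} {U : Mat n} → PauliNormalizer n U → 𝒢𝒜 n U
normalizer⇒𝒢𝒜 {n} {U} U∈@(U-unitary@(UU†≋𝟙 , U†U≋𝟙) , _) =
  (U † , UU†≋𝟙 , U†U≋𝟙) , signature , affineFunction⇒isAffine signature-affine , matrix-signature
  where open CliffordEntries U (unitary⇒orthonormal U U-unitary) (normalizer⇒clifford U U∈)

-- Nonzero multiples of affine matrices are affine, whereas the Clifford group consists of
-- unitaries. The quotient is therefore formed from the unitary members, and the first component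
-- ensures that scaling makes every nonsingular affine matrix unitary.
theorem2p4 : (n : ℕ) →
    (𝒢𝒜 n ⊆ (λ M → ∃[ c ] (Nonzero c × Unitary n (c • M))))
    × (((𝒢𝒜 n ∩ Unitary n) /U⟨1⟩) ≐ 𝒞 n)
theorem2p4 n = (λ {M} → affine⇒scaled-unitary {n} {M})
  , (λ (V , (V∈ , V-unitary) , M∼V) → V , 𝒢𝒜∩unitary⇒normalizer {n} {V} V∈ V-unitary , M∼V)
  , (λ (V , V∈@(V-unitary , _) , M∼V) → V , (normalizer⇒𝒢𝒜 {n} {V} V∈ , V-unitary) , M∼V)
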